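{- Let $P$ be a set of $n$ points in the Euclidean plane with at most $l$ of them collinear. Then $P$ determines at least $\dfrac{1}{61}n(n-l)$ lines.
   Context: A line is determined by $P$ if it contains at least two points of $P$. -}

module Defs where

open import Level using (0ℓ)
open import Data.Nat as ℕ using (ℕ)
open import Data.Product using (Σ; ∃; _×_; _,_)
open import Data.Sum using (_⊎_)
open import Data.List using (List; length; filter)
open import Data.List.Membership.Propositional using (_∈_)
open import Data.List.Relation.Unary.All using (All)
open import Data.List.Relation.Unary.AllPairs using (AllPairs)
open import Relation.Nullary using (¬_; Dec)
open import Relation.Binary.PropositionalEquality using (_≡_; _≢_)
open import Algebra.Structures using (IsCommutativeRing)
open import Relation.Binary.Structures using (IsStrictTotalOrder)

-- An axiomatisation of the real numbers: a (Dedekind-)complete ordered field.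
-- Classically every model is isomorphic to ℝ, so quantifying over all
-- models is the same as talking about the Euclidean plane ℝ².
record RealField : Set₁ where
  infixl 6 _+_ _-_
  infixl 7 _*_
  infix 4 _<_ _≤_
  field
    Carrier : Set
    0# 1#   : Carrier
    _+_ _*_ : Carrier → Carrier → Carrier
    -_      : Carrier → Carrier
    _<_     : Carrier → Carrier → Set
    isCommutativeRing : IsCommutativeRing _≡_ _+_ _*_ -_ 0# 1#
    0≢1     : 0# ≢ 1#
    inv     : (x : Carrier) → x ≢ 0# → Carrier
    inv-law : (x : Carrier) (x≢0 : x ≢ 0#) → x * inv x x≢0 ≡ 1#
    isStrictTotalOrder : IsStrictTotalOrder _≡_ _<_
    +-mono-< : ∀ {x y} z → x < y → x + z < y + z
    *-pos    : ∀ {x y} → 0# < x → 0# < y → 0# < x * y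

  _-_ : Carrier → Carrier → Carrier
  x - y = x + (- y)

  _≤_ : Carrier → Carrier → Set
  x ≤ y = (x < y) ⊎ (x ≡ y)

  field
    complete : (S : Carrier → Set) → (∃ λ x → S x) →
               (∃ λ b → ∀ x → S x → x ≤ b) →
               ∃ λ s → (∀ x → S x → x ≤ s) × (∀ b → (∀ x → S x → x ≤ b) → s ≤ b)



module _ (R : RealField) where
  open RealField R
  _≟ℝ_ : (x y : RealField.Carrier R) → Dec (x ≡ y)
  _≟ℝ_ = IsStrictTotalOrder._≟_ isStrictTotalOrder

module Plane (R : RealField) where
  open RealField R

  Point : Set
  Point = Carrier × Carrier

  Collinear : Point → Point → Point → Set
  Collinear (px , py) (qx , qy) (rx , ry) =
    (qx - px) * (ry - py) ≡ (qy - py) * (rx - px)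

  pointsOnLine : Carrier → Carrier → Carrier → List Point → ℕ
  pointsOnLine a b c P = length (filter (λ { (x , y) → _≟ℝ_ R (a * x + b * y) c }) P)

  AtMostCollinear : List Point → ℕ → Set
  AtMostCollinear P l = ∀ a b c → ¬ (a ≡ 0# × b ≡ 0#) → pointsOnLine a b c P ℕ.≤ l

  -- P determines at least m distinct lines: m pairs of distinct points of P,
  -- no two of which span the same line.
  DeterminesAtLeast : List Point → ℕ → Set
  DeterminesAtLeast P m =
    Σ (List (Point × Point)) λ ls →
      length ls ≡ m ×
      All (λ { (p , q) → p ∈ P × q ∈ P × p ≢ q }) ls ×
      AllPairs (λ { (p , q) (p' , q') → ¬ (Collinear p q p' × Collinear p q q') }) ls

{-# OPTIONS --safe #-}
-- Let x be the number of points on a line determined by the n points, and L the number of these lines.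
--
-- Melchior's inequality, in the form Σ (x − 1) ≤ 2 L for points that are not all collinear: turn the line through
-- two consecutive points p, q of a line counterclockwise until it becomes the line ℓ joining p or q to a third
-- point. Then p (or q) is the first or the last point of ℓ, and this end of ℓ determines the pair p, q.
-- If a richest line has X ≥ 3 n / 61 points, every other point lies on at least X lines, so X (n − X) ≤ Σ x ≤ 3 L.
--
-- Otherwise count pairs: n (n − 1) = Σ x (x − 1). A plane straight-line graph on m points has at most 3 m edges,
-- because in a sweep each edge is charged to an end of it or to the last point seen in the wedge below it.
-- So e ≤ 3 m + (number of crossings) in general, and random sampling of the points amplifies this. Applied to the
-- segments between consecutive points on rich lines, which cross at most once for every pair of lines, it gives
-- Σ max(x − 1 − k, 0) ≤ 5 n² / k² for k² ≤ n, while a count of incidences bounds the sum by n for k² ≥ n.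
-- Few pairs therefore lie on rich lines, and Melchior's inequality, both for all points and averaged over
-- the random subsets with probability 1/2, bounds the number of lines that carry the remaining pairs.

module Submission where

open import Defs
open import Algebra.Bundles using (CommutativeRing)
import Algebra.Properties.Ring as RingProperties
import Algebra.Properties.Semiring.Mult as SemiringMult
import Algebra.Solver.Ring as RingSolver
open import Algebra.Solver.Ring.AlmostCommutativeRing using (fromCommutativeRing; _-Raw-AlmostCommutative⟶_)
open import Data.Bool using (Bool; true; false)
open import Data.Empty using (⊥; ⊥-elim)
open import Data.Fin using (Fin; zero; suc)
open import Data.Integer.Base as ℤ using (ℤ; -[1+_]; _⊖_; 0ℤ) renaming (+_ to pos)
import Data.Integer.Properties as ℤₚ
open import Data.List using (List; []; _∷_; _++_; length; filter; map; cartesianProduct; allFin)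
open import Data.List.Membership.Propositional using (_∈_; find; lose)
open import Data.List.Membership.Propositional.Properties using (∈-filter⁺; ∈-filter⁻; ∈-allFin;
  ∈-cartesianProduct⁺; ∈-cartesianProduct⁻; ∈-map⁺; ∈-++⁺ˡ; ∈-++⁺ʳ; ∈-length)
open import Data.List.Properties using (length-++; length-map; length-filter)
open import Data.List.Relation.Binary.Sublist.Propositional using (_⊆_; []; _∷_; _∷ʳ_) renaming (lookup to ⊆-lookup)
open import Data.List.Relation.Binary.Sublist.Propositional.Properties using (All-resp-⊆; length-mono-≤)
open import Data.List.Relation.Unary.All as All using (All; []; _∷_; all?)
open import Data.List.Relation.Unary.AllPairs as AllPairs using (AllPairs; []; _∷_)
open import Data.List.Relation.Unary.Any using (Any; here; there; _─_; any?)
open import Data.List.Relation.Unary.Unique.Propositional using (Unique)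
import Data.List.Relation.Unary.Unique.Propositional.Properties as Unique
open import Data.Maybe using (Maybe; just; nothing)
open import Data.Nat as ℕ using (ℕ; zero; suc; z≤n; s≤s; _∸_; NonZero)
import Data.Nat.Properties as ℕ
open import Data.Nat.Solver using (module +-*-Solver)
open import Data.Product using (∃; _×_; _,_; proj₁; proj₂)
open import Data.Product.Properties using (≡-dec)
open import Data.Sum using (_⊎_; inj₁; inj₂; [_,_]′)
open import Data.Unit using (⊤)
open import Function using (id)
open import Relation.Binary using (tri<; tri≈; tri>)
open import Relation.Binary.PropositionalEquality
open import Relation.Binary.Structures using (IsStrictTotalOrder)
open import Relation.Nullary using (Dec; ¬_; yes; no)
open import Relation.Nullary.Decidable using (_×-dec_; _⊎-dec_; ¬?; toSum)

-- Melchior's inequality and the bound for plane graphs are usually read off Euler's formula. Here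
-- both are injections into a list of charges, checked by signs of areas and three-term determinant
-- identities, so that no faces have to be defined. One linear functional `ξ`, injective on the
-- points, serves as abscissa: every line has a first and a last point and every edge a left and a
-- right end, with no vertical case. The two uses of Melchior's inequality are different
-- constraints. For all points a line breaks even at 3 points, so only two-point lines pay for long
-- ones. In a random half it breaks even between 5 and 6 points, so lines with 3, 4 and 5 points pay
-- too. The constant 61 leaves room above what the pair count yields, namely n² ≤ a L + (c + e X) n
-- with a = 54 for n ≤ 2500 and a = 48 beyond, where X is the size of a richest line. The term e X n
-- arises because the bound n for a tail of the distribution is summed over up to X tails; it is
-- harmless only when X is a small fraction of n, which is why a very rich line is treated apart.
-- The split at 2500 = 50² makes incidences alone sufficient for small n and the linear terms small
-- for large n.

module _ {A : Set} {Q : A → Set} (_≼_ : A → A → Set) (total : ∀ a b → a ≼ b ⊎ b ≼ a)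
         (transitive : ∀ {a b c} → Q a → Q b → Q c → a ≼ b → b ≼ c → a ≼ c) where

  -- Transitivity is assumed on `Q` only, because directions are cyclically ordered: they form a
  -- linear order only inside a half-plane, and for angles `Q` is membership in one.
  least : ∀ x xs → All Q (x ∷ xs) → ∃ λ m → m ∈ x ∷ xs × (∀ {y} → y ∈ x ∷ xs → m ≼ y)
  least x [] _ = x , here refl , λ { (here refl) → [ id , id ]′ (total x x) }
  least x (x′ ∷ xs) (qx ∷ qs) with least x′ xs qs
  ... | m , m∈ , m-least with total x m
  ...   | inj₂ m≼x = m , there m∈ , λ { (here refl) → m≼x ; (there y∈) → m-least y∈ }
  ...   | inj₁ x≼m = x , here refl , λ
          { (here refl) → [ id , id ]′ (total x x)
          ; (there y∈) → transitive qx (All.lookup qs m∈) (All.lookup qs y∈) x≼m (m-least y∈) }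

  least-∈ : ∀ {x} xs → x ∈ xs → (∀ {y} → y ∈ xs → Q y) → ∃ λ m → m ∈ xs × (∀ {y} → y ∈ xs → m ≼ y)
  least-∈ (x ∷ xs) _ qs = least x xs (All.tabulate qs)

-- Counting in lists by injections.

∈-─⁺ : ∀ {A : Set} {x y : A} {xs} (x∈ : x ∈ xs) → y ∈ xs → y ≢ x → y ∈ (xs ─ x∈)
∈-─⁺ (here refl) (here refl) y≢x = ⊥-elim (y≢x refl)
∈-─⁺ (here refl) (there y∈) y≢x = y∈
∈-─⁺ (there x∈) (here refl) y≢x = here refl
∈-─⁺ (there x∈) (there y∈) y≢x = there (∈-─⁺ x∈ y∈ y≢x)

length-─ : ∀ {A : Set} {x : A} {xs} (x∈ : x ∈ xs) → length xs ≡ suc (length (xs ─ x∈))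
length-─ (here _) = refl
length-─ (there x∈) = cong suc (length-─ x∈)

-- `R` is a relation and not a function so that a charging scheme can be an inductive family: that
-- every element has a charge and that no charge is used twice are then proved independently.
pigeonhole : ∀ {A B : Set} (R : A → B → Set) (xs : List A) (ys : List B) → Unique xs →
             (∀ {x} → x ∈ xs → ∃ λ y → y ∈ ys × R x y) →
             (∀ {x x′ y} → x ∈ xs → x′ ∈ xs → R x y → R x′ y → x ≡ x′) →
             length xs ℕ.≤ length ys
pigeonhole R [] ys _ _ _ = z≤n
pigeonhole R (x ∷ xs) ys (x∉ ∷ unique) image injective with image (here refl)
... | y , y∈ , Rxy = subst (suc (length xs) ℕ.≤_) (sym (length-─ y∈))
  (s≤s (pigeonhole R xs (ys ─ y∈) unique image′ (λ p q → injective (there p) (there q))))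
  where
  image′ : ∀ {x′} → x′ ∈ xs → ∃ λ y′ → y′ ∈ (ys ─ y∈) × R x′ y′
  image′ x′∈ with image (there x′∈)
  ... | y′ , y′∈ , Rx′y′ = y′ , ∈-─⁺ y∈ y′∈
        (λ { refl → All.lookup x∉ x′∈ (injective (here refl) (there x′∈) Rxy Rx′y′) }) , Rx′y′

length-cartesianProduct : ∀ {A B : Set} (xs : List A) (ys : List B) →
                          length (cartesianProduct xs ys) ≡ length xs ℕ.* length ys
length-cartesianProduct [] ys = refl
length-cartesianProduct (x ∷ xs) ys = trans (length-++ (map (x ,_) ys))
  (cong₂ ℕ._+_ (length-map (x ,_) ys) (length-cartesianProduct xs ys))

AllPairs-lookup : ∀ {A : Set} {_~_ : A → A → Set} {xs x y} → AllPairs _~_ xs → x ∈ xs → y ∈ xs → x ≡ y ⊎ x ~ y ⊎ y ~ x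
AllPairs-lookup (_ ∷ _) (here refl) (here refl) = inj₁ refl
AllPairs-lookup (x~ ∷ _) (here refl) (there y∈) = inj₂ (inj₁ (All.lookup x~ y∈))
AllPairs-lookup (y~ ∷ _) (there x∈) (here refl) = inj₂ (inj₂ (All.lookup y~ x∈))
AllPairs-lookup (_ ∷ r) (there x∈) (there y∈) = AllPairs-lookup r x∈ y∈

-- Finite sums and indicators.

module FiniteSums where
  open import Data.Product using (Σ; ∃; _×_; _,_; proj₁; proj₂)
  open import Data.List using (List; []; _∷_; _++_; length; filter; map; cartesianProduct)
  open import Data.Nat.ListAction using (sum)
  open import Data.Nat.ListAction.Properties using (sum-++)
  open import Data.List.Membership.Propositional using (_∈_)
  open import Data.List.Membership.Propositional.Properties using (∈-filter⁺; ∈-filter⁻)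
  open import Data.List.Relation.Unary.Any using (here; there)
  open import Data.List.Relation.Unary.All as All using (All; []; _∷_)
  open import Data.List.Relation.Unary.AllPairs using ([]; _∷_)
  open import Data.List.Relation.Unary.Unique.Propositional using (Unique)
  open import Data.List.Relation.Unary.Unique.Propositional.Properties using (filter⁺)
  open import Data.List.Properties using (map-++; map-∘)
  open import Data.Nat using (ℕ; zero; suc; _+_; _*_; _≤_; z≤n; s≤s)
  open import Data.Nat.Properties
  open import Data.Empty using (⊥-elim)
  open import Relation.Nullary using (¬_; Dec; yes; no)
  open import Relation.Unary using (Decidable)
  open import Relation.Binary.PropositionalEquality
  open import Function using (_∘_)
  open import Algebra.Properties.CommutativeSemigroup +-commutativeSemigroup using () renaming (interchange to +-interchange)

  ∑ : ∀ {A : Set} → List A → (A → ℕ) → ℕ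
  ∑ xs f = sum (map f xs)

  𝟙 : ∀ {P : Set} → Dec P → ℕ
  𝟙 (yes _) = 1
  𝟙 (no _) = 0

  𝟙-yes : ∀ {P : Set} (d : Dec P) → P → 𝟙 d ≡ 1
  𝟙-yes (yes _) _ = refl
  𝟙-yes (no ¬p) p = ⊥-elim (¬p p)

  𝟙-no : ∀ {P : Set} (d : Dec P) → ¬ P → 𝟙 d ≡ 0
  𝟙-no (yes p) ¬p = ⊥-elim (¬p p)
  𝟙-no (no _) _ = refl

  𝟙-mono : ∀ {P Q : Set} (d : Dec P) (d′ : Dec Q) → (P → Q) → 𝟙 d ≤ 𝟙 d′
  𝟙-mono (yes p) d′ f = ≤-reflexive (sym (𝟙-yes d′ (f p)))
  𝟙-mono (no _) d′ f = z≤n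

  𝟙-≤ : ∀ {P : Set} {n} (d : Dec P) → (P → 1 ≤ n) → 𝟙 d ≤ n
  𝟙-≤ (yes p) f = f p
  𝟙-≤ (no _) f = z≤n

  module _ {A : Set} where

    ∑-mono : ∀ xs {f g : A → ℕ} → (∀ {x} → x ∈ xs → f x ≤ g x) → ∑ xs f ≤ ∑ xs g
    ∑-mono [] h = z≤n
    ∑-mono (x ∷ xs) h = +-mono-≤ (h (here refl)) (∑-mono xs (h ∘ there))

    ∑-cong : ∀ xs {f g : A → ℕ} → (∀ {x} → x ∈ xs → f x ≡ g x) → ∑ xs f ≡ ∑ xs g
    ∑-cong [] h = refl
    ∑-cong (x ∷ xs) h = cong₂ _+_ (h (here refl)) (∑-cong xs (h ∘ there))

    ∑-+ : ∀ xs (f g : A → ℕ) → ∑ xs (λ x → f x + g x) ≡ ∑ xs f + ∑ xs g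
    ∑-+ [] f g = refl
    ∑-+ (x ∷ xs) f g = trans (cong (f x + g x +_) (∑-+ xs f g)) (+-interchange (f x) (g x) (∑ xs f) (∑ xs g))

    ∑-*ˡ : ∀ xs c (f : A → ℕ) → ∑ xs (λ x → c * f x) ≡ c * ∑ xs f
    ∑-*ˡ [] c f = sym (*-zeroʳ c)
    ∑-*ˡ (x ∷ xs) c f = trans (cong (c * f x +_) (∑-*ˡ xs c f)) (sym (*-distribˡ-+ c (f x) (∑ xs f)))

    ∑-*ʳ : ∀ xs c (f : A → ℕ) → ∑ xs (λ x → f x * c) ≡ ∑ xs f * c
    ∑-*ʳ xs c f = trans (∑-cong xs (λ {x} _ → *-comm (f x) c)) (trans (∑-*ˡ xs c f) (*-comm c _))

    ∑-const : ∀ (xs : List A) c → ∑ xs (λ _ → c) ≡ length xs * c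
    ∑-const [] c = refl
    ∑-const (x ∷ xs) c = cong (c +_) (∑-const xs c)

    ∑-1 : ∀ (xs : List A) → ∑ xs (λ _ → 1) ≡ length xs
    ∑-1 xs = trans (∑-const xs 1) (*-identityʳ _)

    ∑-zero : ∀ (xs : List A) → ∑ xs (λ _ → 0) ≡ 0
    ∑-zero xs = trans (∑-const xs 0) (*-zeroʳ (length xs))

    term≤∑ : ∀ {xs x} (f : A → ℕ) → x ∈ xs → f x ≤ ∑ xs f
    term≤∑ f (here refl) = m≤m+n _ _
    term≤∑ {y ∷ xs} f (there x∈) = ≤-trans (term≤∑ f x∈) (m≤n+m _ (f y))

    ∑-filter : ∀ {P : A → Set} (P? : Decidable P) xs (f : A → ℕ) →
               ∑ (filter P? xs) f ≡ ∑ xs (λ x → 𝟙 (P? x) * f x)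
    ∑-filter P? [] f = refl
    ∑-filter P? (x ∷ xs) f with P? x
    ... | yes _ = cong₂ _+_ (sym (*-identityˡ (f x))) (∑-filter P? xs f)
    ... | no _ = ∑-filter P? xs f

    length-filter-𝟙 : ∀ {P : A → Set} (P? : Decidable P) xs → length (filter P? xs) ≡ ∑ xs (λ x → 𝟙 (P? x))
    length-filter-𝟙 P? xs = trans (sym (∑-1 (filter P? xs)))
      (trans (∑-filter P? xs (λ _ → 1)) (∑-cong xs (λ _ → *-identityʳ _)))

    ∑-cartesianProduct : ∀ {B : Set} (xs : List A) (ys : List B) (f : A × B → ℕ) →
                         ∑ (cartesianProduct xs ys) f ≡ ∑ xs (λ x → ∑ ys (λ y → f (x , y)))
    ∑-cartesianProduct [] ys f = refl
    ∑-cartesianProduct (x ∷ xs) ys f = trans (cong sum (map-++ f (map (x ,_) ys) (cartesianProduct xs ys)))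
      (trans (sum-++ (map f (map (x ,_) ys)) (map f (cartesianProduct xs ys)))
        (cong₂ _+_ (cong sum (sym (map-∘ ys))) (∑-cartesianProduct xs ys f)))

    at-most-one : ∀ {P : A → Set} (P? : Decidable P) {xs} → Unique xs →
                  (∀ {x y} → x ∈ xs → y ∈ xs → P x → P y → x ≡ y) → ∑ xs (λ x → 𝟙 (P? x)) ≤ 1
    at-most-one {P} P? {xs} unique same = subst (_≤ 1) (length-filter-𝟙 P? xs)
      (singleton (filter P? xs) (filter⁺ P? unique) (λ x∈ y∈ → let x∈xs , px = ∈-filter⁻ P? {xs = xs} x∈
                                                                   y∈xs , py = ∈-filter⁻ P? {xs = xs} y∈
                                                               in same x∈xs y∈xs px py))
      where
      singleton : ∀ (ys : List A) → Unique ys → (∀ {x y} → x ∈ ys → y ∈ ys → x ≡ y) → length ys ≤ 1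
      singleton [] _ _ = z≤n
      singleton (_ ∷ []) _ _ = s≤s z≤n
      singleton (_ ∷ _ ∷ _) ((x≢y ∷ _) ∷ _) all≡ = ⊥-elim (x≢y (all≡ (here refl) (there (here refl))))

    none-zero : ∀ {P : A → Set} (P? : Decidable P) xs → (∀ {x} → x ∈ xs → ¬ P x) → ∑ xs (λ x → 𝟙 (P? x)) ≡ 0
    none-zero P? [] _ = refl
    none-zero P? (x ∷ xs) none = cong₂ _+_ (𝟙-no (P? x) (none (here refl))) (none-zero P? xs (none ∘ there))

  ∑-swap : ∀ {A B : Set} (xs : List A) (ys : List B) (f : A → B → ℕ) →
           ∑ xs (λ x → ∑ ys (f x)) ≡ ∑ ys (λ y → ∑ xs (λ x → f x y))
  ∑-swap [] ys f = sym (∑-zero ys)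
  ∑-swap (x ∷ xs) ys f = trans (cong (∑ ys (f x) +_) (∑-swap xs ys f)) (sym (∑-+ ys (f x) (λ y → ∑ xs (λ x → f x y))))

open FiniteSums

-- Expectations over random sublists, with integer weights.

module RandomSublists where
  open import Data.Product using (Σ; ∃; _×_; _,_; proj₁; proj₂)
  open import Data.List using (List; []; _∷_; length)
  open import Data.List.Membership.Propositional using (_∈_)
  open import Data.List.Relation.Binary.Sublist.Propositional using (_⊆_; []; _∷_; _∷ʳ_)
  open import Data.Nat using (ℕ; zero; suc; _+_; _*_; _^_; _∸_; _≤_; _≤?_; z≤n; s≤s)
  open import Data.Nat.Properties
  open import Data.Nat.Solver using (module +-*-Solver)
  open import Relation.Nullary using (¬_; Dec; yes; no)
  open import Relation.Unary using (Decidable)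
  open import Relation.Binary.PropositionalEquality
  open import Function using (_∘_; id)

  -- The sum of F over all sublists, an element weighing b when it is taken and a when it is left out:
  -- (a + b) ^ length xs times the expectation when elements are taken independently with probability b / (a + b).
  𝔼 : ∀ {A : Set} → ℕ → ℕ → List A → (List A → ℕ) → ℕ
  𝔼 a b [] F = F []
  𝔼 a b (x ∷ xs) F = a * 𝔼 a b xs F + b * 𝔼 a b xs (F ∘ (x ∷_))

  -- 𝔼 for a list of length m and a function of the number of elements taken (see 𝔼-count).
  binomial : ℕ → ℕ → (ℕ → ℕ) → ℕ → ℕ
  binomial a b g zero = g 0
  binomial a b g (suc m) = a * binomial a b g m + b * binomial a b (g ∘ suc) m

  module _ {A : Set} (a b : ℕ) where
    open +-*-Solver

    𝔼-mono : ∀ (xs : List A) {F G} → (∀ {S} → S ⊆ xs → F S ≤ G S) → 𝔼 a b xs F ≤ 𝔼 a b xs G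
    𝔼-mono [] h = h []
    𝔼-mono (x ∷ xs) h = +-mono-≤ (*-monoʳ-≤ a (𝔼-mono xs (h ∘ (x ∷ʳ_)))) (*-monoʳ-≤ b (𝔼-mono xs (h ∘ (refl ∷_))))

    𝔼-+ : ∀ (xs : List A) F G → 𝔼 a b xs (λ S → F S + G S) ≡ 𝔼 a b xs F + 𝔼 a b xs G
    𝔼-+ [] F G = refl
    𝔼-+ (x ∷ xs) F G = trans (cong₂ (λ y z → a * y + b * z) (𝔼-+ xs F G) (𝔼-+ xs (F ∘ (x ∷_)) (G ∘ (x ∷_))))
      (solve 6 (λ a b p q r s → a :* (p :+ q) :+ b :* (r :+ s) := (a :* p :+ b :* r) :+ (a :* q :+ b :* s)) refl a b _ _ _ _)

    𝔼-*ˡ : ∀ (xs : List A) c F → 𝔼 a b xs (λ S → c * F S) ≡ c * 𝔼 a b xs F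
    𝔼-*ˡ [] c F = refl
    𝔼-*ˡ (x ∷ xs) c F = trans (cong₂ (λ y z → a * y + b * z) (𝔼-*ˡ xs c F) (𝔼-*ˡ xs c (F ∘ (x ∷_))))
      (solve 5 (λ a b c p q → a :* (c :* p) :+ b :* (c :* q) := c :* (a :* p :+ b :* q)) refl a b c _ _)

    𝔼-const : ∀ (xs : List A) c → 𝔼 a b xs (λ _ → c) ≡ (a + b) ^ length xs * c
    𝔼-const [] c = sym (*-identityˡ c)
    𝔼-const (x ∷ xs) c = trans (cong (λ y → a * y + b * y) (𝔼-const xs c))
      (solve 4 (λ a b p c → a :* (p :* c) :+ b :* (p :* c) := ((a :+ b) :* p) :* c) refl a b _ c)

    𝔼-∑ : ∀ {B : Set} (xs : List A) (ys : List B) (f : B → List A → ℕ) →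
          𝔼 a b xs (λ S → ∑ ys (λ y → f y S)) ≡ ∑ ys (λ y → 𝔼 a b xs (f y))
    𝔼-∑ xs [] f = trans (𝔼-const xs 0) (*-zeroʳ ((a + b) ^ length xs))
    𝔼-∑ xs (y ∷ ys) f = trans (𝔼-+ xs (f y) (λ S → ∑ ys (λ y → f y S))) (cong (𝔼 a b xs (f y) +_) (𝔼-∑ xs ys f))

    𝔼-length : ∀ (xs : List A) → 𝔼 a b xs length * (a + b) ≡ length xs * b * (a + b) ^ length xs
    𝔼-length [] = refl
    𝔼-length (x ∷ xs) = trans (cong (λ y → (a * 𝔼 a b xs length + b * y) * (a + b))
        (trans (𝔼-+ xs (λ _ → 1) length) (cong (_+ 𝔼 a b xs length) (𝔼-const xs 1))))
      (trans (solve 4 (λ a b e p → (a :* e :+ b :* (p :* con 1 :+ e)) :* (a :+ b)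
                               := (a :+ b) :* (e :* (a :+ b)) :+ b :* ((a :+ b) :* p)) refl a b _ _)
      (trans (cong (λ y → (a + b) * y + b * ((a + b) * (a + b) ^ length xs)) (𝔼-length xs))
        (solve 4 (λ a b n p → (a :+ b) :* (n :* b :* p) :+ b :* ((a :+ b) :* p)
                           := (con 1 :+ n) :* b :* ((a :+ b) :* p)) refl a b (length xs) _)))

    -- An element outside `P` contributes the factor a + b, so only the m elements of `P` matter.
    -- The factor (a + b) ^ m is kept on the left because the exponent length xs - m would need a
    -- subtraction.
    𝔼-count : ∀ {P : A → Set} (P? : Decidable P) (g : ℕ → ℕ) (xs : List A) →
              let m = ∑ xs (λ x → 𝟙 (P? x)) in
              𝔼 a b xs (λ S → g (∑ S (λ x → 𝟙 (P? x)))) * (a + b) ^ m ≡ (a + b) ^ length xs * binomial a b g m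
    𝔼-count P? g [] = *-comm (g 0) 1
    𝔼-count P? g (x ∷ xs) with P? x
    ... | no _ = trans (solve 4 (λ a b e p → (a :* e :+ b :* e) :* p := (a :+ b) :* (e :* p)) refl a b _ _)
      (trans (cong ((a + b) *_) (𝔼-count P? g xs)) (sym (*-assoc (a + b) _ _)))
    ... | yes _ = trans (solve 5 (λ a b e e′ p → (a :* e :+ b :* e′) :* ((a :+ b) :* p)
                                              := (a :+ b) :* (a :* (e :* p) :+ b :* (e′ :* p))) refl a b _ _ _)
      (trans (cong₂ (λ y z → (a + b) * (a * y + b * z)) (𝔼-count P? g xs) (𝔼-count P? (g ∘ suc) xs))
        (solve 5 (λ a b p y z → (a :+ b) :* (a :* (p :* y) :+ b :* (p :* z))
                             := ((a :+ b) :* p) :* (a :* y :+ b :* z)) refl a b _ _ _))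

  private
    bin : (ℕ → ℕ) → ℕ → ℕ
    bin = binomial 1 1

  open +-*-Solver

  -- On the counts 0, 1, 2 the function `_∸ 1` is the indicator that both elements are taken; on 0,
  -- ..., 4 the function `_∸ 3` is the same for four elements. Edges and crossings survive sampling
  -- with these weights.
  binomial-pair : ∀ a b → binomial a b (_∸ 1) 2 ≡ b * b
  binomial-pair a b = solve 2 (λ a b → a :* (a :* con 0 :+ b :* con 0) :+ b :* (a :* con 0 :+ b :* con 1) := b :* b) refl a b

  binomial-quadruple : ∀ a b → binomial a b (_∸ 3) 4 ≡ b * b * (b * b)
  binomial-quadruple a b = solve 2 (λ a b →
      let z = con 0
          z₁ = a :* z :+ b :* z
          z₂ = a :* z₁ :+ b :* z₁
          o₁ = a :* z :+ b :* con 1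
          o₂ = a :* z₁ :+ b :* o₁
          z₃ = a :* z₂ :+ b :* z₂
          o₃ = a :* z₂ :+ b :* o₂
      in a :* z₃ :+ b :* o₃ := b :* b :* (b :* b)) refl a b

  bin-suc : ∀ g m → bin g (suc m) ≡ bin g m + bin (g ∘ suc) m
  bin-suc g m = cong₂ _+_ (+-identityʳ (bin g m)) (+-identityʳ (bin (g ∘ suc) m))

  bin-const : ∀ c m → bin (λ _ → c) m ≡ 2 ^ m * c
  bin-const c zero = sym (*-identityˡ c)
  bin-const c (suc m) = trans (cong (λ y → 1 * y + 1 * y) (bin-const c m))
    (solve 2 (λ p c → con 1 :* (p :* c) :+ con 1 :* (p :* c) := (con 2 :* p) :* c) refl (2 ^ m) c)

  bin-suc-id : ∀ m → bin suc m ≡ bin id m + 2 ^ m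
  bin-suc-id m = go id m
    where
    go : ∀ g m → bin (suc ∘ g) m ≡ bin g m + 2 ^ m
    go g zero = +-comm 1 (g 0)
    go g (suc m) = trans (cong₂ (λ y z → 1 * y + 1 * z) (go g m) (go (g ∘ suc) m))
      (solve 3 (λ y z p → con 1 :* (y :+ p) :+ con 1 :* (z :+ p) := (con 1 :* y :+ con 1 :* z) :+ con 2 :* p) refl
        (bin g m) (bin (g ∘ suc) m) (2 ^ m))

  bin-id : ∀ m → 2 * bin id m ≡ m * 2 ^ m
  bin-id zero = refl
  bin-id (suc m) = trans (cong (2 *_) (trans (bin-suc id m) (cong (bin id m +_) (bin-suc-id m))))
    (trans (solve 2 (λ y p → con 2 :* (y :+ (y :+ p)) := con 2 :* (con 2 :* y) :+ con 2 :* p) refl (bin id m) (2 ^ m))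
    (trans (cong (λ y → 2 * y + 2 * 2 ^ m) (bin-id m))
      (solve 2 (λ m p → con 2 :* (m :* p) :+ con 2 :* p := (con 1 :+ m) :* (con 2 :* p)) refl m (2 ^ m))))

  -- Truncation makes `c ∸ 1` equal to c - 1 plus the indicator of c = 0; that indicator is the
  -- summand 2 on the right.
  bin-pred : ∀ m → 2 * bin (_∸ 1) m + 2 * 2 ^ m ≡ m * 2 ^ m + 2
  bin-pred zero = refl
  bin-pred (suc m) = trans (cong (λ y → 2 * y + 2 * (2 * 2 ^ m)) (bin-suc (_∸ 1) m))
    (trans (solve 3 (λ y z p → con 2 :* (y :+ z) :+ con 2 :* (con 2 :* p) := (con 2 :* y :+ con 2 :* p) :+ con 2 :* z :+ con 2 :* p) refl
        (bin (_∸ 1) m) (bin id m) (2 ^ m))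
    (trans (cong₂ (λ y z → y + z + 2 * 2 ^ m) (bin-pred m) (bin-id m))
      (solve 2 (λ m p → m :* p :+ con 2 :+ m :* p :+ con 2 :* p := (con 1 :+ m) :* (con 2 :* p) :+ con 2) refl m (2 ^ m))))

  at-least : ℕ → ℕ → ℕ
  at-least k c = 𝟙 (k ≤? c)

  at-least-suc : ∀ k c → at-least (suc k) (suc c) ≡ at-least k c
  at-least-suc k c = by-cases (suc k ≤? suc c) (k ≤? c)
    where
    by-cases : (d : Dec (suc k ≤ suc c)) (d′ : Dec (k ≤ c)) → 𝟙 d ≡ 𝟙 d′
    by-cases (yes (s≤s k≤c)) d′ = sym (𝟙-yes d′ k≤c)
    by-cases (no k≰c) d′ = sym (𝟙-no d′ (k≰c ∘ s≤s))

  bin-cong : ∀ {g h} m → (∀ c → g c ≡ h c) → bin g m ≡ bin h m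
  bin-cong zero eq = eq 0
  bin-cong (suc m) eq = cong₂ (λ y z → 1 * y + 1 * z) (bin-cong m eq) (bin-cong m (eq ∘ suc))

  bin-at-least-1 : ∀ m → bin (at-least 1) m + 1 ≡ 2 ^ m
  bin-at-least-1 zero = refl
  bin-at-least-1 (suc m) = trans (cong (_+ 1) (trans (bin-suc (at-least 1) m) (cong (bin (at-least 1) m +_)
      (trans (bin-cong m (λ c → 𝟙-yes (1 ≤? suc c) (s≤s z≤n))) (bin-const 1 m)))))
    (trans (solve 2 (λ y p → y :+ p :* con 1 :+ con 1 := (y :+ con 1) :+ p) refl (bin (at-least 1) m) (2 ^ m))
    (trans (cong (_+ 2 ^ m) (bin-at-least-1 m)) (solve 1 (λ p → p :+ p := con 2 :* p) refl (2 ^ m))))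

  bin-at-least-2 : ∀ m → bin (at-least 2) m + (m + 1) ≡ 2 ^ m
  bin-at-least-2 zero = refl
  bin-at-least-2 (suc m) = trans (cong (_+ (suc m + 1)) (trans (bin-suc (at-least 2) m) (cong (bin (at-least 2) m +_)
      (bin-cong m (at-least-suc 1)))))
    (trans (solve 3 (λ y z m → y :+ z :+ (con 1 :+ m :+ con 1) := (y :+ (m :+ con 1)) :+ (z :+ con 1)) refl
      (bin (at-least 2) m) (bin (at-least 1) m) m)
    (trans (cong₂ _+_ (bin-at-least-2 m) (bin-at-least-1 m)) (solve 1 (λ p → p :+ p := con 2 :* p) refl (2 ^ m))))

  -- κ⁺ m − κ⁻ m is an integer lower bound for 24 (E max(X − 1, 0) − 2 Pr(X ≥ 2)) = 12 m − 72 + (48 m + 72) / 2 ^ m,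
  -- where X counts heads in m tosses of a fair coin.
  κ⁻ : ℕ → ℕ
  κ⁻ 2 = 6
  κ⁻ 3 = 9
  κ⁻ 4 = 8
  κ⁻ 5 = 3
  κ⁻ _ = 0

  κ⁺ : ℕ → ℕ
  κ⁺ m = 12 * (m ∸ 6)

  κ-bound : ∀ m → 2 ≤ m → 48 * bin (at-least 2) m + κ⁺ m * 2 ^ m ≤ 24 * bin (_∸ 1) m + κ⁻ m * 2 ^ m
  κ-bound 1 (s≤s ())
  κ-bound 2 _ = ≤ᵇ⇒≤ _ _ _
  κ-bound 3 _ = ≤ᵇ⇒≤ _ _ _
  κ-bound 4 _ = ≤ᵇ⇒≤ _ _ _
  κ-bound 5 _ = ≤ᵇ⇒≤ _ _ _
  κ-bound m@(suc (suc (suc (suc (suc (suc k)))))) _ = +-cancelʳ-≤ (48 * (m + 1) + 24 * p) _ _ (begin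
    48 * B + 12 * k * p + (48 * (m + 1) + 24 * p)
      ≡⟨ solve 4 (λ B k p m → con 48 :* B :+ con 12 :* k :* p :+ (con 48 :* (m :+ con 1) :+ con 24 :* p)
           := con 48 :* (B :+ (m :+ con 1)) :+ con 12 :* k :* p :+ con 24 :* p) refl B k p m ⟩
    48 * (B + (m + 1)) + 12 * k * p + 24 * p
      ≡⟨ cong (λ y → 48 * y + 12 * k * p + 24 * p) (bin-at-least-2 m) ⟩
    48 * p + 12 * k * p + 24 * p
      -- The discarded amount is the numerator 48 m + 72 of the exponentially small term in the
      -- expectation.
      ≤⟨ m≤m+n _ (24 + 48 * (m + 1)) ⟩
    48 * p + 12 * k * p + 24 * p + (24 + 48 * (m + 1))
      ≡⟨ solve 3 (λ k p m → con 48 :* p :+ con 12 :* k :* p :+ con 24 :* p :+ (con 24 :+ con 48 :* (m :+ con 1))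
           := con 12 :* ((con 6 :+ k) :* p :+ con 2) :+ con 0 :* p :+ con 48 :* (m :+ con 1)) refl k p m ⟩
    12 * (m * p + 2) + 0 * p + 48 * (m + 1)
      ≡⟨ cong (λ y → 12 * y + 0 * p + 48 * (m + 1)) (bin-pred m) ⟨
    12 * (2 * A + 2 * p) + 0 * p + 48 * (m + 1)
      ≡⟨ solve 3 (λ A p m → con 12 :* (con 2 :* A :+ con 2 :* p) :+ con 0 :* p :+ con 48 :* (m :+ con 1)
           := con 24 :* A :+ con 0 :* p :+ (con 48 :* (m :+ con 1) :+ con 24 :* p)) refl A p m ⟩
    24 * A + 0 * p + (48 * (m + 1) + 24 * p) ∎)
    where
    open ≤-Reasoning
    A = bin (_∸ 1) m
    B = bin (at-least 2) m
    p = 2 ^ m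

open RandomSublists

-- Numerical estimates and the optimisation of constants.

module Estimates where
  open import Data.Nat
  open import Data.Nat.Properties
  open import Data.Nat.DivMod using (_/_; _%_; m≡m%n+[m/n]*n; m%n<n; m≥n⇒m/n>0; /-monoˡ-≤; m*n/n≡m)
  open import Data.Nat.Solver using (module +-*-Solver)
  open import Data.Product using (Σ; ∃; _×_; _,_; proj₁; proj₂)
  open import Data.Sum using (_⊎_; inj₁; inj₂)
  open import Relation.Binary.PropositionalEquality
  open import Relation.Nullary using (yes; no)

  open +-*-Solver

  -- The difference of the two sides is (d - m)(d - m - 1), a product of consecutive integers. It
  -- replaces the Cauchy-Schwarz inequality when degrees are summed.
  sum-of-squares-bound : ∀ m d → (2 * m + 1) * d ≤ d * d + m * (m + 1)
  sum-of-squares-bound m d with ≤-total d m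
  ... | inj₁ d≤m = let e = m ∸ d in subst (λ m → (2 * m + 1) * d ≤ d * d + m * (m + 1)) (m+[n∸m]≡n d≤m)
        (subst ((2 * (d + e) + 1) * d ≤_) (solve 2 (λ d e → (con 2 :* (d :+ e) :+ con 1) :* d :+ (e :* e :+ e)
            := d :* d :+ (d :+ e) :* (d :+ e :+ con 1)) refl d e) (m≤m+n _ _))
  ... | inj₂ m≤d with m≤n⇒m<n∨m≡n m≤d
  ...   | inj₂ refl = ≤-reflexive (solve 1 (λ m → (con 2 :* m :+ con 1) :* m := m :* m :+ m :* (m :+ con 1)) refl m)
  ...   | inj₁ m<d = let e = d ∸ suc m in subst (λ d → (2 * m + 1) * d ≤ d * d + m * (m + 1)) (m+[n∸m]≡n m<d)
        (subst ((2 * m + 1) * (suc m + e) ≤_) (solve 2 (λ m e → (con 2 :* m :+ con 1) :* (con 1 :+ m :+ e) :+ (e :* e :+ e)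
            := (con 1 :+ m :+ e) :* (con 1 :+ m :+ e) :+ m :* (m :+ con 1)) refl m e) (m≤m+n _ _))

  -- In the application `s` lines carry U + k s gaps between consecutive points. The right-hand side
  -- divided by 2 m is least near m = s / √n; as k stands for √n here, m = ⌊s / k⌋ is used, and m =
  -- 1 when s < k.
  tail-bound : ∀ U s k n .⦃ _ : NonZero k ⦄ → n ≤ k * k →
               (∀ m → 2 * m * (U + k * s) ≤ s * s + m * (m + 1) * n) → U ≤ n
  tail-bound U s k n n≤k² h with s <? k
  ... | yes s<k = *-cancelˡ-≤ 2 (+-cancelʳ-≤ (2 * (k * s)) _ _ (begin
    2 * U + 2 * (k * s)        ≡⟨ solve 3 (λ U k s → con 2 :* U :+ con 2 :* (k :* s) := con 2 :* con 1 :* (U :+ k :* s)) refl U k s ⟩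
    2 * 1 * (U + k * s)        ≤⟨ h 1 ⟩
    s * s + 1 * (1 + 1) * n    ≤⟨ +-monoˡ-≤ _ (*-monoˡ-≤ s (<⇒≤ s<k)) ⟩
    k * s + 1 * (1 + 1) * n    ≤⟨ m≤m+n _ (k * s) ⟩
    k * s + 1 * (1 + 1) * n + k * s ≡⟨ solve 2 (λ n t → t :+ con 1 :* con 2 :* n :+ t := con 2 :* n :+ con 2 :* t) refl n (k * s) ⟩
    2 * n + 2 * (k * s)        ∎))
    where open ≤-Reasoning
  ... | no s≮k = go (s / k) (m≡m%n+[m/n]*n s k) (m≥n⇒m/n>0 (≮⇒≥ s≮k))
    where
    open ≤-Reasoning
    r = s % k
    r²≤ : ∀ m′ → r * r ≤ suc m′ * (k * k)
    r²≤ m′ = ≤-trans (*-mono-≤ (<⇒≤ (m%n<n s k)) (<⇒≤ (m%n<n s k))) (m≤m+n (k * k) (m′ * (k * k)))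
    go : ∀ m → s ≡ r + m * k → 1 ≤ m → U ≤ n
    go m@(suc m′) s≡ _ = *-cancelˡ-≤ (2 * m) (+-cancelʳ-≤ (2 * m * (k * s)) _ _ (begin
      2 * m * U + 2 * m * (k * s)
        ≡⟨ *-distribˡ-+ (2 * m) U (k * s) ⟨
      2 * m * (U + k * s)
        ≤⟨ h m ⟩
      s * s + m * (m + 1) * n
        -- Only the part m (m - 1) n will be compared with k²; the part 2 m n stays, so that n keeps
        -- the coefficient 1.
        ≡⟨ cong (s * s +_) (solve 2 (λ m′ n → (con 1 :+ m′) :* (con 1 :+ m′ :+ con 1) :* n
             := con 2 :* (con 1 :+ m′) :* n :+ (con 1 :+ m′) :* m′ :* n) refl m′ n) ⟩
      s * s + (2 * m * n + m * m′ * n)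
        ≤⟨ +-monoʳ-≤ (s * s) (+-monoʳ-≤ (2 * m * n) (*-monoʳ-≤ (m * m′) n≤k²)) ⟩
      s * s + (2 * m * n + m * m′ * (k * k))
        ≡⟨ cong (λ s → s * s + (2 * m * n + m * m′ * (k * k))) s≡ ⟩
      (r + m * k) * (r + m * k) + (2 * m * n + m * m′ * (k * k))
        ≡⟨ solve 4 (λ r m′ k n → let m = con 1 :+ m′ in (r :+ m :* k) :* (r :+ m :* k) :+ (con 2 :* m :* n :+ m :* m′ :* (k :* k))
             := r :* r :+ (con 2 :* r :* m :* k :+ m :* m :* (k :* k) :+ con 2 :* m :* n :+ m :* m′ :* (k :* k))) refl r m′ k n ⟩
      r * r + (2 * r * m * k + m * m * (k * k) + 2 * m * n + m * m′ * (k * k))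
        ≤⟨ +-monoˡ-≤ _ (r²≤ m′) ⟩
      m * (k * k) + (2 * r * m * k + m * m * (k * k) + 2 * m * n + m * m′ * (k * k))
        ≡⟨ solve 4 (λ r m′ k n → let m = con 1 :+ m′ in
             m :* (k :* k) :+ (con 2 :* r :* m :* k :+ m :* m :* (k :* k) :+ con 2 :* m :* n :+ m :* m′ :* (k :* k))
             := con 2 :* m :* n :+ con 2 :* m :* (k :* (r :+ m :* k))) refl r m′ k n ⟩
      2 * m * n + 2 * m * (k * (r + m * k))
        ≡⟨ cong (λ s → 2 * m * n + 2 * m * (k * s)) s≡ ⟨
      2 * m * n + 2 * m * (k * s) ∎))

  module _ (V y M : ℕ) .⦃ _ : NonZero M ⦄
           (h : ∀ r → .⦃ NonZero r ⦄ → 2 * (V + y) * (r * r * M) ≤ 6 * (r * r * r) * (M * M) + y * y) where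
    open ≤-Reasoning

    private
      -- h r is used for c M ≤ y ≤ (c + d) M.
      choose : ∀ r .⦃ _ : NonZero r ⦄ c d e → 2 * c + d ≤ 2 * (r * r) + e →
               6 * (r * r * r) + c * c + e * d ≤ 10 * (r * r) + 2 * (r * r) * c →
               (∃ λ z → y ≡ c * M + z × z ≤ d * M) → V ≤ 5 * M
      choose r c d e linear constant (z , y≡ , z≤) = *-cancelʳ-≤ _ _ (2 * (r * r) * M) ⦃ m*n≢0 (2 * (r * r)) M ⦃ m*n≢0 2 (r * r) ⦃ _ ⦄ ⦃ m*n≢0 r r ⦄ ⦄ ⦄
        (+-cancelʳ-≤ (2 * (r * r) * c * (M * M) + 2 * (r * r) * (z * M)) _ _ (begin
        V * (2 * (r * r) * M) + (2 * (r * r) * c * (M * M) + 2 * (r * r) * (z * M))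
          ≡⟨ solve 5 (λ V z M r c → V :* (con 2 :* (r :* r) :* M) :+ (con 2 :* (r :* r) :* c :* (M :* M) :+ con 2 :* (r :* r) :* (z :* M))
               := con 2 :* (V :+ (c :* M :+ z)) :* (r :* r :* M)) refl V z M r c ⟩
        2 * (V + (c * M + z)) * (r * r * M)
          ≡⟨ cong (λ y → 2 * (V + y) * (r * r * M)) y≡ ⟨
        2 * (V + y) * (r * r * M)
          ≤⟨ h r ⟩
        6 * (r * r * r) * (M * M) + y * y
          ≡⟨ cong (λ y → 6 * (r * r * r) * (M * M) + y * y) y≡ ⟩
        6 * (r * r * r) * (M * M) + (c * M + z) * (c * M + z)
          ≡⟨ solve 4 (λ z M r c → con 6 :* (r :* r :* r) :* (M :* M) :+ (c :* M :+ z) :* (c :* M :+ z)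
               := (con 6 :* (r :* r :* r) :+ c :* c) :* (M :* M) :+ con 2 :* c :* (z :* M) :+ z :* z) refl z M r c ⟩
        (6 * (r * r * r) + c * c) * (M * M) + 2 * c * (z * M) + z * z
          -- On the interval 0 ≤ z ≤ d M the convex z² lies below its chord d M z. If the slope 2 c
          -- + d exceeds 2 r², the excess `e` is paid at the far end z = d M.
          ≤⟨ +-monoʳ-≤ _ (*-monoʳ-≤ z z≤) ⟩
        (6 * (r * r * r) + c * c) * (M * M) + 2 * c * (z * M) + z * (d * M)
          ≡⟨ solve 5 (λ z M q c d → q :+ con 2 :* c :* (z :* M) :+ z :* (d :* M) := q :+ (con 2 :* c :+ d) :* (z :* M)) refl
               z M ((6 * (r * r * r) + c * c) * (M * M)) c d ⟩
        (6 * (r * r * r) + c * c) * (M * M) + (2 * c + d) * (z * M)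
          ≤⟨ +-monoʳ-≤ _ (*-monoˡ-≤ (z * M) linear) ⟩
        (6 * (r * r * r) + c * c) * (M * M) + (2 * (r * r) + e) * (z * M)
          ≡⟨ solve 5 (λ z M q r e → q :* (M :* M) :+ (con 2 :* (r :* r) :+ e) :* (z :* M)
               := q :* (M :* M) :+ con 2 :* (r :* r) :* (z :* M) :+ e :* M :* z) refl z M (6 * (r * r * r) + c * c) r e ⟩
        (6 * (r * r * r) + c * c) * (M * M) + 2 * (r * r) * (z * M) + e * M * z
          ≤⟨ +-monoʳ-≤ _ (*-monoʳ-≤ (e * M) z≤) ⟩
        (6 * (r * r * r) + c * c) * (M * M) + 2 * (r * r) * (z * M) + e * M * (d * M)
          ≡⟨ solve 5 (λ M q w e d → q :* (M :* M) :+ w :+ e :* M :* (d :* M) := (q :+ e :* d) :* (M :* M) :+ w) refl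
               M (6 * (r * r * r) + c * c) (2 * (r * r) * (z * M)) e d ⟩
        (6 * (r * r * r) + c * c + e * d) * (M * M) + 2 * (r * r) * (z * M)
          ≤⟨ +-monoˡ-≤ _ (*-monoˡ-≤ (M * M) constant) ⟩
        (10 * (r * r) + 2 * (r * r) * c) * (M * M) + 2 * (r * r) * (z * M)
          ≡⟨ solve 4 (λ M r c w → (con 10 :* (r :* r) :+ con 2 :* (r :* r) :* c) :* (M :* M) :+ w
               := con 5 :* M :* (con 2 :* (r :* r) :* M) :+ (con 2 :* (r :* r) :* c :* (M :* M) :+ w)) refl M r c (2 * (r * r) * (z * M)) ⟩
        5 * M * (2 * (r * r) * M) + (2 * (r * r) * c * (M * M) + 2 * (r * r) * (z * M)) ∎))

      above : ∀ c d → c * M ≤ y → y ≤ (c + d) * M → ∃ λ z → y ≡ c * M + z × z ≤ d * M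
      above c d cM≤y y≤ = y ∸ c * M , sym (m+[n∸m]≡n cM≤y) ,
        m≤n+o⇒m∸n≤o y (c * M) (≤-trans y≤ (≤-reflexive (*-distribʳ-+ M c d)))

    -- r is chosen within a constant factor of the optimum (y / M) ^ (2/3), up to y / (3 M) when y is large.
    middle-bound : V ≤ 5 * M
    middle-bound with y ≤? 3 * M
    ... | yes y≤3M = choose 1 0 3 1 (≤ᵇ⇒≤ 3 3 _) (≤ᵇ⇒≤ 9 10 _) (above 0 3 z≤n y≤3M)
    ... | no y≰3M with y ≤? 6 * M
    ...   | yes y≤6M = choose 2 3 3 1 (≤ᵇ⇒≤ 9 9 _) (≤ᵇ⇒≤ 60 64 _) (above 3 3 (≰⇒≥ y≰3M) y≤6M)
    ...   | no y≰6M with y ≤? 12 * M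
    -- This range fixes the constant 5: for r = 3 the hypothesis gives exactly V ≤ 5 M at both y = 6
    -- M and y = 12 M. The other ranges leave room.
    ...     | yes y≤12M = choose 3 6 6 0 (≤ᵇ⇒≤ 18 18 _) (≤ᵇ⇒≤ 198 198 _) (above 6 6 (≰⇒≥ y≰6M) y≤12M)
    ...     | no y≰12M = choose r ⦃ >-nonZero (≤-trans (s≤s z≤n) 4≤r) ⦄ (3 * r) 3 0 linear constant (y % (3 * M) , y≡ , <⇒≤ (m%n<n y (3 * M)))
      where
      instance
        3M≢0 : NonZero (3 * M)
        3M≢0 = m*n≢0 3 M
      r = y / (3 * M)
      4≤r : 4 ≤ r
      4≤r = subst (_≤ r) (m*n/n≡m 4 (3 * M)) (/-monoˡ-≤ (3 * M) (≤-trans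
        (≤-reflexive (solve 1 (λ M → con 4 :* (con 3 :* M) := con 12 :* M) refl M)) (≰⇒≥ y≰12M)))
      linear : 2 * (3 * r) + 3 ≤ 2 * (r * r) + 0
      linear = begin
        2 * (3 * r) + 3       ≤⟨ +-monoʳ-≤ (2 * (3 * r)) (≤-trans (≤ᵇ⇒≤ 3 8 _) (*-monoʳ-≤ 2 4≤r)) ⟩
        2 * (3 * r) + 2 * r   ≡⟨ solve 1 (λ r → con 2 :* (con 3 :* r) :+ con 2 :* r := con 2 :* (con 4 :* r)) refl r ⟩
        2 * (4 * r)           ≤⟨ *-monoʳ-≤ 2 (*-monoˡ-≤ r 4≤r) ⟩
        2 * (r * r)           ≡⟨ +-identityʳ _ ⟨
        2 * (r * r) + 0       ∎
      constant : 6 * (r * r * r) + 3 * r * (3 * r) + 0 * 3 ≤ 10 * (r * r) + 2 * (r * r) * (3 * r)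
      constant = ≤-trans (m≤m+n _ (r * r)) (≤-reflexive (solve 1 (λ r → con 6 :* (r :* r :* r) :+ con 3 :* r :* (con 3 :* r) :+ con 0 :* con 3 :+ r :* r
        := con 10 :* (r :* r) :+ con 2 :* (r :* r) :* (con 3 :* r)) refl r))
      y≡ : y ≡ 3 * r * M + y % (3 * M)
      y≡ = trans (m≡m%n+[m/n]*n y (3 * M)) (trans (+-comm (y % (3 * M)) (r * (3 * M))) (cong (_+ y % (3 * M))
        (solve 2 (λ r M → r :* (con 3 :* M) := con 3 :* r :* M) refl r M)))

  sumBelow : (ℕ → ℕ) → ℕ → ℕ
  sumBelow f zero = 0
  sumBelow f (suc h) = f h + sumBelow f h

  sumBelow-mono : ∀ {f g} h → (∀ i → f i ≤ g i) → sumBelow f h ≤ sumBelow g h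
  sumBelow-mono zero f≤g = z≤n
  sumBelow-mono (suc h) f≤g = +-mono-≤ (f≤g h) (sumBelow-mono h f≤g)

  sumBelow-const : ∀ {f} c h → (∀ i → f i ≤ c) → sumBelow f h ≤ h * c
  sumBelow-const c zero f≤c = z≤n
  sumBelow-const c (suc h) f≤c = +-mono-≤ (f≤c h) (sumBelow-const c h f≤c)

  sumBelow-extend : ∀ f {m h} → m ≤ h → sumBelow f m ≤ sumBelow f h
  sumBelow-extend f {m} {zero} z≤n = ≤-refl
  sumBelow-extend f {m} {suc h} m≤1+h with m≤n⇒m<n∨m≡n m≤1+h
  ... | inj₁ (s≤s m≤h) = ≤-trans (sumBelow-extend f m≤h) (m≤n+m _ (f h))
  ... | inj₂ refl = ≤-refl

  -- A line with m gaps has m + 1 points, so this is its number of pairs of points.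
  triangle : ℕ → ℕ
  triangle zero = 0
  triangle (suc m) = suc m + triangle m

  2*triangle : ∀ m → 2 * triangle m ≡ suc m * m
  2*triangle zero = refl
  2*triangle (suc m) = trans (*-distribˡ-+ 2 (suc m) (triangle m)) (trans (cong (2 * suc m +_) (2*triangle m))
    (solve 1 (λ m → con 2 :* (con 1 :+ m) :+ (con 1 :+ m) :* m := (con 2 :+ m) :* (con 1 :+ m)) refl m))

  -- The layers `m ∸ i` vanish from i = m on, so one height `h` serves all lines at once and the
  -- pairs on rich lines can be summed layer by layer.
  triangle≤sumBelow : ∀ {m h} → m ≤ h → triangle m ≤ sumBelow (m ∸_) h
  triangle≤sumBelow {m} m≤h = ≤-trans (go m) (sumBelow-extend (m ∸_) m≤h)
    where
    shift : ∀ m h → h ≤ suc m → h + sumBelow (m ∸_) h ≤ sumBelow (suc m ∸_) h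
    shift m zero _ = z≤n
    shift m (suc h) (s≤s h≤m) = begin
      suc h + (m ∸ h + sumBelow (m ∸_) h)  ≡⟨ solve 3 (λ h d s → con 1 :+ h :+ (d :+ s) := con 1 :+ d :+ (h :+ s)) refl h (m ∸ h) _ ⟩
      suc (m ∸ h) + (h + sumBelow (m ∸_) h) ≤⟨ +-mono-≤ (≤-reflexive (sym (+-∸-assoc 1 h≤m))) (shift m h (m≤n⇒m≤1+n h≤m)) ⟩
      suc m ∸ h + sumBelow (suc m ∸_) h    ∎
      where open ≤-Reasoning
    go : ∀ m → triangle m ≤ sumBelow (m ∸_) m
    go zero = z≤n
    go (suc m) = begin
      suc (m + triangle m)                          ≤⟨ s≤s (+-monoʳ-≤ m (go m)) ⟩
      suc (m + sumBelow (m ∸_) m)                   ≤⟨ s≤s (shift m m (n≤1+n m)) ⟩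
      suc (sumBelow (suc m ∸_) m)                   ≡⟨ cong (_+ sumBelow (suc m ∸_) m) (sym (trans (+-∸-assoc 1 (≤-refl {m})) (cong suc (n∸n≡0 m)))) ⟩
      suc m ∸ m + sumBelow (suc m ∸_) m             ∎
      where open ≤-Reasoning

  -- Σ_{k > c} 1 / k² ≤ 1 / c by telescoping 1 / (k (k + 1)).
  telescope : ∀ c .⦃ _ : NonZero c ⦄ (u : ℕ → ℕ) M n →
              (∀ i → let k = c + i in u i * (k * suc k) ≤ M + n * (k * suc k)) →
              ∀ h → c * sumBelow u h ≤ M + c * n * h
  telescope c u M n bound h = *-cancelˡ-≤ (c + h) ⦃ c+h≢0 h ⦄ (+-cancelʳ-≤ (c * M) _ _ (begin
      (c + h) * (c * sumBelow u h) + c * M   ≤⟨ go h ⟩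
      M * (c + h) + c * n * h * (c + h)      ≤⟨ m≤m+n _ (c * M) ⟩
      M * (c + h) + c * n * h * (c + h) + c * M
        ≡⟨ cong (_+ c * M) (solve 4 (λ c h M n → M :* (c :+ h) :+ c :* n :* h :* (c :+ h) := (c :+ h) :* (M :+ c :* n :* h)) refl c h M n) ⟩
      (c + h) * (M + c * n * h) + c * M      ∎))
    where
    open ≤-Reasoning
    c+h≢0 : ∀ h → NonZero (c + h)
    c+h≢0 h = >-nonZero (<-≤-trans (>-nonZero⁻¹ c) (m≤m+n c h))
    -- Divided by c (c + h) this is Σ u ≤ M (1 / c - 1 / (c + h)) + n h; the induction closes only
    -- with the subtracted 1 / (c + h).
    go : ∀ h → (c + h) * (c * sumBelow u h) + c * M ≤ M * (c + h) + c * n * h * (c + h)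
    go zero = ≤-reflexive (solve 3 (λ c M n → (c :+ con 0) :* (c :* con 0) :+ c :* M := M :* (c :+ con 0) :+ c :* n :* con 0 :* (c :+ con 0)) refl c M n)
    go (suc h) = *-cancelˡ-≤ k ⦃ c+h≢0 h ⦄ (begin
      k * ((c + suc h) * (c * (u h + W)) + c * M)
        ≡⟨ cong (λ k′ → k * (k′ * (c * (u h + W)) + c * M)) (+-suc c h) ⟩
      k * (suc k * (c * (u h + W)) + c * M)
        ≡⟨ solve 5 (λ k c u W M → k :* ((con 1 :+ k) :* (c :* (u :+ W)) :+ c :* M)
             := (con 1 :+ k) :* (k :* (c :* W)) :+ k :* (c :* M) :+ c :* (u :* (k :* (con 1 :+ k)))) refl k c (u h) W M ⟩
      suc k * (k * (c * W)) + k * (c * M) + c * (u h * (k * suc k))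
        ≤⟨ +-monoʳ-≤ _ (*-monoʳ-≤ c (bound h)) ⟩
      suc k * (k * (c * W)) + k * (c * M) + c * (M + n * (k * suc k))
        ≡⟨ solve 5 (λ k c n W M → (con 1 :+ k) :* (k :* (c :* W)) :+ k :* (c :* M) :+ c :* (M :+ n :* (k :* (con 1 :+ k)))
             := (con 1 :+ k) :* (k :* (c :* W) :+ c :* M) :+ c :* n :* (k :* (con 1 :+ k))) refl k c n W M ⟩
      suc k * (k * (c * W) + c * M) + c * n * (k * suc k)
        ≤⟨ +-monoˡ-≤ _ (*-monoʳ-≤ (suc k) (go h)) ⟩
      suc k * (M * k + c * n * h * k) + c * n * (k * suc k)
        ≡⟨ solve 5 (λ k c n h M → (con 1 :+ k) :* (M :* k :+ c :* n :* h :* k) :+ c :* n :* (k :* (con 1 :+ k))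
             := k :* (M :* (con 1 :+ k) :+ c :* n :* (con 1 :+ h) :* (con 1 :+ k))) refl k c n h M ⟩
      k * (M * suc k + c * n * suc h * suc k)
        ≡⟨ cong (λ k′ → k * (M * k′ + c * n * suc h * k′)) (+-suc c h) ⟨
      k * (M * (c + suc h) + c * n * suc h * (c + suc h)) ∎)
      where
      k = c + h
      W = sumBelow u h

  triangle-+ : ∀ K i → triangle (K + i) ≡ triangle K + K * i + triangle i
  triangle-+ K i = *-cancelˡ-≡ _ _ 2 (trans (2*triangle (K + i)) (sym (trans
    (solve 4 (λ tK tI K i → con 2 :* (tK :+ K :* i :+ tI) := con 2 :* tK :+ con 2 :* tI :+ con 2 :* (K :* i)) refl (triangle K) (triangle i) K i)
    (trans (cong₂ (λ y z → y + z + 2 * (K * i)) (2*triangle K) (2*triangle i))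
      (solve 2 (λ K i → (con 1 :+ K) :* K :+ (con 1 :+ i) :* i :+ con 2 :* (K :* i) := (con 1 :+ K :+ i) :* (K :+ i)) refl K i)))))

  -- The multipliers of small-line and large-line come from the dual of the linear program that minimises
  -- the number of lines under the available inequalities: small-line is tight at j = 1 and from j = 50 on,
  -- large-line at j = 1, j = 2 and from j = 29 on.
  small-line : ∀ j → 1 ≤ j → triangle j + 25 ≤ 26 * j + 24 * (j ∸ 50) + triangle (j ∸ 50)
  small-line j@(suc a) _ with j ≤? 50
  ... | yes j≤50 = ≤-trans (*-cancelˡ-≤ 2 (begin
      2 * (triangle j + 25)
        ≡⟨ trans (*-distribˡ-+ 2 (triangle j) 25) (cong (_+ 50) (2*triangle j)) ⟩
      suc j * j + 50
        -- Twice the slack is (j - 1)(50 - j), which is nonnegative between the two tight values.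
        ≤⟨ m≤m+n _ (a * b) ⟩
      suc j * j + 50 + a * b
        ≡⟨ solve 2 (λ a b → (con 2 :+ a) :* (con 1 :+ a) :+ con 50 :+ a :* b := con 52 :+ a :* (con 3 :+ (a :+ b))) refl a b ⟩
      52 + a * (3 + (a + b))
        ≡⟨ cong (λ c → 52 + a * (3 + c)) (m+[n∸m]≡n (≤-pred j≤50)) ⟩
      52 + a * 52
        ≡⟨ solve 1 (λ a → con 52 :+ a :* con 52 := con 2 :* (con 26 :* (con 1 :+ a))) refl a ⟩
      2 * (26 * j) ∎)) (≤-trans (m≤m+n (26 * j) (24 * (j ∸ 50))) (m≤m+n _ _))
    where
    open ≤-Reasoning
    b = 49 ∸ a
  ... | no j≰50 = subst (λ j → triangle j + 25 ≤ 26 * j + 24 * (j ∸ 50) + triangle (j ∸ 50)) (m+[n∸m]≡n (≰⇒≥ j≰50))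
      (≤-reflexive (trans (cong (_+ 25) (triangle-+ 50 i)) (trans
        (solve 2 (λ i t → con 1275 :+ con 50 :* i :+ t :+ con 25 := con 26 :* (con 50 :+ i) :+ con 24 :* i :+ t) refl i (triangle i))
        (cong (λ i′ → 26 * (50 + i) + 24 * i′ + triangle i′) (sym (m+n∸m≡n 50 i))))))
    where
    i = j ∸ 50

  large-line : ∀ j → 1 ≤ j →
    triangle j + 10 + κ⁻ (suc j) ≤ 12 + 5 * j + κ⁺ (suc j) + 12 * (j ∸ 29) + triangle (j ∸ 29)
  large-line 1 _ = ≤ᵇ⇒≤ _ _ _
  large-line 2 _ = ≤ᵇ⇒≤ _ _ _
  large-line 3 _ = ≤ᵇ⇒≤ _ _ _
  large-line 4 _ = ≤ᵇ⇒≤ _ _ _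
  large-line j@(suc (suc (suc (suc (suc q))))) _ with j ≤? 29
  ... | yes j≤29 = ≤-trans (*-cancelˡ-≤ 2 (begin
      2 * (triangle j + 10 + 0)
        ≡⟨ trans (*-distribˡ-+ 2 (triangle j + 10) 0) (trans (+-identityʳ _)
             (trans (*-distribˡ-+ 2 (triangle j) 10) (cong (_+ 20) (2*triangle j)))) ⟩
      suc j * j + 20
        ≤⟨ m≤m+n _ ((1 + q) * b) ⟩
      suc j * j + 20 + (1 + q) * b
        ≡⟨ solve 2 (λ q b → (con 6 :+ q) :* (con 5 :+ q) :+ con 20 :+ (con 1 :+ q) :* b
             := con 50 :+ q :* (con 10 :+ (q :+ b)) :+ (q :+ b)) refl q b ⟩
      50 + q * (10 + (q + b)) + (q + b)
        ≡⟨ cong (λ c → 50 + q * (10 + c) + c) (m+[n∸m]≡n (≤-pred (≤-pred (≤-pred (≤-pred (≤-pred j≤29)))))) ⟩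
      50 + q * 34 + 24
        ≡⟨ solve 1 (λ q → con 50 :+ q :* con 34 :+ con 24 := con 2 :* (con 12 :+ con 5 :* (con 5 :+ q) :+ con 12 :* q)) refl q ⟩
      2 * (12 + 5 * j + 12 * q) ∎)) (≤-trans (m≤m+n (12 + 5 * j + 12 * q) (12 * (j ∸ 29))) (m≤m+n _ _))
    where
    open ≤-Reasoning
    b = 24 ∸ q
  ... | no j≰29 = subst (λ j → triangle j + 10 + κ⁻ (suc j) ≤ 12 + 5 * j + κ⁺ (suc j) + 12 * (j ∸ 29) + triangle (j ∸ 29))
      (m+[n∸m]≡n (≰⇒≥ j≰29))
      (≤-reflexive (trans (cong (λ y → y + 10 + 0) (triangle-+ 29 i)) (trans
        (solve 2 (λ i t → con 435 :+ con 29 :* i :+ t :+ con 10 :+ con 0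
           := con 12 :+ con 5 :* (con 29 :+ i) :+ con 12 :* (con 24 :+ i) :+ con 12 :* i :+ t) refl i (triangle i))
        (cong (λ i′ → 12 + 5 * (29 + i) + 12 * (24 + i) + 12 * i′ + triangle i′) (sym (m+n∸m≡n 29 i))))))
    where
    i = j ∸ 29

  -- Here X is the number of points on a richest line and X + d is the number of all points.
  conclude : ∀ a L X d c e → .⦃ NonZero a ⦄ → .⦃ NonZero (X + d) ⦄ →
             (X + d) * (X + d) ≤ a * L + (c + e * X) * (X + d) → a * d + 61 * (c + e * X) ≤ 61 * (X + d) →
             (X + d) * d ≤ 61 * L
  conclude a L X d c e bound slack = *-cancelˡ-≤ a (+-cancelʳ-≤ (61 * (c + e * X) * n) _ _ (begin
    a * (n * d) + 61 * (c + e * X) * n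
      ≡⟨ solve 4 (λ a n d w → a :* (n :* d) :+ con 61 :* w :* n := n :* (a :* d :+ con 61 :* w)) refl a n d (c + e * X) ⟩
    n * (a * d + 61 * (c + e * X))
      ≤⟨ *-monoʳ-≤ n slack ⟩
    n * (61 * n)
      ≡⟨ solve 1 (λ n → n :* (con 61 :* n) := con 61 :* (n :* n)) refl n ⟩
    61 * (n * n)
      ≤⟨ *-monoʳ-≤ 61 bound ⟩
    61 * (a * L + (c + e * X) * n)
      ≡⟨ solve 4 (λ a L w n → con 61 :* (a :* L :+ w :* n) := a :* (con 61 :* L) :+ con 61 :* w :* n) refl a L (c + e * X) n ⟩
    a * (61 * L) + 61 * (c + e * X) * n ∎))
    where
    open ≤-Reasoning
    n = X + d

  small-slack : ∀ X d → 2 ≤ X → 19 * X ≤ d → 54 * d + 61 * (1 + 2 * X) ≤ 61 * (X + d)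
  small-slack X d 2≤X 19X≤d = begin
    54 * d + 61 * (1 + 2 * X)          ≡⟨ solve 2 (λ X d → con 54 :* d :+ con 61 :* (con 1 :+ con 2 :* X) := con 54 :* d :+ con 61 :* X :+ (con 61 :+ con 61 :* X)) refl X d ⟩
    54 * d + 61 * X + (61 + 61 * X)    ≤⟨ +-monoʳ-≤ (54 * d + 61 * X) (+-monoˡ-≤ (61 * X) (≤-trans (≤ᵇ⇒≤ 61 144 _) (*-monoʳ-≤ 72 2≤X))) ⟩
    54 * d + 61 * X + (72 * X + 61 * X) ≡⟨ solve 2 (λ X d → con 54 :* d :+ con 61 :* X :+ (con 72 :* X :+ con 61 :* X) := con 54 :* d :+ con 61 :* X :+ con 7 :* (con 19 :* X)) refl X d ⟩
    54 * d + 61 * X + 7 * (19 * X)     ≤⟨ +-monoʳ-≤ (54 * d + 61 * X) (*-monoʳ-≤ 7 19X≤d) ⟩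
    54 * d + 61 * X + 7 * d            ≡⟨ solve 2 (λ X d → con 54 :* d :+ con 61 :* X :+ con 7 :* d := con 61 :* (X :+ d)) refl X d ⟩
    61 * (X + d)                       ∎
    where open ≤-Reasoning

  large-slack : ∀ X d → 2500 ≤ X + d → 19 * X ≤ d → 48 * d + 61 * (98 + 4 * X) ≤ 61 * (X + d)
  large-slack X d 2500≤ 19X≤d = begin
    48 * d + 61 * (98 + 4 * X)           ≡⟨ solve 2 (λ X d → con 48 :* d :+ con 61 :* (con 98 :+ con 4 :* X) := con 48 :* d :+ con 61 :* X :+ (con 5978 :+ con 183 :* X)) refl X d ⟩
    -- The available 13 d is split: 3 d pays for 61 · 98 = 5978, for which d ≥ 1993 is just enough,
    -- and 10 d ≥ 190 X pays for 183 X.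
    48 * d + 61 * X + (5978 + 183 * X)   ≤⟨ +-monoʳ-≤ (48 * d + 61 * X) (+-mono-≤ (≤-trans (≤ᵇ⇒≤ 5978 5979 _) (*-monoʳ-≤ 3 1993≤d)) (*-monoˡ-≤ X (≤ᵇ⇒≤ 183 190 _))) ⟩
    48 * d + 61 * X + (3 * d + 190 * X)  ≡⟨ solve 2 (λ X d → con 48 :* d :+ con 61 :* X :+ (con 3 :* d :+ con 190 :* X) := con 51 :* d :+ con 61 :* X :+ con 10 :* (con 19 :* X)) refl X d ⟩
    51 * d + 61 * X + 10 * (19 * X)      ≤⟨ +-monoʳ-≤ (51 * d + 61 * X) (*-monoʳ-≤ 10 19X≤d) ⟩
    51 * d + 61 * X + 10 * d             ≡⟨ solve 2 (λ X d → con 51 :* d :+ con 61 :* X :+ con 10 :* d := con 61 :* (X :+ d)) refl X d ⟩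
    61 * (X + d)                         ∎
    where
    open ≤-Reasoning
    1993≤d : 1993 ≤ d
    1993≤d = *-cancelˡ-≤ 20 (begin
      20 * 1993       ≤⟨ ≤ᵇ⇒≤ (20 * 1993) (19 * 2500) _ ⟩
      19 * 2500       ≤⟨ *-monoʳ-≤ 19 2500≤ ⟩
      19 * (X + d)    ≡⟨ *-distribˡ-+ 19 X d ⟩
      19 * X + 19 * d ≤⟨ +-monoˡ-≤ (19 * d) 19X≤d ⟩
      20 * d          ∎)

  -- The hypothesis means 58 X ≤ 3 d, and 57 = 3 · 19 is the multiple of 3 just below.
  19*X≤d : ∀ X d → 61 * X ≤ 3 * (X + d) → 19 * X ≤ d
  19*X≤d X d 61X≤ = *-cancelˡ-≤ 3 (+-cancelˡ-≤ (3 * X) _ _ (begin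
    3 * X + 3 * (19 * X)  ≡⟨ solve 1 (λ X → con 3 :* X :+ con 3 :* (con 19 :* X) := con 60 :* X) refl X ⟩
    60 * X                ≤⟨ *-monoˡ-≤ X (≤ᵇ⇒≤ 60 61 _) ⟩
    61 * X                ≤⟨ 61X≤ ⟩
    3 * (X + d)           ≡⟨ *-distribˡ-+ 3 X d ⟩
    3 * X + 3 * d         ∎))
    where open ≤-Reasoning

open Estimates

-- Ordered field arithmetic and a solver for polynomial identities.

module OrderedField (R : RealField) where
  open RealField R public

  commutativeRing : CommutativeRing _ _
  commutativeRing = record { isCommutativeRing = isCommutativeRing }

  private
    module K = CommutativeRing commutativeRing
  open K public using (-‿inverseʳ; *-comm; *-identityˡ; *-identityʳ; zeroˡ)
  open RingProperties K.ring public using (-‿distribˡ-*; -‿distribʳ-*; -0#≈0#; -‿involutive; -‿+-comm)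
  open SemiringMult K.semiring using (×-homo-+; ×1-homo-*) renaming (_×_ to _·_)

  -- The canonical homomorphism from ℤ. Coefficients of polynomials are taken in ℤ, where equality
  -- computes, so that cancellations are recognised.
  ⟦_⟧ℤ : ℤ → Carrier
  ⟦ pos n ⟧ℤ = n · 1#
  ⟦ -[1+ n ] ⟧ℤ = - (suc n · 1#)

  cancel-1# : ∀ a b → a - b ≡ (1# + a) - (1# + b)
  cancel-1# a b = sym (begin
    (1# + a) - (1# + b)         ≡⟨ cong ((1# + a) +_) (-‿+-comm 1# b) ⟨
    (1# + a) + (- 1# - b)       ≡⟨ cong (_+ (- 1# - b)) (K.+-comm 1# a) ⟩
    (a + 1#) + (- 1# - b)       ≡⟨ K.+-assoc a 1# _ ⟩
    a + (1# + (- 1# - b))       ≡⟨ cong (a +_) (K.+-assoc 1# (- 1#) (- b)) ⟨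
    a + ((1# - 1#) - b)         ≡⟨ cong (λ z → a + (z - b)) (K.-‿inverseʳ 1#) ⟩
    a + (0# - b)                ≡⟨ cong (a +_) (K.+-identityˡ (- b)) ⟩
    a - b                       ∎)
    where open ≡-Reasoning

  ⟦⟧ℤ-⊖ : ∀ m n → ⟦ m ⊖ n ⟧ℤ ≡ m · 1# - n · 1#
  ⟦⟧ℤ-⊖ m zero = trans (sym (K.+-identityʳ _)) (cong (m · 1# +_) (sym -0#≈0#))
  ⟦⟧ℤ-⊖ zero (suc n) = sym (K.+-identityˡ _)
  ⟦⟧ℤ-⊖ (suc m) (suc n) = trans (cong ⟦_⟧ℤ (ℤₚ.[1+m]⊖[1+n]≡m⊖n m n))
    (trans (⟦⟧ℤ-⊖ m n) (cancel-1# (m · 1#) (n · 1#)))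

  ⟦⟧ℤ-+ : ∀ i j → ⟦ i ℤ.+ j ⟧ℤ ≡ ⟦ i ⟧ℤ + ⟦ j ⟧ℤ
  ⟦⟧ℤ-+ (pos m) (pos n) = ×-homo-+ 1# m n
  ⟦⟧ℤ-+ (pos m) -[1+ n ] = ⟦⟧ℤ-⊖ m (suc n)
  ⟦⟧ℤ-+ -[1+ m ] (pos n) = trans (⟦⟧ℤ-⊖ n (suc m)) (K.+-comm _ _)
  ⟦⟧ℤ-+ -[1+ m ] -[1+ n ] = trans
    (cong -_ (trans (cong (λ k → suc k · 1#) (sym (ℕₚ.+-suc m n))) (×-homo-+ 1# (suc m) (suc n))))
    (sym (-‿+-comm _ _))
    where import Data.Nat.Properties as ℕₚ

  ⟦⟧ℤ-neg : ∀ i → ⟦ ℤ.- i ⟧ℤ ≡ - ⟦ i ⟧ℤ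
  ⟦⟧ℤ-neg (pos zero) = sym -0#≈0#
  ⟦⟧ℤ-neg (pos (suc n)) = refl
  ⟦⟧ℤ-neg -[1+ n ] = sym (-‿involutive _)

  ⟦⟧ℤ-*⁺ : ∀ m j → ⟦ pos m ℤ.* j ⟧ℤ ≡ m · 1# * ⟦ j ⟧ℤ
  ⟦⟧ℤ-*⁺ m (pos n) = trans (cong ⟦_⟧ℤ (sym (ℤₚ.pos-* m n))) (×1-homo-* m n)
  ⟦⟧ℤ-*⁺ m -[1+ n ] = begin
    ⟦ pos m ℤ.* ℤ.- (pos (suc n)) ⟧ℤ   ≡⟨ cong ⟦_⟧ℤ (ℤₚ.neg-distribʳ-* (pos m) (pos (suc n))) ⟨
    ⟦ ℤ.- (pos m ℤ.* pos (suc n)) ⟧ℤ   ≡⟨ ⟦⟧ℤ-neg (pos m ℤ.* pos (suc n)) ⟩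
    - ⟦ pos m ℤ.* pos (suc n) ⟧ℤ       ≡⟨ cong -_ (⟦⟧ℤ-*⁺ m (pos (suc n))) ⟩
    - (m · 1# * suc n · 1#)      ≡⟨ -‿distribʳ-* _ _ ⟩
    m · 1# * - (suc n · 1#)      ∎
    where open ≡-Reasoning

  ⟦⟧ℤ-* : ∀ i j → ⟦ i ℤ.* j ⟧ℤ ≡ ⟦ i ⟧ℤ * ⟦ j ⟧ℤ
  ⟦⟧ℤ-* (pos m) j = ⟦⟧ℤ-*⁺ m j
  ⟦⟧ℤ-* -[1+ m ] j = begin
    ⟦ ℤ.- (pos (suc m)) ℤ.* j ⟧ℤ     ≡⟨ cong ⟦_⟧ℤ (ℤₚ.neg-distribˡ-* (pos (suc m)) j) ⟨
    ⟦ ℤ.- (pos (suc m) ℤ.* j) ⟧ℤ     ≡⟨ ⟦⟧ℤ-neg (pos (suc m) ℤ.* j) ⟩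
    - ⟦ pos (suc m) ℤ.* j ⟧ℤ         ≡⟨ cong -_ (⟦⟧ℤ-*⁺ (suc m) j) ⟩
    - (suc m · 1# * ⟦ j ⟧ℤ)      ≡⟨ -‿distribˡ-* _ _ ⟩
    - (suc m · 1#) * ⟦ j ⟧ℤ      ∎
    where open ≡-Reasoning

  private
    ℤ-morphism : ℤ.+-*-rawRing -Raw-AlmostCommutative⟶ fromCommutativeRing commutativeRing
    ℤ-morphism = record
      { ⟦_⟧ = ⟦_⟧ℤ ; +-homo = ⟦⟧ℤ-+ ; *-homo = ⟦⟧ℤ-* ; -‿homo = ⟦⟧ℤ-neg
      ; 0-homo = refl ; 1-homo = K.+-identityʳ 1# }

    coefficient-≟ : ∀ i j → Maybe (⟦ i ⟧ℤ ≡ ⟦ j ⟧ℤ)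
    coefficient-≟ i j with i ℤₚ.≟ j
    ... | yes i≡j = just (cong ⟦_⟧ℤ i≡j)
    ... | no _ = nothing

  module Solver = RingSolver ℤ.+-*-rawRing (fromCommutativeRing commutativeRing) ℤ-morphism coefficient-≟

  open Solver using (solve; _:=_; _:+_; _:*_; _:-_; :-_; con; Polynomial)
  module Ord = IsStrictTotalOrder isStrictTotalOrder

  open Ord public using (compare; _<?_) renaming (trans to <-trans)

  <-irrefl : ∀ {x} → ¬ (x < x)
  <-irrefl = Ord.irrefl refl

  ≤-<-trans : ∀ {x y z} → x ≤ y → y < z → x < z
  ≤-<-trans (inj₁ x<y) y<z = <-trans x<y y<z
  ≤-<-trans (inj₂ refl) y<z = y<z

  <-≤-trans : ∀ {x y z} → x < y → y ≤ z → x < z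
  <-≤-trans x<y (inj₁ y<z) = <-trans x<y y<z
  <-≤-trans x<y (inj₂ refl) = x<y

  ≤-trans : ∀ {x y z} → x ≤ y → y ≤ z → x ≤ z
  ≤-trans (inj₁ x<y) y≤z = inj₁ (<-≤-trans x<y y≤z)
  ≤-trans (inj₂ refl) y≤z = y≤z

  <⇒≱ : ∀ {x y} → x < y → ¬ (y ≤ x)
  <⇒≱ x<y y≤x = <-irrefl (<-≤-trans x<y y≤x)

  ≤-antisym : ∀ {x y} → x ≤ y → y ≤ x → x ≡ y
  ≤-antisym (inj₁ x<y) y≤x = ⊥-elim (<⇒≱ x<y y≤x)
  ≤-antisym (inj₂ x≡y) _ = x≡y

  ≤-total : ∀ x y → x ≤ y ⊎ y ≤ x
  ≤-total x y with compare x y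
  ... | tri< x<y _ _ = inj₁ (inj₁ x<y)
  ... | tri≈ _ x≡y _ = inj₁ (inj₂ x≡y)
  ... | tri> _ _ y<x = inj₂ (inj₁ y<x)

  _≤?_ : ∀ x y → Dec (x ≤ y)
  x ≤? y with compare x y
  ... | tri< x<y _ _ = yes (inj₁ x<y)
  ... | tri≈ _ x≡y _ = yes (inj₂ x≡y)
  ... | tri> _ _ y<x = no (<⇒≱ y<x)

  <-or-≤ : ∀ x y → x < y ⊎ y ≤ x
  <-or-≤ x y with compare x y
  ... | tri< x<y _ _ = inj₁ x<y
  ... | tri≈ _ x≡y _ = inj₂ (inj₂ (sym x≡y))
  ... | tri> _ _ y<x = inj₂ (inj₁ y<x)

  <⇒0<- : ∀ {x y} → x < y → 0# < y - x
  <⇒0<- {x} {y} x<y = subst (_< y - x) (K.-‿inverseʳ x) (+-mono-< (- x) x<y)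

  0<-⇒< : ∀ {x y} → 0# < y - x → x < y
  0<-⇒< {x} {y} 0<y-x = subst₂ _<_ (K.+-identityˡ x) (solve 2 (λ x y → (y :- x) :+ x := y) refl x y)
    (+-mono-< x 0<y-x)

  ≤⇒0≤- : ∀ {x y} → x ≤ y → 0# ≤ y - x
  ≤⇒0≤- (inj₁ x<y) = inj₁ (<⇒0<- x<y)
  ≤⇒0≤- {x} (inj₂ refl) = inj₂ (sym (K.-‿inverseʳ x))

  0≤-⇒≤ : ∀ {x y} → 0# ≤ y - x → x ≤ y
  0≤-⇒≤ (inj₁ 0<y-x) = inj₁ (0<-⇒< 0<y-x)
  0≤-⇒≤ {x} {y} (inj₂ 0≡y-x) = inj₂ (sym (trans (solve 2 (λ x y → y := (y :- x) :+ x) refl x y)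
    (trans (cong (_+ x) (sym 0≡y-x)) (K.+-identityˡ x))))

  pos+nonneg : ∀ {x y} → 0# < x → 0# ≤ y → 0# < x + y
  pos+nonneg {x} {y} 0<x (inj₁ 0<y) =
    <-trans 0<y (subst (_< x + y) (K.+-identityˡ y) (+-mono-< y 0<x))
  pos+nonneg {x} 0<x (inj₂ refl) = subst (0# <_) (sym (K.+-identityʳ x)) 0<x

  nonneg+pos : ∀ {x y} → 0# ≤ x → 0# < y → 0# < x + y
  nonneg+pos {x} {y} 0≤x 0<y = subst (0# <_) (K.+-comm y x) (pos+nonneg 0<y 0≤x)

  pos+pos : ∀ {x y} → 0# < x → 0# < y → 0# < x + y
  pos+pos 0<x 0<y = pos+nonneg 0<x (inj₁ 0<y)

  nonneg+nonneg : ∀ {x y} → 0# ≤ x → 0# ≤ y → 0# ≤ x + y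
  nonneg+nonneg (inj₁ 0<x) 0≤y = inj₁ (pos+nonneg 0<x 0≤y)
  nonneg+nonneg {y = y} (inj₂ refl) 0≤y = subst (0# ≤_) (sym (K.+-identityˡ y)) 0≤y

  nonneg*nonneg : ∀ {x y} → 0# ≤ x → 0# ≤ y → 0# ≤ x * y
  nonneg*nonneg (inj₁ 0<x) (inj₁ 0<y) = inj₁ (*-pos 0<x 0<y)
  nonneg*nonneg {x} (inj₁ _) (inj₂ refl) = inj₂ (sym (K.zeroʳ x))
  nonneg*nonneg {y = y} (inj₂ refl) _ = inj₂ (sym (K.zeroˡ y))

  pos⇒≢0 : ∀ {x} → 0# < x → x ≢ 0#
  pos⇒≢0 0<x refl = <-irrefl 0<x

  neg-pos : ∀ {x} → x < 0# → 0# < - x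
  neg-pos {x} x<0 = subst (0# <_) (K.+-identityˡ (- x)) (<⇒0<- x<0)

  ¬pos-neg : ∀ {x} → 0# < x → ¬ (0# < - x)
  ¬pos-neg {x} 0<x 0<-x = <-irrefl (subst (0# <_) (K.-‿inverseʳ x) (pos+pos 0<x 0<-x))

  data Sign (x : Carrier) : Set where
    positive : 0# < x → Sign x
    null     : x ≡ 0# → Sign x
    negative : 0# < - x → Sign x

  sign : ∀ x → Sign x
  sign x with compare 0# x
  ... | tri< 0<x _ _ = positive 0<x
  ... | tri≈ _ 0≡x _ = null (sym 0≡x)
  ... | tri> _ _ x<0 = negative (neg-pos x<0)

  *-cancel-pos : ∀ {x y} → 0# < x → 0# < x * y → 0# < y
  *-cancel-pos {x} {y} 0<x 0<xy with sign y
  ... | positive 0<y = 0<y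
  ... | null refl = ⊥-elim (pos⇒≢0 0<xy (K.zeroʳ x))
  ... | negative 0<-y = ⊥-elim (¬pos-neg 0<xy
          (subst (0# <_) (sym (-‿distribʳ-* x y)) (*-pos 0<x 0<-y)))

  *-cancel-nonneg : ∀ {x y} → 0# < x → 0# ≤ x * y → 0# ≤ y
  *-cancel-nonneg {x} {y} 0<x 0≤xy with sign y
  ... | positive 0<y = inj₁ 0<y
  ... | null y≡0 = inj₂ (sym y≡0)
  ... | negative 0<-y = ⊥-elim (<⇒≱ (*-pos 0<x 0<-y)
          (subst (_≤ 0#) (-‿distribʳ-* x y) (neg-≤ 0≤xy)))
    where
    neg-≤ : ∀ {z} → 0# ≤ z → - z ≤ 0#
    neg-≤ {z} (inj₁ 0<z) = inj₁ (subst₂ _<_ (K.+-identityˡ _) (K.-‿inverseʳ z) (+-mono-< (- z) 0<z))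
    neg-≤ (inj₂ refl) = inj₂ -0#≈0#

  *-≡0 : ∀ {x y} → x ≢ 0# → x * y ≡ 0# → y ≡ 0#
  *-≡0 {x} {y} x≢0 xy≡0 with sign x | sign y
  ... | _ | null y≡0 = y≡0
  ... | null x≡0 | _ = ⊥-elim (x≢0 x≡0)
  ... | positive 0<x | positive 0<y = ⊥-elim (pos⇒≢0 (*-pos 0<x 0<y) xy≡0)
  ... | positive 0<x | negative 0<-y = ⊥-elim (pos⇒≢0 (*-pos 0<x 0<-y)
          (trans (sym (-‿distribʳ-* x y)) (trans (cong -_ xy≡0) -0#≈0#)))
  ... | negative 0<-x | positive 0<y = ⊥-elim (pos⇒≢0 (*-pos 0<-x 0<y)
          (trans (sym (-‿distribˡ-* x y)) (trans (cong -_ xy≡0) -0#≈0#)))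
  ... | negative 0<-x | negative 0<-y = ⊥-elim (pos⇒≢0 (*-pos 0<-x 0<-y)
          (trans (solve 2 (λ x y → (:- x) :* (:- y) := x :* y) refl x y) xy≡0))

  -≡0⇒≡ : ∀ {x y} → x - y ≡ 0# → x ≡ y
  -≡0⇒≡ {x} {y} x-y≡0 = trans (solve 2 (λ x y → x := (x :- y) :+ y) refl x y)
    (trans (cong (_+ y) x-y≡0) (K.+-identityˡ y))

-- Signed areas, their identities, and crossings of segments.

module Geometry (R : RealField) (t : RealField.Carrier R) where
  open OrderedField R
  open Plane R using (Point)
  open Solver using (solve; _:=_; _:+_; _:*_; _:-_; :-_; con; Polynomial)

  :ξ : ∀ {n} → Polynomial n → Polynomial n × Polynomial n → Polynomial n
  :ξ t (x , y) = x :+ t :* y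

  :area : ∀ {n} (p q r : Polynomial n × Polynomial n) → Polynomial n
  :area (px , py) (qx , qy) (rx , ry) = (qx :- px) :* (ry :- py) :- (qy :- py) :* (rx :- px)

  -- Outside this block `ξ` and `area` are atoms, known through the identities proved here and not
  -- as polynomials in the coordinates.
  abstract
    -- An abscissa; t will be chosen so that it separates the given points.
    ξ : Point → Carrier
    ξ (x , y) = x + t * y

    -- Twice the signed area of the triangle: positive when r lies to the left of the line directed
    -- from p to q.
    area : Point → Point → Point → Carrier
    area (px , py) (qx , qy) (rx , ry) = (qx - px) * (ry - py) - (qy - py) * (rx - px)

    area-rotate : ∀ p q r → area q r p ≡ area p q r
    area-rotate (px , py) (qx , qy) (rx , ry) = solve 6 (λ px py qx qy rx ry →
      :area (qx , qy) (rx , ry) (px , py) := :area (px , py) (qx , qy) (rx , ry)) refl px py qx qy rx ry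

    area-flip : ∀ p q r → - area p q r ≡ area p r q
    area-flip (px , py) (qx , qy) (rx , ry) = solve 6 (λ px py qx qy rx ry →
      :- :area (px , py) (qx , qy) (rx , ry) := :area (px , py) (rx , ry) (qx , qy)) refl px py qx qy rx ry

    area-pqq : ∀ p q → area p q q ≡ 0#
    area-pqq (px , py) (qx , qy) = solve 4 (λ px py qx qy →
      :area (px , py) (qx , qy) (qx , qy) := con (0ℤ)) refl px py qx qy

    -- With e as origin the areas are 2 × 2 determinants, and this is the three-term
    -- Grassmann-Plücker relation.
    plücker : ∀ e a b c d →
      area e a b * area e c d + area e a d * area e b c ≡ area e a c * area e b d
    plücker (ex , ey) (ax , ay) (bx , by) (cx , cy) (dx , dy) =
      solve 10 (λ ex ey ax ay bx by cx cy dx dy →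
        let e = ex , ey ; a = ax , ay ; b = bx , by ; c = cx , cy ; d = dx , dy in
        :area e a b :* :area e c d :+ :area e a d :* :area e b c := :area e a c :* :area e b d)
        refl ex ey ax ay bx by cx cy dx dy

    -- This is `plücker` with d = e + (-t, 1): along that direction `ξ` is constant, and
    -- `area e c d` becomes ξ c - ξ e.
    plücker-ξ : ∀ e a b c →
      area e a b * (ξ c - ξ e) + area e b c * (ξ a - ξ e) ≡ area e a c * (ξ b - ξ e)
    plücker-ξ (ex , ey) (ax , ay) (bx , by) (cx , cy) =
      solve 9 (λ t ex ey ax ay bx by cx cy →
        let e = ex , ey ; a = ax , ay ; b = bx , by ; c = cx , cy in
        :area e a b :* (:ξ t c :- :ξ t e) :+ :area e b c :* (:ξ t a :- :ξ t e)
          := :area e a c :* (:ξ t b :- :ξ t e))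
        refl t ex ey ax ay bx by cx cy

    change-line : ∀ a b p q r → area p q r * (ξ b - ξ a)
      ≡ (area a b r - area a b p) * (ξ q - ξ p) - (area a b q - area a b p) * (ξ r - ξ p)
    change-line (ax , ay) (bx , by) (px , py) (qx , qy) (rx , ry) =
      solve 11 (λ t ax ay bx by px py qx qy rx ry →
        let a = ax , ay ; b = bx , by ; p = px , py ; q = qx , qy ; r = rx , ry in
        :area p q r :* (:ξ t b :- :ξ t a) := (:area a b r :- :area a b p) :* (:ξ t q :- :ξ t p)
          :- (:area a b q :- :area a b p) :* (:ξ t r :- :ξ t p))
        refl t ax ay bx by px py qx qy rx ry

    -- The area over xy is affine along a line, so its value at b interpolates those at a and c; the
    -- last term corrects for abc not being collinear.
    interpolate : ∀ x y a b c → (ξ c - ξ a) * area x y b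
      ≡ (ξ c - ξ b) * area x y a + (ξ b - ξ a) * area x y c - (ξ y - ξ x) * area a b c
    interpolate (xx , xy) (yx , yy) (ax , ay) (bx , by) (cx , cy) =
      solve 11 (λ t xx xy yx yy ax ay bx by cx cy →
        let x = xx , xy ; y = yx , yy ; a = ax , ay ; b = bx , by ; c = cx , cy in
        (:ξ t c :- :ξ t a) :* :area x y b := (:ξ t c :- :ξ t b) :* :area x y a
          :+ (:ξ t b :- :ξ t a) :* :area x y c :- (:ξ t y :- :ξ t x) :* :area a b c)
        refl t xx xy yx yy ax ay bx by cx cy

    -- Both sides are (ξ v − ξ w)(ξ y − ξ u) times the height of the line uy above the line wv at abscissa ξ z.
    gap : ∀ w v u y z →
      area w v u * (ξ y - ξ z) + area w v y * (ξ z - ξ u)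
        ≡ area w v z * (ξ y - ξ u) + area u z y * (ξ v - ξ w)
    gap (wx , wy) (vx , vy) (ux , uy) (yx , yy) (zx , zy) =
      solve 11 (λ t wx wy vx vy ux uy yx yy zx zy →
        let w = wx , wy ; v = vx , vy ; u = ux , uy ; y = yx , yy ; z = zx , zy in
        :area w v u :* (:ξ t y :- :ξ t z) :+ :area w v y :* (:ξ t z :- :ξ t u)
          := :area w v z :* (:ξ t y :- :ξ t u) :+ :area u z y :* (:ξ t v :- :ξ t w))
        refl t wx wy vx vy ux uy yx yy zx zy

    collinear⇒area : ∀ {p q r} → Plane.Collinear R p q r → area p q r ≡ 0#
    collinear⇒area {px , py} {qx , qy} {rx , ry} c = trans (cong (_- (qy - py) * (rx - px)) c) (-‿inverseʳ _)

    area⇒collinear : ∀ {p q r} → area p q r ≡ 0# → Plane.Collinear R p q r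
    area⇒collinear {px , py} {qx , qy} {rx , ry} a≡0 = -≡0⇒≡ a≡0

    _∖_ : Point → Point → Point
    (px , py) ∖ (qx , qy) = px - qx , py - qy

    cross : Point → Point → Carrier
    cross (ax , ay) (bx , by) = ax * by - ay * bx

    cross-flip : ∀ a b → - cross a b ≡ cross b a
    cross-flip (ax , ay) (bx , by) = solve 4 (λ ax ay bx by →
      :- (ax :* by :- ay :* bx) := bx :* ay :- by :* ax) refl ax ay bx by

    cross-plücker : ∀ a b c d → cross a b * cross c d + cross a d * cross b c ≡ cross a c * cross b d
    cross-plücker (ax , ay) (bx , by) (cx , cy) (dx , dy) = solve 8 (λ ax ay bx by cx cy dx dy →
      (ax :* by :- ay :* bx) :* (cx :* dy :- cy :* dx) :+ (ax :* dy :- ay :* dx) :* (bx :* cy :- by :* cx)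
        := (ax :* cy :- ay :* cx) :* (bx :* dy :- by :* dx)) refl ax ay bx by cx cy dx dy

    cross-from : ∀ p a b → cross (a ∖ p) (b ∖ p) ≡ area p a b
    cross-from p a b = refl

    cross-to : ∀ q a b → cross (q ∖ a) (q ∖ b) ≡ area q a b
    cross-to (qx , qy) (ax , ay) (bx , by) = solve 6 (λ qx qy ax ay bx by →
      (qx :- ax) :* (qy :- by) :- (qy :- ay) :* (qx :- bx) := :area (qx , qy) (ax , ay) (bx , by))
      refl qx qy ax ay bx by

    cross-from-to : ∀ p q a b → cross (a ∖ p) (q ∖ b) ≡ area p a q - area p a b
    cross-from-to (px , py) (qx , qy) (ax , ay) (bx , by) = solve 8 (λ px py qx qy ax ay bx by →
      (ax :- px) :* (qy :- by) :- (ay :- py) :* (qx :- bx)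
        := :area (px , py) (ax , ay) (qx , qy) :- :area (px , py) (ax , ay) (bx , by))
      refl px py qx qy ax ay bx by

    cross-to-from : ∀ p q a b → cross (q ∖ a) (b ∖ p) ≡ area q a p - area q a b
    cross-to-from (px , py) (qx , qy) (ax , ay) (bx , by) = solve 8 (λ px py qx qy ax ay bx by →
      (qx :- ax) :* (by :- py) :- (qy :- ay) :* (bx :- px)
        := :area (qx , qy) (ax , ay) (px , py) :- :area (qx , qy) (ax , ay) (bx , by))
      refl px py qx qy ax ay bx by

    ξ-def : ∀ x y → ξ (x , y) ≡ x + t * y
    ξ-def x y = refl

  area-pqp : ∀ p q → area p q p ≡ 0#
  area-pqp p q = trans (area-rotate p p q) (trans (area-rotate q p p) (area-pqq q p))

  area-ppq : ∀ p q → area p p q ≡ 0#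
  area-ppq p q = trans (area-rotate q p p) (area-pqq q p)

  area-pos⇒flip-neg : ∀ {p q r} → 0# < area p q r → ¬ (0# ≤ area p r q)
  area-pos⇒flip-neg {p} {q} {r} 0<area nonneg =
    <-irrefl (subst (0# <_) (trans (cong (area p q r +_) (sym (area-flip p q r))) (-‿inverseʳ (area p q r)))
      (pos+nonneg 0<area nonneg))

  Generic : List Point → Set
  Generic S = ∀ {p q} → p ∈ S → q ∈ S → ξ p ≡ ξ q → p ≡ q

  data Orientation (p q r : Point) : Set where
    left      : 0# < area p q r → Orientation p q r
    collinear : area p q r ≡ 0# → Orientation p q r
    right     : 0# < area p r q → Orientation p q r

  orientation : ∀ p q r → Orientation p q r
  orientation p q r with sign (area p q r)
  ... | positive 0<a = left 0<a
  ... | null a≡0 = collinear a≡0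
  ... | negative 0<-a = right (subst (0# <_) (area-flip p q r) 0<-a)

  area-total : ∀ p q r → 0# ≤ area p q r ⊎ 0# ≤ area p r q
  area-total p q r with orientation p q r
  ... | left 0<a = inj₁ (inj₁ 0<a)
  ... | collinear a≡0 = inj₁ (inj₂ (sym a≡0))
  ... | right 0<a = inj₂ (inj₁ 0<a)

  ¬right⇒0≤ : ∀ {p q r} → ¬ (0# < area p r q) → 0# ≤ area p q r
  ¬right⇒0≤ {p} {q} {r} ¬right with orientation p q r
  ... | left 0<a = inj₁ 0<a
  ... | collinear a≡0 = inj₂ (sym a≡0)
  ... | right 0<a = ⊥-elim (¬right 0<a)

  area-antisym : ∀ {p q r} → 0# ≤ area p q r → 0# ≤ area p r q → area p q r ≡ 0#
  area-antisym (inj₁ 0<a) 0≤a′ = ⊥-elim (area-pos⇒flip-neg 0<a 0≤a′)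
  area-antisym (inj₂ 0≡a) _ = sym 0≡a

  area-null-flip : ∀ {p q r} → area p q r ≡ 0# → area p r q ≡ 0#
  area-null-flip {p} {q} {r} a≡0 = trans (sym (area-flip p q r)) (trans (cong -_ a≡0) -0#≈0#)

  area-rotate⁺ : ∀ {p q r} → 0# < area p q r → 0# < area q r p
  area-rotate⁺ {p} {q} {r} = subst (0# <_) (sym (area-rotate p q r))

  area-rotate⁰ : ∀ {p q r} → 0# ≤ area p q r → 0# ≤ area q r p
  area-rotate⁰ {p} {q} {r} = subst (0# ≤_) (sym (area-rotate p q r))

  area-0≡0 : ∀ {p q r} → area p q r ≡ 0# → 0# ≤ area p q r
  area-0≡0 a≡0 = inj₂ (sym a≡0)

  -- All directions from v point into the half-plane ξ < ξ v, so the differences of abscissae in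
  -- `plücker-ξ` have one sign.
  angular-trans : ∀ {v a b c} → ξ a < ξ v → ξ b < ξ v → ξ c < ξ v →
                  0# ≤ area v a b → 0# ≤ area v b c → 0# ≤ area v a c
  angular-trans {v} {a} {b} {c} a<v b<v c<v ab bc = *-cancel-nonneg (<⇒0<- b<v)
    (subst (0# ≤_) identity (nonneg+nonneg (nonneg*nonneg ab (inj₁ (<⇒0<- c<v)))
                                           (nonneg*nonneg bc (inj₁ (<⇒0<- a<v)))))
    where
    identity : area v a b * (ξ v - ξ c) + area v b c * (ξ v - ξ a) ≡ (ξ v - ξ b) * area v a c
    identity = trans (solve 6 (λ ab bc a b c v → ab :* (v :- c) :+ bc :* (v :- a)
                                 := :- (ab :* (c :- v) :+ bc :* (a :- v))) refl
                        (area v a b) (area v b c) (ξ a) (ξ b) (ξ c) (ξ v))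
              (trans (cong -_ (plücker-ξ v a b c))
                     (solve 3 (λ ac b v → :- (ac :* (b :- v)) := (v :- b) :* ac) refl (area v a c) (ξ b) (ξ v)))

  Segment : Set
  Segment = Point × Point

  -- The two segments cross, the second one descending through the first (abscissae increasing along both).
  Crosses : Segment → Segment → Set
  Crosses (w , v) (u , y) = 0# < area w v u × 0# < area w y v × 0# < area u w y × 0# < area u y v

  private
    -- The left-hand side of `gap` as a function of the abscissa x. It is affine, so a positive
    -- value followed by a negative one fixes its sign before the first and after the second place;
    -- evaluated at the four ends this gives the four inequalities of `Crosses`.
    D : (p m y u x : Carrier) → Carrier
    D p m y u x = p * (y - x) + m * (x - u)

    D-before : ∀ {p m y u z t x} → z < t → 0# < D p m y u z → 0# < - D p m y u t → x ≤ z → 0# < D p m y u x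
    D-before {p} {m} {y} {u} {z} {t} {x} z<t Dz Dt x≤z = *-cancel-pos (<⇒0<- z<t) (subst (0# <_)
      (solve 7 (λ p m y u z t x → let D = λ x → p :* (y :- x) :+ m :* (x :- u) in
         D z :* (t :- x) :+ (:- D t) :* (z :- x) := (t :- z) :* D x) refl p m y u z t x)
      (pos+nonneg (*-pos Dz (<⇒0<- (≤-<-trans x≤z z<t))) (nonneg*nonneg (inj₁ Dt) (≤⇒0≤- x≤z))))

    D-after : ∀ {p m y u z t x} → z < t → 0# < D p m y u z → 0# < - D p m y u t → t ≤ x → 0# < - D p m y u x
    D-after {p} {m} {y} {u} {z} {t} {x} z<t Dz Dt t≤x = *-cancel-pos (<⇒0<- z<t) (subst (0# <_)
      (solve 7 (λ p m y u z t x → let D = λ x → p :* (y :- x) :+ m :* (x :- u) in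
         D z :* (x :- t) :+ (:- D t) :* (x :- z) := (t :- z) :* (:- D x)) refl p m y u z t x)
      (nonneg+pos (nonneg*nonneg (inj₁ Dz) (≤⇒0≤- t≤x)) (*-pos Dt (<⇒0<- (<-≤-trans z<t t≤x)))))

  -- At the abscissa of z the line wv runs weakly below z and uy weakly above it, one of them
  -- strictly. This is just enough to make the gap positive, and it admits a z on one of the
  -- segments.
  data Between (w v u y z : Point) : Set where
    upper : 0# ≤ area w v z → 0# < area u z y → Between w v u y z
    lower : 0# < area w v z → 0# ≤ area u z y → Between w v u y z

  -- If uy is above wv at the abscissa of z (with z in between) and below it at the later abscissa of s, they cross.
  crossing : ∀ {w v u y z s} → ξ w < ξ v → ξ u < ξ y → ξ w ≤ ξ z → ξ u ≤ ξ z → ξ z < ξ s → ξ s ≤ ξ v → ξ s ≤ ξ y →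
             Between w v u y z → Between u y w v s → Crosses (w , v) (u , y)
  crossing {w} {v} {u} {y} {z} {s} w<v u<y w≤z u≤z z<s s≤v s≤y between-z between-s =
      *-cancel-pos (<⇒0<- u<y) (subst (0# <_) (solve 4 (λ p m y u → p :* (y :- u) :+ m :* (u :- u) := (y :- u) :* p) refl
        p m (ξ y) (ξ u)) (D-before z<s Dz Ds u≤z))
    , subst (0# <_) (area-flip w v y) (*-cancel-pos (<⇒0<- u<y) (subst (0# <_)
        (solve 4 (λ p m y u → :- (p :* (y :- y) :+ m :* (y :- u)) := (y :- u) :* (:- m)) refl
        p m (ξ y) (ξ u)) (D-after z<s Dz Ds s≤y)))
    , *-cancel-pos (<⇒0<- w<v) (subst (0# <_) (trans (gap w v u y w) (trans (cong (λ a → a * (ξ y - ξ u) + area u w y * (ξ v - ξ w)) (area-pqp w v))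
        (solve 3 (λ a b c → con 0ℤ :* a :+ b :* c := c :* b) refl (ξ y - ξ u) (area u w y) (ξ v - ξ w)))) (D-before z<s Dz Ds w≤z))
    , subst (0# <_) (area-flip u v y) (*-cancel-pos (<⇒0<- w<v) (subst (0# <_) (trans (cong -_ (gap w v u y v)) (trans (cong (λ a → - (a * (ξ y - ξ u) + area u v y * (ξ v - ξ w))) (area-pqq w v))
        (solve 3 (λ a b c → :- (con 0ℤ :* a :+ b :* c) := c :* (:- b)) refl (ξ y - ξ u) (area u v y) (ξ v - ξ w)))) (D-after z<s Dz Ds s≤v)))
    where
    p = area w v u
    m = area w v y

    sum-pos : ∀ {w v u y z} → ξ w < ξ v → ξ u < ξ y → Between w v u y z →
              0# < area w v z * (ξ y - ξ u) + area u z y * (ξ v - ξ w)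
    sum-pos w<v u<y (upper a b) = nonneg+pos (nonneg*nonneg a (inj₁ (<⇒0<- u<y))) (*-pos b (<⇒0<- w<v))
    sum-pos w<v u<y (lower a b) = pos+nonneg (*-pos a (<⇒0<- u<y)) (nonneg*nonneg b (inj₁ (<⇒0<- w<v)))

    Dz : 0# < D p m (ξ y) (ξ u) (ξ z)
    Dz = subst (0# <_) (sym (gap w v u y z)) (sum-pos w<v u<y between-z)

    Ds : 0# < - D p m (ξ y) (ξ u) (ξ s)
    Ds = subst (0# <_) (begin
      area u y s * (ξ v - ξ w) + area w s v * (ξ y - ξ u)
        ≡⟨ cong₂ (λ a b → a * (ξ v - ξ w) + b * (ξ y - ξ u)) (area-flip u s y) (area-flip w v s) ⟨
      - area u s y * (ξ v - ξ w) + - area w v s * (ξ y - ξ u)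
        ≡⟨ solve 4 (λ a b c d → :- a :* b :+ :- c :* d := :- (c :* d :+ a :* b)) refl
             (area u s y) (ξ v - ξ w) (area w v s) (ξ y - ξ u) ⟩
      - (area w v s * (ξ y - ξ u) + area u s y * (ξ v - ξ w))
        ≡⟨ cong -_ (gap w v u y s) ⟨
      - D p m (ξ y) (ξ u) (ξ s) ∎) (sum-pos u<y w<v between-s)
      where open ≡-Reasoning

-- Plane straight-line graphs have at most three edges per vertex.

module Planar (R : RealField) (t : RealField.Carrier R) (S : List (Plane.Point R))
  (ξ-injective : Geometry.Generic R t S)
  where
  open OrderedField R
  open Geometry R t
  open Plane R using (Point)

  -- `Crosses` sees only proper crossings; `empty` is what excludes collinear edges that overlap
  -- from a common left or right end.
  record Edge (u v : Point) : Set where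
    field
      left∈  : u ∈ S
      right∈ : v ∈ S
      ξ<     : ξ u < ξ v
      empty  : ∀ {r} → r ∈ S → area u v r ≡ 0# → ξ u < ξ r → ξ r < ξ v → ⊥
  open Edge

  _≟ₚ_ : (p q : Point) → Dec (p ≡ q)
  _≟ₚ_ = ≡-dec (_≟ℝ_ R) (_≟ℝ_ R)

  collinear⇒≡ : ∀ {u u′ v} → Edge u v → Edge u′ v → area v u u′ ≡ 0# → u ≡ u′
  collinear⇒≡ {u} {u′} {v} e e′ a≡0 with compare (ξ u) (ξ u′)
  ... | tri< u<u′ _ _ = ⊥-elim (empty e (left∈ e′)
          (trans (sym (area-rotate u v u′)) (area-null-flip a≡0)) u<u′ (ξ< e′))
  ... | tri≈ _ u≡u′ _ = ξ-injective (left∈ e) (left∈ e′) u≡u′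
  ... | tri> _ _ u′<u = ⊥-elim (empty e′ (left∈ e)
          (trans (sym (area-rotate u′ v u)) a≡0) u′<u (ξ< e))

  collinear⇒≡ʳ : ∀ {u v v′} → Edge u v → Edge u v′ → area u v v′ ≡ 0# → v ≡ v′
  collinear⇒≡ʳ {u} {v} {v′} e e′ a≡0 with compare (ξ v) (ξ v′)
  ... | tri< v<v′ _ _ = ⊥-elim (empty e′ (right∈ e) (area-null-flip a≡0) (ξ< e) v<v′)
  ... | tri≈ _ v≡v′ _ = ξ-injective (right∈ e) (right∈ e′) v≡v′
  ... | tri> _ _ v′<v = ⊥-elim (empty e (right∈ e′) a≡0 (ξ< e′) v′<v)

  module _ (F : List Segment) (F-unique : Unique F)
           (F-edge : ∀ {u v} → (u , v) ∈ F → Edge u v)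
           (noncrossing : ∀ {a f} → a ∈ F → f ∈ F → ¬ Crosses a f) where

    -- z is the last point of S to the left of v in the wedge between the edge uv and the next
    -- edge wv below it.
    record Wedge (u v z : Point) : Set where
      field
        {w y} : Point
        wv∈   : (w , v) ∈ F
        below : 0# < area v u w
        next  : ∀ {w′} → (w′ , v) ∈ F → 0# < area v u w′ → 0# ≤ area v w w′
        uy∈   : (u , y) ∈ F
        under : 0# < area u y v
        z∈    : z ∈ S
        z<v   : ξ z < ξ v
        uz    : 0# ≤ area v u z
        zw    : 0# ≤ area v z w
        last  : ∀ {s} → s ∈ S → ξ s < ξ v → 0# ≤ area v u s → 0# ≤ area v s w → ξ s ≤ ξ z
    open Wedge

    -- Every edge is charged to a point of S together with one of three labels, and no charge is used twice.
    data Charge : Segment → Fin 3 × Point → Set where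
      lowest-left  : ∀ {u v} → (∀ {w} → (w , v) ∈ F → ¬ (0# < area v u w)) → Charge (u , v) (zero , v)
      lowest-right : ∀ {u v} → (∀ {y} → (u , y) ∈ F → ¬ (0# < area u y v)) → Charge (u , v) (suc zero , u)
      wedge        : ∀ {u v z} → Wedge u v z → Charge (u , v) (suc (suc zero) , z)

    module _ {u v z} (uv∈ : (u , v) ∈ F) (W : Wedge u v z) where
      private
        e = F-edge uv∈
        module W = Wedge W
        a = F-edge W.wv∈
        f = F-edge W.uy∈

      u≤z : ξ u ≤ ξ z
      u≤z = W.last (left∈ e) (ξ< e) (area-0≡0 (area-pqq v u)) (inj₁ W.below)

      w≤z : ξ W.w ≤ ξ z
      w≤z = W.last (left∈ a) (ξ< a) (inj₁ W.below) (area-0≡0 (area-pqq v W.w))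

      -- This is the purpose of `under`. If u were the last point of the wedge, the edge uy would
      -- enter the wedge at u and, having no point to end at inside, would descend through wv: at y
      -- itself, or before the abscissa of v, where it passes below v.
      z≢u : z ≢ u
      z≢u refl with <-or-≤ (ξ W.y) (ξ v)
      ... | inj₂ v≤y = noncrossing W.wv∈ W.uy∈
              (crossing (ξ< a) (ξ< f) w≤z (inj₂ refl) (ξ< e) (inj₂ refl) v≤y
                (lower (area-rotate⁺ (area-rotate⁺ W.below)) (area-0≡0 (area-ppq u W.y)))
                (lower W.under (area-0≡0 (area-pqq W.w v))))
      ... | inj₁ y<v = noncrossing W.wv∈ W.uy∈
              (crossing (ξ< a) (ξ< f) w≤z (inj₂ refl) (ξ< f) (inj₁ y<v) (inj₂ refl)
                (lower (area-rotate⁺ (area-rotate⁺ W.below)) (area-0≡0 (area-ppq u W.y)))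
                (upper (area-0≡0 (area-pqq u W.y)) y-below))
        where
        y-below : 0# < area W.w W.y v
        y-below with orientation v W.y W.w
        ... | left 0<a = ⊥-elim (<⇒≱ (ξ< f) (W.last (right∈ f) y<v (inj₁ (area-rotate⁺ (area-rotate⁺ W.under))) (inj₁ 0<a)))
        ... | collinear a≡0 = ⊥-elim (<⇒≱ (ξ< f) (W.last (right∈ f) y<v (inj₁ (area-rotate⁺ (area-rotate⁺ W.under))) (area-0≡0 a≡0)))
        ... | right 0<a = area-rotate⁺ 0<a

      below-edge : 0# < area v u z
      below-edge with uz W
      ... | inj₁ 0<a = 0<a
      ... | inj₂ 0≡a with u≤z
      ...   | inj₁ u<z = ⊥-elim (empty e W.z∈ (trans (sym (area-rotate u v z)) (area-null-flip (sym 0≡a))) u<z W.z<v)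
      ...   | inj₂ u≡z = ⊥-elim (z≢u (sym (ξ-injective (left∈ e) W.z∈ u≡z)))

    -- The wedges at one vertex are stacked: the wedge under u₁v stops at the next edge, which is no
    -- lower than u₂v, whereas z lies strictly below u₂v.
    no-lower : ∀ {u₁ u₂ v z} → (u₁ , v) ∈ F → (u₂ , v) ∈ F → Wedge u₁ v z → Wedge u₂ v z → ¬ (0# < area v u₁ u₂)
    no-lower {u₁} {u₂} {v} {z} e₁∈ e₂∈ W₁ W₂ u₂-below = area-pos⇒flip-neg (below-edge e₂∈ W₂)
      (angular-trans (z<v W₁) (ξ< (F-edge (wv∈ W₁))) (ξ< (F-edge e₂∈)) (zw W₁) (next W₁ e₂∈ u₂-below))

    -- Being later than z, the point v₁ cannot lie in the wedge of the second edge. It is therefore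
    -- beneath that wedge, and u₁v₁, which passes above z, has to descend through w₂v₂ to reach it.
    beneath-e₂ : ∀ {u₁ v₁ u₂ v₂ z} → (u₁ , v₁) ∈ F → (u₂ , v₂) ∈ F → Wedge u₁ v₁ z → Wedge u₂ v₂ z →
                 ξ v₁ < ξ v₂ → 0# ≤ area v₂ u₂ v₁ → ⊥
    beneath-e₂ {u₁} {v₁} {u₂} {v₂} {z} e₁∈ e₂∈ W₁ W₂ v₁<v₂ v₁-below with orientation v₂ v₁ (w W₂)
    ... | left 0<a = <⇒≱ (z<v W₁) (last W₂ (right∈ (F-edge e₁∈)) v₁<v₂ v₁-below (inj₁ 0<a))
    ... | collinear a≡0 = <⇒≱ (z<v W₁) (last W₂ (right∈ (F-edge e₁∈)) v₁<v₂ v₁-below (area-0≡0 a≡0))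
    ... | right beneath = noncrossing (wv∈ W₂) e₁∈
            (crossing (ξ< (F-edge (wv∈ W₂))) (ξ< (F-edge e₁∈)) (w≤z e₂∈ W₂) (u≤z e₁∈ W₁) (z<v W₁) (inj₁ v₁<v₂) (inj₂ refl)
              (upper (area-rotate⁰ (area-rotate⁰ (zw W₂))) (area-rotate⁺ (below-edge e₁∈ W₁)))
              (upper (area-0≡0 (area-pqq u₁ v₁)) (area-rotate⁺ beneath)))

    no-earlier : ∀ {u₁ v₁ u₂ v₂ z} → (u₁ , v₁) ∈ F → (u₂ , v₂) ∈ F → Wedge u₁ v₁ z → Wedge u₂ v₂ z → ¬ (ξ v₁ < ξ v₂)
    no-earlier {u₁} {v₁} {u₂} {v₂} {z} e₁∈ e₂∈ W₁ W₂ v₁<v₂ with orientation v₂ u₂ v₁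
    -- Here u₂v₂ runs above z and then below v₁, while w₁v₁ runs weakly below z and ends in v₁.
    ... | right above = noncrossing (wv∈ W₁) e₂∈
            (crossing (ξ< (F-edge (wv∈ W₁))) (ξ< (F-edge e₂∈)) (w≤z e₁∈ W₁) (u≤z e₂∈ W₂) (z<v W₁) (inj₂ refl) (inj₁ v₁<v₂)
              (upper (area-rotate⁰ (area-rotate⁰ (zw W₁))) (area-rotate⁺ (below-edge e₂∈ W₂)))
              (lower (area-rotate⁺ (area-rotate⁺ above)) (area-0≡0 (area-pqq (w W₁) v₁))))
    ... | left below-e₂ = beneath-e₂ e₁∈ e₂∈ W₁ W₂ v₁<v₂ (inj₁ below-e₂)
    ... | collinear a≡0 = beneath-e₂ e₁∈ e₂∈ W₁ W₂ v₁<v₂ (area-0≡0 a≡0)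
    charge-injective : ∀ {e e′ c} → e ∈ F → e′ ∈ F → Charge e c → Charge e′ c → e ≡ e′
    charge-injective {u , v} {u′ , _} e∈ e′∈ (lowest-left l) (lowest-left l′) =
      cong (_, v) (collinear⇒≡ (F-edge e∈) (F-edge e′∈) (area-antisym (¬right⇒0≤ (l′ e∈)) (¬right⇒0≤ (l e′∈))))
    charge-injective {u , v} {_ , v′} e∈ e′∈ (lowest-right l) (lowest-right l′) =
      cong (u ,_) (collinear⇒≡ʳ (F-edge e∈) (F-edge e′∈) (area-antisym (¬right⇒0≤ (l e′∈)) (¬right⇒0≤ (l′ e∈))))
    charge-injective {u , v} {u′ , v′} e∈ e′∈ (wedge W) (wedge W′) with compare (ξ v) (ξ v′)
    ... | tri< v<v′ _ _ = ⊥-elim (no-earlier e∈ e′∈ W W′ v<v′)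
    ... | tri> _ _ v′<v = ⊥-elim (no-earlier e′∈ e∈ W′ W v′<v)
    ... | tri≈ _ v≡v′ _ with ξ-injective (right∈ (F-edge e∈)) (right∈ (F-edge e′∈)) v≡v′
    ...   | refl with orientation v u u′
    ...     | left 0<a = ⊥-elim (no-lower e∈ e′∈ W W′ 0<a)
    ...     | right 0<a = ⊥-elim (no-lower e′∈ e∈ W′ W 0<a)
    ...     | collinear a≡0 = cong (_, v) (collinear⇒≡ (F-edge e∈) (F-edge e′∈) a≡0)

    module _ {u v} (e∈ : (u , v) ∈ F) where
      private
        e = F-edge e∈

        Below Under : Segment → Set
        Below a = proj₂ a ≡ v × 0# < area v u (proj₁ a)
        Under f = proj₁ f ≡ u × 0# < area u (proj₂ f) v

        below? : ∀ a → Dec (Below a)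
        below? a = proj₂ a ≟ₚ v ×-dec (0# <? area v u (proj₁ a))

        under? : ∀ f → Dec (Under f)
        under? f = proj₁ f ≟ₚ u ×-dec (0# <? area u (proj₂ f) v)

        InWedge : Point → Point → Set
        InWedge w s = ξ s < ξ v × 0# ≤ area v u s × 0# ≤ area v s w

        in-wedge? : ∀ w s → Dec (InWedge w s)
        in-wedge? w s = (ξ s <? ξ v) ×-dec (0# ≤? area v u s) ×-dec (0# ≤? area v s w)

      next-below : ∀ {w′} → (w′ , v) ∈ F → 0# < area v u w′ → ∃ λ w →
        (w , v) ∈ F × 0# < area v u w × (∀ {w″} → (w″ , v) ∈ F → 0# < area v u w″ → 0# ≤ area v w w″)
      next-below w′∈ w′-below = from-least
        (least-∈ {Q = λ a → ξ (proj₁ a) < ξ v} (λ a a′ → 0# ≤ area v (proj₁ a) (proj₁ a′))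
          (λ a a′ → area-total v (proj₁ a) (proj₁ a′)) (λ {a} {b} {c} → angular-trans {v} {proj₁ a} {proj₁ b} {proj₁ c})
          (filter below? F) (∈-filter⁺ below? w′∈ (refl , w′-below)) left-of)
        where
        left-of : ∀ {a} → a ∈ filter below? F → ξ (proj₁ a) < ξ v
        left-of {_ , _} a∈ with ∈-filter⁻ below? {xs = F} a∈
        ... | a∈F , refl , _ = ξ< (F-edge a∈F)

        from-least : (∃ λ a → a ∈ filter below? F × (∀ {a′} → a′ ∈ filter below? F → 0# ≤ area v (proj₁ a) (proj₁ a′))) →
          ∃ λ w → (w , v) ∈ F × 0# < area v u w × (∀ {w″} → (w″ , v) ∈ F → 0# < area v u w″ → 0# ≤ area v w w″)
        from-least ((w , _) , m∈ , m-next) with ∈-filter⁻ below? {xs = F} m∈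
        ... | wv∈ , refl , w-below = w , wv∈ , w-below , λ w″∈ w″-below → m-next (∈-filter⁺ below? w″∈ (refl , w″-below))

      last-in-wedge : ∀ {w} → 0# < area v u w → ∃ λ z → z ∈ S × InWedge w z × (∀ {s} → s ∈ S → InWedge w s → ξ s ≤ ξ z)
      last-in-wedge {w} w-below = from-least
        (least-∈ {Q = λ _ → ⊤} (λ s s′ → ξ s′ ≤ ξ s) (λ s s′ → ≤-total (ξ s′) (ξ s)) (λ _ _ _ b≤a c≤b → ≤-trans c≤b b≤a)
          (filter (in-wedge? w) S) (∈-filter⁺ (in-wedge? w) (left∈ e) (ξ< e , area-0≡0 (area-pqq v u) , inj₁ w-below)) _)
        where
        from-least : (∃ λ z → z ∈ filter (in-wedge? w) S × (∀ {s} → s ∈ filter (in-wedge? w) S → ξ s ≤ ξ z)) →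
          ∃ λ z → z ∈ S × InWedge w z × (∀ {s} → s ∈ S → InWedge w s → ξ s ≤ ξ z)
        from-least (z , z∈ , z-last) with ∈-filter⁻ (in-wedge? w) {xs = S} z∈
        ... | z∈S , z-in = z , z∈S , z-in , λ s∈ s-in → z-last (∈-filter⁺ (in-wedge? w) s∈ s-in)

      make-wedge : ∀ {w′ y} → (w′ , v) ∈ F → 0# < area v u w′ → (u , y) ∈ F → 0# < area u y v → ∃ λ z → Wedge u v z
      make-wedge w′∈ w′-below uy∈ under =
        let w , wv∈ , w-below , next = next-below w′∈ w′-below
            z , z∈ , (z<v , uz , zw) , last = last-in-wedge w-below
        in z , record { wv∈ = wv∈ ; below = w-below ; next = next ; uy∈ = uy∈ ; under = under
                      ; z∈ = z∈ ; z<v = z<v ; uz = uz ; zw = zw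
                      ; last = λ s∈ s<v us sw → last s∈ (s<v , us , sw) }

      charge : ∃ λ c → c ∈ cartesianProduct (allFin 3) S × Charge (u , v) c
      charge = by-cases (any? below? F) (any? under? F)
        where
        wedge-charge : (∃ λ a → a ∈ F × Below a) → (∃ λ f → f ∈ F × Under f) →
                       ∃ λ c → c ∈ cartesianProduct (allFin 3) S × Charge (u , v) c
        wedge-charge ((_ , _) , w∈ , refl , w-below) ((_ , _) , y∈ , refl , y-under) =
          let z , W = make-wedge w∈ w-below y∈ y-under
          in (suc (suc zero) , z) , ∈-cartesianProduct⁺ (∈-allFin (suc (suc zero))) (z∈ W) , wedge W

        by-cases : Dec (Any Below F) → Dec (Any Under F) → ∃ λ c → c ∈ cartesianProduct (allFin 3) S × Charge (u , v) c
        by-cases (no ¬below) _ = (zero , v) , ∈-cartesianProduct⁺ (∈-allFin {n = 3} zero) (right∈ e) ,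
          lowest-left λ w∈ 0<a → ¬below (lose w∈ (refl , 0<a))
        by-cases (yes _) (no ¬under) = (suc zero , u) , ∈-cartesianProduct⁺ (∈-allFin {n = 3} (suc zero)) (left∈ e) ,
          lowest-right λ y∈ 0<a → ¬under (lose y∈ (refl , 0<a))
        by-cases (yes below) (yes under) = wedge-charge (find below) (find under)

    planar-bound : length F ℕ.≤ 3 ℕ.* length S
    planar-bound = subst (length F ℕ.≤_) (length-cartesianProduct (allFin 3) S)
      (pigeonhole Charge F (cartesianProduct (allFin 3) S) F-unique charge charge-injective)

-- Rotating the line of an edge until it first meets another point.

module Rotation (R : RealField) (t : RealField.Carrier R) (S : List (Plane.Point R))
  (ξ-injective : Geometry.Generic R t S)
  where
  open OrderedField R
  open Geometry R t
  open Plane R using (Point)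
  open Planar R t S ξ-injective using (Edge)
  open Solver using (solve; _:=_; _:+_; _:*_; _:-_; :-_; con)
  open Edge

  -- The line ef, rotated counterclockwise, first meets a line joining e or f to another point of S
  -- when it reaches the line er.
  record FirstHit (e f r : Point) : Set where
    field
      r∈      : r ∈ S
      r-left  : 0# < area e f r
      lefts   : ∀ {s} → s ∈ S → 0# < area e f s → 0# ≤ area e r s
      -- Points on the right are met by turning about f: area e r f - area e r s is the cross
      -- product of r - e and f - s.
      rights  : ∀ {s} → s ∈ S → 0# < area e s f → area e r s ≤ area e r f
  open FirstHit

  -- This makes e an end of the new line: a point of er on the other side of ef would have been met
  -- earlier, in the rotation about f.
  ¬right-on-hit : ∀ {e f r s} → FirstHit e f r → s ∈ S → area e r s ≡ 0# → ¬ (0# < area e s f)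
  ¬right-on-hit {e} {f} {r} h s∈ ers≡0 0<esf =
    area-pos⇒flip-neg (r-left h) (subst (_≤ area e r f) ers≡0 (rights h s∈ 0<esf))

  -- The points r and r′ lie on one ray from e, and r′ is left of ef′. With f′ left of ef, the
  -- rotation from ef would sweep over f′ strictly before r, against `lefts`.
  hit-conflict : ∀ {e f f′ r r′} → f′ ∈ S → FirstHit e f r → FirstHit e f′ r′ → area e r r′ ≡ 0# → ¬ (0# < area e f f′)
  hit-conflict {e} {f} {f′} {r} {r′} f′∈ h h′ err′≡0 0<eff′ =
    ¬pos-neg (*-pos (r-left h) (r-left h′)) (neg-nonneg (subst (0# ≤_) identity
      (nonneg*nonneg (¬right⇒0≤ (¬right-on-hit h (r∈ h′) err′≡0)) (lefts h f′∈ 0<eff′))))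
    where
    identity : area e f r′ * area e r f′ ≡ - (area e f r * area e f′ r′)
    identity = trans (sym (plücker e f r r′ f′)) (trans (cong₂ (λ a b → area e f r * a + area e f f′ * b)
        (sym (area-flip e f′ r′)) err′≡0)
      (solve 3 (λ x y z → x :* (:- y) :+ z :* con 0ℤ := :- (x :* y)) refl (area e f r) (area e f′ r′) (area e f f′)))
    neg-nonneg : 0# ≤ - (area e f r * area e f′ r′) → 0# < - (area e f r * area e f′ r′)
    neg-nonneg (inj₁ 0<x) = 0<x
    neg-nonneg (inj₂ 0≡x) = ⊥-elim (pos⇒≢0 (*-pos (r-left h) (r-left h′))
      (trans (solve 1 (λ x → x := :- (:- x)) refl _) (trans (cong -_ (sym 0≡x)) -0#≈0#)))

  -- Along er the abscissa relative to e is proportional to the height over ef; since no point of er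
  -- has negative height, e is the first or the last point according to the sign of ξ r - ξ e.
  hit-shift : ∀ {e f r s} → FirstHit e f r → area e r s ≡ 0# → area e f r * (ξ s - ξ e) ≡ area e f s * (ξ r - ξ e)
  hit-shift {e} {f} {r} {s} h ers≡0 = trans (trans
    (solve 3 (λ x y z → x :* y := x :* y :+ con 0ℤ :* z) refl (area e f r) (ξ s - ξ e) (ξ f - ξ e))
    (cong (λ a → area e f r * (ξ s - ξ e) + a * (ξ f - ξ e)) (sym ers≡0)))
    (plücker-ξ e f r s)

  hit-first : ∀ {e f r s} → FirstHit e f r → ξ e < ξ r → s ∈ S → area e r s ≡ 0# → ξ e ≤ ξ s
  hit-first h e<r s∈ ers≡0 = 0≤-⇒≤ (*-cancel-nonneg (r-left h) (subst (0# ≤_) (sym (hit-shift h ers≡0))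
    (nonneg*nonneg (¬right⇒0≤ (¬right-on-hit h s∈ ers≡0)) (inj₁ (<⇒0<- e<r)))))

  hit-last : ∀ {e f r s} → FirstHit e f r → ξ r < ξ e → s ∈ S → area e r s ≡ 0# → ξ s ≤ ξ e
  hit-last {e} {f} {r} {s} h r<e s∈ ers≡0 = 0≤-⇒≤ (*-cancel-nonneg (r-left h) (subst (0# ≤_) identity
    (nonneg*nonneg (¬right⇒0≤ (¬right-on-hit h s∈ ers≡0)) (inj₁ (<⇒0<- r<e)))))
    where
    identity : area e f s * (ξ e - ξ r) ≡ area e f r * (ξ e - ξ s)
    identity = trans (solve 3 (λ a e r → a :* (e :- r) := :- (a :* (r :- e))) refl (area e f s) (ξ e) (ξ r))
      (trans (cong -_ (sym (hit-shift h ers≡0)))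
        (solve 3 (λ a e s → :- (a :* (s :- e)) := a :* (e :- s)) refl (area e f r) (ξ e) (ξ s)))

  module _ {p q} (edge : Edge p q) where
    private
      -- The direction of the turning line when it meets s: about p for a point on the left, about q
      -- for one on the right. All these directions lie on one side of pq, where they are linearly
      -- ordered. The collinear value is a default that `off?` filters out.
      vector : ∀ {s} → Orientation p q s → Point
      vector {s} (left _) = s ∖ p
      vector (collinear _) = q ∖ p
      vector {s} (right _) = q ∖ s

      direction : Point → Point
      direction s = vector (orientation p q s)

      direction-left : ∀ {s} → 0# < area p q s → direction s ≡ s ∖ p
      direction-left {s} 0<a = go (orientation p q s)
        where
        go : (o : Orientation p q s) → vector o ≡ s ∖ p
        go (left _) = refl
        go (collinear a≡0) = ⊥-elim (pos⇒≢0 0<a a≡0)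
        go (right 0<a′) = ⊥-elim (area-pos⇒flip-neg 0<a (inj₁ 0<a′))

      direction-right : ∀ {s} → 0# < area p s q → direction s ≡ q ∖ s
      direction-right {s} 0<a = go (orientation p q s)
        where
        go : (o : Orientation p q s) → vector o ≡ q ∖ s
        go (right _) = refl
        go (collinear a≡0) = ⊥-elim (pos⇒≢0 0<a (area-null-flip a≡0))
        go (left 0<a′) = ⊥-elim (area-pos⇒flip-neg 0<a (inj₁ 0<a′))

      direction-up : ∀ {s} → area p q s ≢ 0# → 0# < cross (q ∖ p) (direction s)
      direction-up {s} a≢0 = go (orientation p q s)
        where
        go : (o : Orientation p q s) → 0# < cross (q ∖ p) (vector o)
        go (left 0<a) = subst (0# <_) (sym (cross-from p q s)) 0<a
        go (collinear a≡0) = ⊥-elim (a≢0 a≡0)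
        go (right 0<a) = subst (0# <_) (sym (trans (cross-from-to p q q s) (trans (cong (_- area p q s) (area-pqq p q))
          (trans (solve 1 (λ x → con 0ℤ :- x := :- x) refl (area p q s)) (area-flip p q s))))) 0<a

      _≼_ : Point → Point → Set
      a ≼ b = 0# ≤ cross (direction a) (direction b)

      ≼-total : ∀ a b → a ≼ b ⊎ b ≼ a
      ≼-total a b with sign (cross (direction a) (direction b))
      ... | positive 0<c = inj₁ (inj₁ 0<c)
      ... | null c≡0 = inj₁ (inj₂ (sym c≡0))
      ... | negative 0<-c = inj₂ (inj₁ (subst (0# <_) (cross-flip _ _) 0<-c))

      Up : Point → Set
      Up s = 0# < cross (q ∖ p) (direction s)

      ≼-trans : ∀ {a b c} → Up a → Up b → Up c → a ≼ b → b ≼ c → a ≼ c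
      ≼-trans {a} {b} {c} ua ub uc ab bc = *-cancel-nonneg ub (subst (0# ≤_) (cross-plücker _ _ _ _)
        (nonneg+nonneg (nonneg*nonneg (inj₁ ua) bc) (nonneg*nonneg (inj₁ uc) ab)))

      off? : ∀ s → Dec (area p q s ≢ 0#)
      off? s = ¬? (_≟ℝ_ R (area p q s) 0#)

      cross-at : ∀ {a b v w} → direction a ≡ v → direction b ≡ w → ∀ {c} → cross v w ≡ c → a ≼ b → 0# ≤ c
      cross-at refl refl refl a≼b = a≼b

    first-hit : (∃ λ s → s ∈ S × area p q s ≢ 0#) → ∃ λ r → FirstHit p q r ⊎ FirstHit q p r
    first-hit (s , s∈ , off) = from-least
      (least-∈ _≼_ ≼-total (λ {a} {b} {c} → ≼-trans {a} {b} {c}) (filter off? S) (∈-filter⁺ off? s∈ off)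
        (λ y∈ → direction-up (proj₂ (∈-filter⁻ off? {xs = S} y∈))))
      where
      from-least : (∃ λ r → r ∈ filter off? S × (∀ {s} → s ∈ filter off? S → r ≼ s)) →
                   ∃ λ r → FirstHit p q r ⊎ FirstHit q p r
      from-least (r , r∈f , r-least) = r , by-side (orientation p q r)
        where
        r∈S = proj₁ (∈-filter⁻ off? {xs = S} r∈f)
        by-side : Orientation p q r → FirstHit p q r ⊎ FirstHit q p r
        by-side (collinear a≡0) = ⊥-elim (proj₂ (∈-filter⁻ off? {xs = S} r∈f) a≡0)
        by-side (left 0<a) = inj₁ record
          { r∈ = r∈S ; r-left = 0<a
          ; lefts = λ {s} s∈ 0<s → cross-at (direction-left 0<a) (direction-left 0<s) (cross-from p r s)
                  (r-least (∈-filter⁺ off? s∈ (pos⇒≢0 0<s)))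
          ; rights = λ {s} s∈ 0<s → 0≤-⇒≤ (cross-at (direction-left 0<a) (direction-right 0<s) (cross-from-to p q r s)
                  (r-least (∈-filter⁺ off? s∈ (λ a≡0 → pos⇒≢0 0<s (area-null-flip a≡0))))) }
        by-side (right 0<a) = inj₂ record
          { r∈ = r∈S ; r-left = area-rotate⁺ (area-rotate⁺ 0<a)
          ; lefts = λ {s} s∈ 0<s → let 0<s′ = area-rotate⁺ 0<s in
                  cross-at (direction-right 0<a) (direction-right 0<s′) (cross-to q r s)
                  (r-least (∈-filter⁺ off? s∈ (λ a≡0 → pos⇒≢0 0<s′ (area-null-flip a≡0))))
          ; rights = λ {s} s∈ 0<s → let 0<s′ = area-rotate⁺ (area-rotate⁺ 0<s) in
                  0≤-⇒≤ (cross-at (direction-right 0<a) (direction-left 0<s′) (cross-to-from p q r s)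
                  (r-least (∈-filter⁺ off? s∈ (pos⇒≢0 0<s′)))) }

-- Lines as pairs of points, and the lines spanned by the configuration.

module Lines (R : RealField) (t : RealField.Carrier R) where
  open OrderedField R
  open Geometry R t
  open Plane R using (Point)
  open Solver using (solve; _:=_; _:+_; _:*_; _:-_; :-_; con)

  On : Segment → Point → Set
  On (a , b) s = area a b s ≡ 0#

  on? : ∀ ℓ s → Dec (On ℓ s)
  on? (a , b) s = _≟ℝ_ R (area a b s) 0#

  Rising : Segment → Set
  Rising (a , b) = ξ a < ξ b

  ξ-≢ : ∀ {a b} → ξ a ≢ ξ b → ξ b - ξ a ≢ 0#
  ξ-≢ a≢b d≡0 = a≢b (sym (-≡0⇒≡ d≡0))

  <⇒ξ≢ : ∀ {a b} → ξ a < ξ b → ξ a ≢ ξ b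
  <⇒ξ≢ a<b a≡b = <-irrefl (subst (_ <_) (sym a≡b) a<b)

  -- On a common line the areas over pq and over ab differ by the ratio of the lengths measured by
  -- `ξ`, so incidence and sides do not depend on the chosen pair.
  rescale : ∀ {a b p q} r → On (a , b) p → On (a , b) q → area p q r * (ξ b - ξ a) ≡ area a b r * (ξ q - ξ p)
  rescale {a} {b} {p} {q} r ap≡0 aq≡0 = trans (change-line a b p q r)
    (trans (cong₂ (λ y z → (area a b r - y) * (ξ q - ξ p) - (z - y) * (ξ r - ξ p)) ap≡0 aq≡0)
      (solve 3 (λ x y z → (x :- con 0ℤ) :* y :- (con 0ℤ :- con 0ℤ) :* z := x :* y) refl (area a b r) (ξ q - ξ p) (ξ r - ξ p)))

  on-chord⇒on : ∀ {a b p q r} → ξ p ≢ ξ q → On (a , b) p → On (a , b) q → On (p , q) r → On (a , b) r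
  on-chord⇒on {a} {b} {p} {q} {r} p≢q ap aq pr = *-≡0 (ξ-≢ p≢q) (trans (*-comm _ _)
    (trans (sym (rescale r ap aq)) (trans (cong (_* (ξ b - ξ a)) pr) (zeroˡ _))))

  on⇒on-chord : ∀ {a b p q r} → ξ a ≢ ξ b → On (a , b) p → On (a , b) q → On (a , b) r → On (p , q) r
  on⇒on-chord {a} {b} {p} {q} {r} a≢b ap aq ar = *-≡0 (ξ-≢ a≢b) (trans (*-comm _ _)
    (trans (rescale r ap aq) (trans (cong (_* (ξ q - ξ p)) ar) (zeroˡ _))))

  Same : Segment → Segment → Set
  Same ℓ (p , q) = On ℓ p × On ℓ q

  same? : ∀ ℓ m → Dec (Same ℓ m)
  same? ℓ (p , q) = on? ℓ p ×-dec on? ℓ q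

  distinct : List Segment → List Segment
  distinct [] = []
  distinct (m ∷ ms) with any? (same? m) (distinct ms)
  ... | yes _ = distinct ms
  ... | no _ = m ∷ distinct ms

  distinct-⊆ : ∀ ms {m} → m ∈ distinct ms → m ∈ ms
  distinct-⊆ (m ∷ ms) m∈ with any? (same? m) (distinct ms)
  ... | yes _ = there (distinct-⊆ ms m∈)
  distinct-⊆ (m ∷ ms) (here refl) | no _ = here refl
  distinct-⊆ (m ∷ ms) (there m∈) | no _ = there (distinct-⊆ ms m∈)

  distinct-AllPairs : ∀ ms → AllPairs (λ ℓ m → ¬ Same ℓ m) (distinct ms)
  distinct-AllPairs [] = []
  distinct-AllPairs (m ∷ ms) with any? (same? m) (distinct ms)
  ... | yes _ = distinct-AllPairs ms
  ... | no ¬same = All.tabulate (λ m′∈ same → ¬same (lose m′∈ same)) ∷ distinct-AllPairs ms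

  distinct-cover : ∀ ms {m} → m ∈ ms → ∃ λ ℓ → ℓ ∈ distinct ms × Same m ℓ
  distinct-cover (m ∷ ms) m∈ with any? (same? m) (distinct ms)
  distinct-cover (m ∷ ms) (here refl) | yes same = find same
  distinct-cover (m ∷ ms) (there m∈) | yes _ = distinct-cover ms m∈
  distinct-cover ((p , q) ∷ ms) (here refl) | no _ = (p , q) , here refl , area-pqp p q , area-pqq p q
  distinct-cover (m ∷ ms) (there m∈) | no _ = let ℓ , ℓ∈ , same = distinct-cover ms m∈ in ℓ , there ℓ∈ , same

module Configuration (R : RealField) (t : RealField.Carrier R) (P : List (Plane.Point R)) (P-unique : Unique P)
  (ξ-injective : Geometry.Generic R t P)
  where
  open OrderedField R
  open Geometry R t
  open Plane R using (Point)
  open Lines R t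

  rising? : ∀ e → Dec (Rising e)
  rising? (a , b) = ξ a <? ξ b

  candidates : List Segment
  candidates = filter rising? (cartesianProduct P P)

  ls : List Segment
  ls = distinct candidates

  line-ends : ∀ {a b} → (a , b) ∈ ls → a ∈ P × b ∈ P × ξ a < ξ b
  line-ends ℓ∈ with ∈-filter⁻ rising? {xs = cartesianProduct P P} (distinct-⊆ candidates ℓ∈)
  ... | ab∈ , a<b with ∈-cartesianProduct⁻ P P ab∈
  ...   | a∈ , b∈ = a∈ , b∈ , a<b

  ≢⇒ξ≢ : ∀ {p q} → p ∈ P → q ∈ P → p ≢ q → ξ p ≢ ξ q
  ≢⇒ξ≢ p∈ q∈ p≢q ξp≡ξq = p≢q (ξ-injective p∈ q∈ ξp≡ξq)

  joins : ∀ {p q} → p ∈ P → q ∈ P → p ≢ q → ∃ λ ℓ → ℓ ∈ ls × On ℓ p × On ℓ q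
  joins {p} {q} p∈ q∈ p≢q = by-order (compare (ξ p) (ξ q))
    where
    rising : ∀ {p q} → p ∈ P → q ∈ P → ξ p < ξ q → ∃ λ ℓ → ℓ ∈ ls × On ℓ p × On ℓ q
    rising {p} {q} p∈ q∈ p<q =
      let (a , b) , ℓ∈ , pa , pb = distinct-cover candidates (∈-filter⁺ rising? (∈-cartesianProduct⁺ p∈ q∈) p<q)
          a∈ , b∈ , a<b = line-ends ℓ∈
      in (a , b) , ℓ∈ , on⇒on-chord (<⇒ξ≢ p<q) pa pb (area-pqp p q) , on⇒on-chord (<⇒ξ≢ p<q) pa pb (area-pqq p q)

    by-order : _ → ∃ λ ℓ → ℓ ∈ ls × On ℓ p × On ℓ q
    by-order (tri< p<q _ _) = rising p∈ q∈ p<q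
    by-order (tri≈ _ p≡q _) = ⊥-elim (p≢q (ξ-injective p∈ q∈ p≡q))
    by-order (tri> _ _ q<p) = let ℓ , ℓ∈ , oq , op = rising q∈ p∈ q<p in ℓ , ℓ∈ , op , oq

  meet : ∀ {ℓ m p q} → ℓ ∈ ls → m ∈ ls → p ∈ P → q ∈ P → p ≢ q → On ℓ p → On ℓ q → On m p → On m q → ℓ ≡ m
  meet {a , b} {c , d} {p} {q} ℓ∈ m∈ p∈ q∈ p≢q ℓp ℓq mp mq = [_,_]′ id (λ s → ⊥-elim ([_,_]′ (λ ¬same → ¬same ℓm) (λ ¬same → ¬same mℓ) s))
    (AllPairs-lookup (distinct-AllPairs candidates) ℓ∈ m∈)
    where
    ξp≢ξq = ≢⇒ξ≢ p∈ q∈ p≢q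
    ξa≢ξb = <⇒ξ≢ (proj₂ (proj₂ (line-ends ℓ∈)))
    ξc≢ξd = <⇒ξ≢ (proj₂ (proj₂ (line-ends m∈)))
    ℓm : Same (a , b) (c , d)
    ℓm = on-chord⇒on ξp≢ξq ℓp ℓq (on⇒on-chord ξc≢ξd mp mq (area-pqp c d)) ,
         on-chord⇒on ξp≢ξq ℓp ℓq (on⇒on-chord ξc≢ξd mp mq (area-pqq c d))
    mℓ : Same (c , d) (a , b)
    mℓ = on-chord⇒on ξp≢ξq mp mq (on⇒on-chord ξa≢ξb ℓp ℓq (area-pqp a b)) ,
         on-chord⇒on ξp≢ξq mp mq (on⇒on-chord ξa≢ξb ℓp ℓq (area-pqq a b))

  ls-unique : Unique ls
  ls-unique = AllPairs.map (λ { {p , q} ¬same refl → ¬same (area-pqp p q , area-pqq p q) }) (distinct-AllPairs candidates)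

  x : Segment → List Point → ℕ
  x ℓ S = ∑ S (λ s → 𝟙 (on? ℓ s))

-- Melchior's inequality for subsets, written with the lines of the whole configuration.

module Sample (R : RealField) (t : RealField.Carrier R) (P : List (Plane.Point R)) (P-unique : Unique P)
  (ξ-injective : Geometry.Generic R t P)
  (S : List (Plane.Point R)) (S⊆P : ∀ {p} → p ∈ S → p ∈ P) (S-unique : Unique S)
  where
  open OrderedField R
  open Geometry R t
  open Plane R using (Point)
  open Lines R t
  open Configuration R t P P-unique ξ-injective
  open Solver using (solve; _:=_; _:+_; _:*_; _:-_; :-_; con)

  ξ-injectiveˢ : ∀ {p q} → p ∈ S → q ∈ S → ξ p ≡ ξ q → p ≡ q
  ξ-injectiveˢ p∈ q∈ = ξ-injective (S⊆P p∈) (S⊆P q∈)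

  open Planar R t S ξ-injectiveˢ public
  open Rotation R t S ξ-injectiveˢ
  open Edge

  InGap : Segment → Point → Set
  InGap (u , v) r = area u v r ≡ 0# × ξ u < ξ r × ξ r < ξ v

  in-gap? : ∀ e r → Dec (InGap e r)
  in-gap? (u , v) r = (_≟ℝ_ R (area u v r) 0#) ×-dec ((ξ u <? ξ r) ×-dec (ξ r <? ξ v))

  Consecutive : Segment → Set
  Consecutive e = Rising e × All (λ r → ¬ InGap e r) S

  consecutive? : ∀ e → Dec (Consecutive e)
  consecutive? e = rising? e ×-dec all? (λ r → ¬? (in-gap? e r)) S

  edges : List Segment
  edges = filter consecutive? (cartesianProduct S S)

  edges-unique : Unique edges
  edges-unique = Unique.filter⁺ consecutive? (Unique.cartesianProduct⁺ S-unique S-unique)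

  edges⇒Edge : ∀ {u v} → (u , v) ∈ edges → Edge u v
  edges⇒Edge e∈ =
    let uv∈ , u<v , gap = ∈-filter⁻ consecutive? {xs = cartesianProduct S S} e∈
        u∈ , v∈ = ∈-cartesianProduct⁻ S S uv∈
    in record { left∈ = u∈ ; right∈ = v∈ ; ξ< = u<v
              ; empty = λ r∈ a≡0 u<r r<v → All.lookup gap r∈ (a≡0 , u<r , r<v) }

  Edge⇒edges : ∀ {u v} → Edge u v → (u , v) ∈ edges
  Edge⇒edges e = ∈-filter⁺ consecutive? (∈-cartesianProduct⁺ (left∈ e) (right∈ e))
    (ξ< e , All.tabulate (λ r∈ (a≡0 , u<r , r<v) → empty e r∈ a≡0 u<r r<v))

  edges-on : Segment → List Segment
  edges-on ℓ = filter (same? ℓ) edges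

  private
    data Successor (ℓ : Segment) (s : Point) : Maybe Segment → Set where
      final : (∀ {r} → r ∈ S → On ℓ r → ξ r ≤ ξ s) → Successor ℓ s nothing
      next  : ∀ {v} → Successor ℓ s (just (s , v))

  -- Every point of the line but its last one starts an edge; `nothing` stands for the missing
  -- successor of the last one, hence the `suc`.
  x≤edges-on : ∀ {ℓ} → ℓ ∈ ls → x ℓ S ℕ.≤ suc (length (edges-on ℓ))
  x≤edges-on {ℓ@(a , b)} ℓ∈ = subst₂ ℕ._≤_ (length-filter-𝟙 (on? ℓ) S) (cong suc (length-map just (edges-on ℓ)))
    (pigeonhole (Successor ℓ) (filter (on? ℓ) S) (nothing ∷ map just (edges-on ℓ)) (Unique.filter⁺ (on? ℓ) S-unique)
      (λ s∈ → let s∈S , s-on = ∈-filter⁻ (on? ℓ) {xs = S} s∈ in by-cases s∈S s-on (any? (later? _) S)) injective)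
    where
    a≢b = <⇒ξ≢ (proj₂ (proj₂ (line-ends ℓ∈)))

    Later : Point → Point → Set
    Later s r = On ℓ r × ξ s < ξ r

    later? : ∀ s r → Dec (Later s r)
    later? s r = on? ℓ r ×-dec (ξ s <? ξ r)

    closest : ∀ {s r} → s ∈ S → On ℓ s → r ∈ S → Later s r → ∃ λ v → (s , v) ∈ edges-on ℓ
    closest {s} {r} s∈ s-on r∈ r-later =
      let v , v∈f , v-least = least-∈ {Q = λ _ → ⊤} (λ r r′ → ξ r ≤ ξ r′) (λ r r′ → ≤-total (ξ r) (ξ r′)) (λ _ _ _ → ≤-trans)
                                (filter (later? s) S) (∈-filter⁺ (later? s) r∈ r-later) _
          v∈ , v-on , s<v = ∈-filter⁻ (later? s) {xs = S} v∈f
          s≢v = <⇒ξ≢ s<v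
      in v , ∈-filter⁺ (same? ℓ) (Edge⇒edges record
           { left∈ = s∈ ; right∈ = v∈ ; ξ< = s<v
           ; empty = λ q∈ a≡0 s<q q<v → <⇒≱ q<v (v-least (∈-filter⁺ (later? s) q∈ (on-chord⇒on s≢v s-on v-on a≡0 , s<q))) })
           (s-on , v-on)

    by-cases : ∀ {s} → s ∈ S → On ℓ s → Dec (Any (Later s) S) → ∃ λ y → y ∈ nothing ∷ map just (edges-on ℓ) × Successor ℓ s y
    by-cases {s} s∈ s-on (yes later) =
      let r , r∈ , r-later = find later
          v , e∈ = closest s∈ s-on r∈ r-later
      in just (s , v) , there (∈-map⁺ just e∈) , next
    by-cases {s} s∈ s-on (no ¬later) = nothing , here refl , final λ {r} r∈ r-on → not-later r∈ r-on (<-or-≤ (ξ s) (ξ r))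
      where
      not-later : ∀ {r} → r ∈ S → On ℓ r → ξ s < ξ r ⊎ ξ r ≤ ξ s → ξ r ≤ ξ s
      not-later r∈ r-on (inj₁ s<r) = ⊥-elim (¬later (lose r∈ (r-on , s<r)))
      not-later r∈ r-on (inj₂ r≤s) = r≤s

    injective : ∀ {s s′ y} → s ∈ filter (on? ℓ) S → s′ ∈ filter (on? ℓ) S → Successor ℓ s y → Successor ℓ s′ y → s ≡ s′
    injective s∈ s′∈ (final h) (final h′) =
      let s∈S , s-on = ∈-filter⁻ (on? ℓ) {xs = S} s∈
          s′∈S , s′-on = ∈-filter⁻ (on? ℓ) {xs = S} s′∈
      in ξ-injectiveˢ s∈S s′∈S (≤-antisym (h′ s∈S s-on) (h s′∈S s′-on))
    injective _ _ next next = refl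

  spanned? : ∀ ls′ e → Dec (Any (λ ℓ → Same ℓ e) ls′)
  spanned? ls′ e = any? (λ ℓ → same? ℓ e) ls′

  ∑-edges-on : ∀ {ls′} → Unique ls′ → (∀ {ℓ} → ℓ ∈ ls′ → ℓ ∈ ls) →
               ∑ ls′ (λ ℓ → length (edges-on ℓ)) ℕ.≤ length (filter (spanned? ls′) edges)
  ∑-edges-on {ls′} unique ls′⊆ls = begin
    ∑ ls′ (λ ℓ → length (edges-on ℓ))           ≡⟨ ∑-cong ls′ (λ {ℓ} _ → length-filter-𝟙 (same? ℓ) edges) ⟩
    ∑ ls′ (λ ℓ → ∑ edges (λ e → 𝟙 (same? ℓ e))) ≡⟨ ∑-swap ls′ edges (λ ℓ e → 𝟙 (same? ℓ e)) ⟩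
    ∑ edges (λ e → ∑ ls′ (λ ℓ → 𝟙 (same? ℓ e))) ≤⟨ ∑-mono edges (λ {e} e∈ → one e∈ (spanned? ls′ e)) ⟩
    ∑ edges (λ e → 𝟙 (spanned? ls′ e))          ≡⟨ length-filter-𝟙 (spanned? ls′) edges ⟨
    length (filter (spanned? ls′) edges)        ∎
    where
    open ℕ.≤-Reasoning
    one : ∀ {e} → e ∈ edges → (d : Dec (Any (λ ℓ → Same ℓ e) ls′)) → ∑ ls′ (λ ℓ → 𝟙 (same? ℓ e)) ℕ.≤ 𝟙 d
    one {u , v} e∈ (yes _) = at-most-one (λ ℓ → same? ℓ (u , v)) unique λ ℓ∈ m∈ (ℓu , ℓv) (mu , mv) →
      meet (ls′⊆ls ℓ∈) (ls′⊆ls m∈) (S⊆P (left∈ (edges⇒Edge e∈))) (S⊆P (right∈ (edges⇒Edge e∈)))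
        (λ { refl → <-irrefl (ξ< (edges⇒Edge e∈)) }) ℓu ℓv mu mv
    one {e} e∈ (no ¬s) = ℕ.≤-reflexive (none-zero (λ ℓ → same? ℓ e) ls′ (λ ℓ∈ s → ¬s (lose ℓ∈ s)))

  data Ends (p q : Point) : Point → Point → Set where
    forward  : Ends p q p q
    backward : Ends p q q p

  Extreme : Bool → Segment → Point → Set
  Extreme true ℓ e = ∀ {s} → s ∈ S → On ℓ s → ξ e ≤ ξ s
  Extreme false ℓ e = ∀ {s} → s ∈ S → On ℓ s → ξ s ≤ ξ e

  extreme-unique : ∀ b {ℓ e e′} → e ∈ S → e′ ∈ S → On ℓ e → On ℓ e′ → Extreme b ℓ e → Extreme b ℓ e′ → e ≡ e′
  extreme-unique true e∈ e′∈ on on′ h h′ = ξ-injectiveˢ e∈ e′∈ (≤-antisym (h e′∈ on′) (h′ e∈ on))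
  extreme-unique false e∈ e′∈ on on′ h h′ = ξ-injectiveˢ e∈ e′∈ (≤-antisym (h′ e∈ on) (h e′∈ on′))

  data Flag (p q : Point) (ℓ : Segment) (b : Bool) : Set where
    flag : ∀ {e f r} → Ends p q e f → FirstHit e f r → ℓ ∈ ls → On ℓ e → On ℓ r → Extreme b ℓ e → Flag p q ℓ b

  -- The edge pq is charged to an end of the line that FirstHit provides, unless all of S lies on the line pq.
  data FlagOrRest : Segment → Segment × Bool ⊎ Point → Set where
    by-flag : ∀ {p q ℓ b} → Flag p q ℓ b → FlagOrRest (p , q) (inj₁ (ℓ , b))
    by-rest : ∀ {p q} → (∀ {s} → s ∈ S → area p q s ≡ 0#) → FlagOrRest (p , q) (inj₂ p)

  e∈-ends : ∀ {p q e f} → Edge p q → Ends p q e f → e ∈ S × f ∈ S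
  e∈-ends edge forward = left∈ edge , right∈ edge
  e∈-ends edge backward = right∈ edge , left∈ edge

  -- If e lies between p and q, then r′, being left of ep, is right of eq, and `¬right-on-hit`
  -- forbids such a point on er.
  opposite-ends : ∀ {p e q r r′} → ξ p < ξ e → ξ e < ξ q → FirstHit e q r → FirstHit e p r′ → area e r r′ ≡ 0# → ¬ (area e p q ≡ 0#)
  opposite-ends {p} {e} {q} {r} {r′} p<e e<q h h′ err′≡0 epq≡0 = ¬right-on-hit h (FirstHit.r∈ h′) err′≡0
    (*-cancel-pos (<⇒0<- p<e) (subst (0# <_) identity (*-pos (FirstHit.r-left h′) (<⇒0<- e<q))))
    where
    identity : area e p r′ * (ξ q - ξ e) ≡ (ξ e - ξ p) * area e r′ q
    identity = begin
      area e p r′ * (ξ q - ξ e)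
        ≡⟨ solve 5 (λ a b q e p → a :* (q :- e) := (a :* (q :- e) :+ b :* (p :- e)) :+ (e :- p) :* b) refl
             (area e p r′) (area e r′ q) (ξ q) (ξ e) (ξ p) ⟩
      (area e p r′ * (ξ q - ξ e) + area e r′ q * (ξ p - ξ e)) + (ξ e - ξ p) * area e r′ q
        ≡⟨ cong (_+ (ξ e - ξ p) * area e r′ q) (trans (plücker-ξ e p r′ q) (cong (_* (ξ r′ - ξ e)) epq≡0)) ⟩
      0# * (ξ r′ - ξ e) + (ξ e - ξ p) * area e r′ q
        ≡⟨ solve 2 (λ a b → con 0ℤ :* a :+ b := b) refl (ξ r′ - ξ e) ((ξ e - ξ p) * area e r′ q) ⟩
      (ξ e - ξ p) * area e r′ q ∎
      where open ≡-Reasoning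

  same-flag : ∀ {p q p′ q′ e f f′ r r′} → Edge p q → Edge p′ q′ → Ends p q e f → Ends p′ q′ e f′ →
              FirstHit e f r → FirstHit e f′ r′ → area e r r′ ≡ 0# → area e f f′ ≡ 0# → (p , q) ≡ (p′ , q′)
  same-flag E E′ forward forward h h′ _ eff′≡0 = cong (_ ,_) (collinear⇒≡ʳ E E′ eff′≡0)
  same-flag E E′ backward backward h h′ _ eff′≡0 = cong (_, _) (collinear⇒≡ E E′ eff′≡0)
  same-flag E E′ forward backward h h′ err′≡0 eff′≡0 =
    ⊥-elim (opposite-ends (ξ< E′) (ξ< E) h h′ err′≡0 (area-null-flip eff′≡0))
  same-flag E E′ backward forward h h′ err′≡0 eff′≡0 =
    ⊥-elim (opposite-ends (ξ< E) (ξ< E′) h′ h (area-null-flip err′≡0) eff′≡0)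

  flag-injective : ∀ {p q p′ q′ ℓ b} → Edge p q → Edge p′ q′ → Flag p q ℓ b → Flag p′ q′ ℓ b → (p , q) ≡ (p′ , q′)
  flag-injective {b = b} E E′ (flag {e} {f} {r} ends h ℓ∈ on-e on-r extreme) (flag {e′} {f′} {r′} ends′ h′ _ on-e′ on-r′ extreme′)
    = same-vertex (extreme-unique b (proj₁ (e∈-ends E ends)) (proj₁ (e∈-ends E′ ends′)) on-e on-e′ extreme extreme′)
    where
    same-vertex : e ≡ e′ → _ ≡ _
    same-vertex refl = by-orientation (orientation e f f′)
      where
      err′≡0 : area e r r′ ≡ 0#
      err′≡0 = on⇒on-chord (<⇒ξ≢ (proj₂ (proj₂ (line-ends ℓ∈)))) on-e on-r on-r′
      by-orientation : Orientation e f f′ → _ ≡ _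
      by-orientation (left 0<a) = ⊥-elim (hit-conflict (proj₂ (e∈-ends E′ ends′)) h h′ err′≡0 0<a)
      by-orientation (right 0<a) = ⊥-elim (hit-conflict (proj₂ (e∈-ends E ends)) h′ h (area-null-flip err′≡0) 0<a)
      by-orientation (collinear a≡0) = same-flag E E′ ends ends′ h h′ err′≡0 a≡0

  flag-or-rest-injective : ∀ {e e′ c} → e ∈ edges → e′ ∈ edges → FlagOrRest e c → FlagOrRest e′ c → e ≡ e′
  flag-or-rest-injective e∈ e′∈ (by-flag F) (by-flag F′) = flag-injective (edges⇒Edge e∈) (edges⇒Edge e′∈) F F′
  flag-or-rest-injective {_ , _} {_ , _} e∈ e′∈ (by-rest h) (by-rest h′) =
    cong (_ ,_) (collinear⇒≡ʳ (edges⇒Edge e∈) (edges⇒Edge e′∈) (h (right∈ (edges⇒Edge e′∈))))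

  crowded? : ∀ ℓ → Dec (2 ℕ.≤ x ℓ S)
  crowded? ℓ = 2 ℕ.≤? x ℓ S

  two-on : ∀ {ℓ p q} → p ∈ S → q ∈ S → p ≢ q → On ℓ p → On ℓ q → 2 ℕ.≤ x ℓ S
  two-on {ℓ} {p} {q} p∈ q∈ p≢q p-on q-on = subst (2 ℕ.≤_) (length-filter-𝟙 (on? ℓ) S)
    (pigeonhole _≡_ (p ∷ q ∷ []) (filter (on? ℓ) S) ((p≢q ∷ []) ∷ [] ∷ [])
      (λ { (here refl) → p , ∈-filter⁺ (on? ℓ) p∈ p-on , refl
         ; (there (here refl)) → q , ∈-filter⁺ (on? ℓ) q∈ q-on , refl })
      (λ { _ _ refl refl → refl }))

  private
    flags : List (Segment × Bool)
    flags = cartesianProduct (filter crowded? ls) (true ∷ false ∷ [])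

    make-flag : ∀ {p q e f r} → Edge p q → Ends p q e f → FirstHit e f r →
                ∃ λ c → c ∈ flags × Flag p q (proj₁ c) (proj₂ c)
    make-flag {p} {q} {e} {f} {r} E ends h =
      let ℓ , ℓ∈ , on-e , on-r = joins (S⊆P e∈) (S⊆P r∈) e≢r
          ℓ∈′ = ∈-filter⁺ crowded? ℓ∈ (two-on {ℓ} e∈ r∈ e≢r on-e on-r)
          chord : ∀ {s} → On ℓ s → area e r s ≡ 0#
          chord = on⇒on-chord (<⇒ξ≢ (proj₂ (proj₂ (line-ends ℓ∈)))) on-e on-r
      in by-order ℓ∈ ℓ∈′ on-e on-r chord (compare (ξ e) (ξ r))
      where
      e∈ = proj₁ (e∈-ends E ends)
      r∈ = FirstHit.r∈ h
      e≢r : e ≢ r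
      e≢r refl = pos⇒≢0 (FirstHit.r-left h) (area-pqp e f)

      by-order : ∀ {ℓ} → ℓ ∈ ls → ℓ ∈ filter crowded? ls → On ℓ e → On ℓ r → (∀ {s} → On ℓ s → area e r s ≡ 0#) →
                 _ → ∃ λ c → c ∈ flags × Flag p q (proj₁ c) (proj₂ c)
      by-order {ℓ} ℓ∈ ℓ∈′ on-e on-r chord (tri< e<r _ _) = (ℓ , true) , ∈-cartesianProduct⁺ ℓ∈′ (here refl) ,
        flag ends h ℓ∈ on-e on-r (λ s∈ s-on → hit-first h e<r s∈ (chord s-on))
      by-order ℓ∈ ℓ∈′ on-e on-r chord (tri≈ _ e≡r _) = ⊥-elim (e≢r (ξ-injectiveˢ e∈ r∈ e≡r))
      by-order {ℓ} ℓ∈ ℓ∈′ on-e on-r chord (tri> _ _ r<e) = (ℓ , false) , ∈-cartesianProduct⁺ ℓ∈′ (there (here refl)) ,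
        flag ends h ℓ∈ on-e on-r (λ s∈ s-on → hit-last h r<e s∈ (chord s-on))

  module _ (rest : List Point) (degenerate : ∀ {p q} → Edge p q → (∀ {s} → s ∈ S → area p q s ≡ 0#) → p ∈ rest) where
    private
      targets : List (Segment × Bool ⊎ Point)
      targets = map inj₁ flags ++ map inj₂ rest

      target : ∀ {e} → e ∈ edges → ∃ λ c → c ∈ targets × FlagOrRest e c
      target {p , q} e∈ = by-cases (any? (λ s → ¬? (_≟ℝ_ R (area p q s) 0#)) S)
        where
        E = edges⇒Edge e∈
        from-hit : (∃ λ r → FirstHit p q r ⊎ FirstHit q p r) → ∃ λ c → c ∈ flags × Flag p q (proj₁ c) (proj₂ c)
        from-hit (_ , inj₁ h) = make-flag E forward h
        from-hit (_ , inj₂ h) = make-flag E backward h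

        by-cases : _ → ∃ λ c → c ∈ targets × FlagOrRest (p , q) c
        by-cases (yes off) = let c , c∈ , fl = from-hit (first-hit E (find off))
                             in inj₁ c , ∈-++⁺ˡ (∈-map⁺ inj₁ c∈) , by-flag fl
        by-cases (no ¬off) = inj₂ p , ∈-++⁺ʳ (map inj₁ flags) (∈-map⁺ inj₂ (degenerate E all-on)) , by-rest all-on
          where
          all-on : ∀ {s} → s ∈ S → area p q s ≡ 0#
          all-on {s} s∈ = [ id , (λ off → ⊥-elim (¬off (lose s∈ off))) ]′ (toSum (_≟ℝ_ R (area p q s) 0#))

      length-targets : length targets ≡ 2 ℕ.* ∑ ls (λ ℓ → 𝟙 (crowded? ℓ)) ℕ.+ length rest
      length-targets = trans (length-++ (map inj₁ flags)) (cong₂ ℕ._+_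
        (trans (length-map inj₁ flags) (trans (length-cartesianProduct (filter crowded? ls) (true ∷ false ∷ []))
          (trans (ℕ.*-comm (length (filter crowded? ls)) 2) (cong (2 ℕ.*_) (length-filter-𝟙 crowded? ls)))))
        (length-map inj₂ rest))

    -- `rest` absorbs the edges of an S that lies on one line. It is empty for a set known not to be
    -- collinear, and S itself for a random subset, at the price of an error linear in the number of
    -- points.
    melchior-up-to : ∑ ls (λ ℓ → x ℓ S ∸ 1) ℕ.≤ 2 ℕ.* ∑ ls (λ ℓ → 𝟙 (crowded? ℓ)) ℕ.+ length rest
    melchior-up-to = begin
      ∑ ls (λ ℓ → x ℓ S ∸ 1)               ≤⟨ ∑-mono ls (λ ℓ∈ → ℕ.∸-monoˡ-≤ 1 (x≤edges-on ℓ∈)) ⟩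
      ∑ ls (λ ℓ → length (edges-on ℓ))     ≤⟨ ∑-edges-on ls-unique id ⟩
      length (filter (spanned? ls) edges)  ≤⟨ length-filter (spanned? ls) edges ⟩
      length edges                         ≤⟨ pigeonhole FlagOrRest edges targets edges-unique target flag-or-rest-injective ⟩
      length targets                       ≡⟨ length-targets ⟩
      _                                    ∎
      where open ℕ.≤-Reasoning

  melchior-weak : ∑ ls (λ ℓ → x ℓ S ∸ 1) ℕ.≤ 2 ℕ.* ∑ ls (λ ℓ → 𝟙 (crowded? ℓ)) ℕ.+ length S
  melchior-weak = melchior-up-to S (λ E _ → left∈ E)

  melchior : (∀ {p q} → p ∈ S → q ∈ S → p ≢ q → ∃ λ s → s ∈ S × area p q s ≢ 0#) →
             ∑ ls (λ ℓ → x ℓ S ∸ 1) ℕ.≤ 2 ℕ.* ∑ ls (λ ℓ → 𝟙 (crowded? ℓ))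
  melchior off-line = subst (∑ ls (λ ℓ → x ℓ S ∸ 1) ℕ.≤_) (ℕ.+-identityʳ _)
    (melchior-up-to [] (λ E on → let s , s∈ , off = off-line (left∈ E) (right∈ E) (λ { refl → <-irrefl (ξ< E) })
                                 in ⊥-elim (off (on s∈))))

-- The graph of consecutive points on chosen lines, and its crossings.

module Graph (R : RealField) (t : RealField.Carrier R) (P : List (Plane.Point R)) (P-unique : Unique P)
  (ξ-injective : Geometry.Generic R t P)
  (ls′ : List (Geometry.Segment R t)) (ls′-unique : Unique ls′)
  (ls′⊆ls : ∀ {ℓ} → ℓ ∈ ls′ → ℓ ∈ Configuration.ls R t P P-unique ξ-injective)
  where
  open OrderedField R
  open Geometry R t
  open Plane R using (Point)
  open Lines R t
  open Configuration R t P P-unique ξ-injective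
  open Solver using (solve; _:=_; _:+_; _:*_; _:-_; :-_; con)
  open Sample R t P P-unique ξ-injective P id P-unique
  open Edge

  graph : List Segment
  graph = filter (spanned? ls′) edges

  graph-unique : Unique graph
  graph-unique = Unique.filter⁺ (spanned? ls′) edges-unique

  graph⇒Edge : ∀ {u v} → (u , v) ∈ graph → Edge u v
  graph⇒Edge e∈ = edges⇒Edge (proj₁ (∈-filter⁻ (spanned? ls′) {xs = edges} e∈))

  graph-line : ∀ {e} → e ∈ graph → ∃ λ ℓ → ℓ ∈ ls′ × Same ℓ e
  graph-line e∈ = find (proj₂ (∈-filter⁻ (spanned? ls′) {xs = edges} e∈))

  crosses? : ∀ a f → Dec (Crosses a f)
  crosses? (w , v) (u , y) = (0# <? area w v u) ×-dec ((0# <? area w y v) ×-dec ((0# <? area u w y) ×-dec (0# <? area u y v)))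

  Straddles : Segment → Point → Point → Set
  Straddles (w , v) u y = 0# < area u w y × 0# < area u y v

  -- Only the line through u and y matters. This half of a crossing survives replacing f by another
  -- edge of its line, so the two edges of a crossing can be recovered one at a time from their
  -- lines.
  Separates : Segment → Segment → Set
  Separates (u , y) a = Straddles a u y ⊎ Straddles a y u

  crosses-separates : ∀ {a f} → Crosses a f ⊎ Crosses f a → Separates f a × Separates a f
  crosses-separates (inj₁ (wvu , wyv , uwy , uyv)) =
    inj₁ (uwy , uyv) , inj₂ (area-rotate⁺ wvu , area-rotate⁺ (area-rotate⁺ wyv))
  crosses-separates (inj₂ (uyw , uvy , wuv , wvy)) =
    inj₂ (area-rotate⁺ uyw , area-rotate⁺ (area-rotate⁺ uvy)) , inj₁ (wuv , wvy)

  -- The area over uy is affine along the line wv and increases from w to v, so it stays positive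
  -- beyond v.
  straddle-beyond : ∀ {u y w v s} → ξ w < ξ v → ξ v ≤ ξ s → area w v s ≡ 0# → Straddles (w , v) u y → 0# < area u y s
  straddle-beyond {u} {y} {w} {v} {s} w<v v≤s wvs≡0 (uwy , uyv) = *-cancel-pos (<⇒0<- w<v) (subst (0# <_) identity
    (pos+nonneg (*-pos (<⇒0<- (<-≤-trans w<v v≤s)) uyv) (nonneg*nonneg (≤⇒0≤- v≤s) (inj₁ uwy))))
    where
    open ≡-Reasoning
    identity : (ξ s - ξ w) * area u y v + (ξ s - ξ v) * area u w y ≡ (ξ v - ξ w) * area u y s
    identity = begin
      (ξ s - ξ w) * area u y v + (ξ s - ξ v) * area u w y
        ≡⟨ cong₂ (λ a b → a + (ξ s - ξ v) * b) (interpolate u y w v s) (sym (area-flip u y w)) ⟩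
      ((ξ s - ξ v) * area u y w + (ξ v - ξ w) * area u y s - (ξ y - ξ u) * area w v s) + (ξ s - ξ v) * - area u y w
        ≡⟨ cong (λ a → ((ξ s - ξ v) * area u y w + (ξ v - ξ w) * area u y s - (ξ y - ξ u) * a) + (ξ s - ξ v) * - area u y w) wvs≡0 ⟩
      ((ξ s - ξ v) * area u y w + (ξ v - ξ w) * area u y s - (ξ y - ξ u) * 0#) + (ξ s - ξ v) * - area u y w
        ≡⟨ solve 4 (λ a b c d → (a :* b :+ c :- d :* con 0ℤ) :+ a :* (:- b) := c) refl
             (ξ s - ξ v) (area u y w) ((ξ v - ξ w) * area u y s) (ξ y - ξ u) ⟩
      (ξ v - ξ w) * area u y s ∎

  straddle-once : ∀ {u y w v w′ v′} → ξ w < ξ v → ξ v ≤ ξ w′ → ξ w′ < ξ v′ → area w v w′ ≡ 0# → area w v v′ ≡ 0# →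
                  Straddles (w , v) u y → ¬ Separates (u , y) (w′ , v′)
  straddle-once w<v v≤w′ w′<v′ on on′ st (inj₁ (uw′y , _)) =
    area-pos⇒flip-neg (straddle-beyond w<v v≤w′ on st) (inj₁ uw′y)
  straddle-once w<v v≤w′ w′<v′ on on′ st (inj₂ (_ , yuv′)) =
    area-pos⇒flip-neg (straddle-beyond w<v (≤-trans v≤w′ (inj₁ w′<v′)) on′ st) (inj₁ (area-rotate⁺ yuv′))

  separate-once : ∀ {f w v w′ v′} → ξ w < ξ v → ξ v ≤ ξ w′ → ξ w′ < ξ v′ → area w v w′ ≡ 0# → area w v v′ ≡ 0# →
                  Separates f (w , v) → ¬ Separates f (w′ , v′)
  separate-once w<v v≤w′ w′<v′ on on′ (inj₁ st) sep = straddle-once w<v v≤w′ w′<v′ on on′ st sep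
  separate-once w<v v≤w′ w′<v′ on on′ (inj₂ st) (inj₁ st′) = straddle-once w<v v≤w′ w′<v′ on on′ st (inj₂ st′)
  separate-once w<v v≤w′ w′<v′ on on′ (inj₂ st) (inj₂ st′) = straddle-once w<v v≤w′ w′<v′ on on′ st (inj₁ st′)

  same-side : ∀ {u y u′ y′ r} → ξ u < ξ y → ξ u′ < ξ y′ → On (u , y) u′ → On (u , y) y′ → 0# < area u′ y′ r → 0# < area u y r
  same-side {u} {y} {u′} {y′} {r} u<y u′<y′ on on′ 0<area = *-cancel-pos (<⇒0<- u′<y′)
    (subst (0# <_) (trans (rescale r on on′) (*-comm _ _)) (*-pos 0<area (<⇒0<- u<y)))

  same-sideʳ : ∀ {u y u′ y′ r} → ξ u < ξ y → ξ u′ < ξ y′ → On (u , y) u′ → On (u , y) y′ → 0# < area u′ r y′ → 0# < area u r y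
  same-sideʳ {u} {y} {u′} {y′} {r} u<y u′<y′ on on′ 0<area = *-cancel-pos (<⇒0<- u′<y′)
    (subst (0# <_) identity (*-pos 0<area (<⇒0<- u<y)))
    where
    identity : area u′ r y′ * (ξ y - ξ u) ≡ (ξ y′ - ξ u′) * area u r y
    identity = trans (cong (_* (ξ y - ξ u)) (sym (area-flip u′ y′ r)))
      (trans (solve 2 (λ a b → (:- a) :* b := :- (a :* b)) refl (area u′ y′ r) (ξ y - ξ u))
      (trans (cong -_ (rescale r on on′))
      (trans (solve 2 (λ a b → :- (a :* b) := b :* (:- a)) refl (area u y r) (ξ y′ - ξ u′))
             (cong ((ξ y′ - ξ u′) *_) (area-flip u y r)))))

  separates-transport : ∀ {f f′ a} → Rising f → Rising f′ → Same f f′ → Separates f′ a → Separates f a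
  separates-transport u<y u′<y′ (on , on′) (inj₁ (p , q)) =
    inj₁ (same-sideʳ u<y u′<y′ on on′ p , same-side u<y u′<y′ on on′ q)
  separates-transport u<y u′<y′ (on , on′) (inj₂ (p , q)) =
    inj₂ ( area-rotate⁺ (same-side u<y u′<y′ on on′ (area-rotate⁺ (area-rotate⁺ p)))
         , area-rotate⁺ (area-rotate⁺ (same-sideʳ u<y u′<y′ on on′ (area-rotate⁺ q))))

  separated-unique : ∀ {ℓ m a a′ f f′} → ℓ ∈ ls → m ∈ ls → a ∈ graph → a′ ∈ graph → f ∈ graph → f′ ∈ graph →
    Same ℓ a → Same ℓ a′ → Same m f → Same m f′ → Separates f a → Separates f′ a′ → a ≡ a′
  separated-unique {ℓ} {m} {w , v} {w′ , v′} {u , y} {u′ , y′} ℓ∈ m∈ a∈ a′∈ f∈ f′∈ (ℓw , ℓv) (ℓw′ , ℓv′) (mu , my) (mu′ , my′) sep sep′ =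
    by-order (compare (ξ w) (ξ w′))
    where
    A = graph⇒Edge a∈
    A′ = graph⇒Edge a′∈
    ℓ-rising = <⇒ξ≢ (proj₂ (proj₂ (line-ends ℓ∈)))
    m-rising = <⇒ξ≢ (proj₂ (proj₂ (line-ends m∈)))
    sep″ : Separates (u , y) (w′ , v′)
    sep″ = separates-transport (ξ< (graph⇒Edge f∈)) (ξ< (graph⇒Edge f′∈))
      (on⇒on-chord m-rising mu my mu′ , on⇒on-chord m-rising mu my my′) sep′

    disjoint : ∀ {w v w′ v′} → Edge w v → Edge w′ v′ → On ℓ w → On ℓ v → On ℓ w′ → On ℓ v′ →
               Separates (u , y) (w , v) → Separates (u , y) (w′ , v′) → ¬ (ξ w < ξ w′)
    disjoint {w} {v} {w′} {v′} A A′ ℓw ℓv ℓw′ ℓv′ sep sep′ w<w′ = either (<-or-≤ (ξ w′) (ξ v))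
      where
      either : ξ w′ < ξ v ⊎ ξ v ≤ ξ w′ → ⊥
      either (inj₁ w′<v) = empty A (left∈ A′) (on⇒on-chord ℓ-rising ℓw ℓv ℓw′) w<w′ w′<v
      either (inj₂ v≤w′) = separate-once (ξ< A) v≤w′ (ξ< A′) (on⇒on-chord ℓ-rising ℓw ℓv ℓw′)
        (on⇒on-chord ℓ-rising ℓw ℓv ℓv′) sep sep′

    by-order : _ → (w , v) ≡ (w′ , v′)
    by-order (tri< w<w′ _ _) = ⊥-elim (disjoint A A′ ℓw ℓv ℓw′ ℓv′ sep sep″ w<w′)
    by-order (tri> _ _ w′<w) = ⊥-elim (disjoint A′ A ℓw′ ℓv′ ℓw ℓv sep″ sep w′<w)
    by-order (tri≈ _ ξw≡ξw′ _) = same-left (ξ-injective (left∈ A) (left∈ A′) ξw≡ξw′)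
      where
      same-left : w ≡ w′ → (w , v) ≡ (w′ , v′)
      same-left refl = cong (w ,_) (collinear⇒≡ʳ A A′ (on⇒on-chord ℓ-rising ℓw ℓv ℓv′))

  CrossPair : Segment × Segment → Set
  CrossPair (a , f) = Crosses a f ⊎ Crosses f a

  cross-pair? : ∀ c → Dec (CrossPair c)
  cross-pair? (a , f) = crosses? a f ⊎-dec crosses? f a

  data LinePair : Segment × Segment → Segment × Segment → Set where
    line-pair : ∀ {a f ℓ m} → ℓ ∈ ls′ → m ∈ ls′ → Same ℓ a → Same m f → LinePair (a , f) (ℓ , m)

  crossings : ℕ
  crossings = ∑ graph (λ a → ∑ graph (λ f → 𝟙 (crosses? a f)))

  cross-pairs : List (Segment × Segment)
  cross-pairs = filter cross-pair? (cartesianProduct graph graph)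

  cross-pairs≤ : length cross-pairs ℕ.≤ length ls′ ℕ.* length ls′
  cross-pairs≤ = subst (length cross-pairs ℕ.≤_) (length-cartesianProduct ls′ ls′)
    (pigeonhole LinePair cross-pairs (cartesianProduct ls′ ls′)
      (Unique.filter⁺ cross-pair? (Unique.cartesianProduct⁺ graph-unique graph-unique)) lines-of injective)
    where
    lines-of : ∀ {c} → c ∈ cross-pairs → ∃ λ lm → lm ∈ cartesianProduct ls′ ls′ × LinePair c lm
    lines-of c∈ =
      let a∈ , f∈ = ∈-cartesianProduct⁻ graph graph (proj₁ (∈-filter⁻ cross-pair? {xs = cartesianProduct graph graph} c∈))
          ℓ , ℓ∈ , ℓa = graph-line a∈
          m , m∈ , mf = graph-line f∈
      in (ℓ , m) , ∈-cartesianProduct⁺ ℓ∈ m∈ , line-pair ℓ∈ m∈ ℓa mf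

    injective : ∀ {c c′ lm} → c ∈ cross-pairs → c′ ∈ cross-pairs → LinePair c lm → LinePair c′ lm → c ≡ c′
    injective c∈ c′∈ (line-pair ℓ∈ m∈ ℓa mf) (line-pair _ _ ℓa′ mf′) =
      let af∈ , cr = ∈-filter⁻ cross-pair? {xs = cartesianProduct graph graph} c∈
          a′f′∈ , cr′ = ∈-filter⁻ cross-pair? {xs = cartesianProduct graph graph} c′∈
          a∈ , f∈ = ∈-cartesianProduct⁻ graph graph af∈
          a′∈ , f′∈ = ∈-cartesianProduct⁻ graph graph a′f′∈
          fa , af = crosses-separates cr
          f′a′ , a′f′ = crosses-separates cr′
      in cong₂ _,_ (separated-unique (ls′⊆ls ℓ∈) (ls′⊆ls m∈) a∈ a′∈ f∈ f′∈ ℓa ℓa′ mf mf′ fa f′a′)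
                   (separated-unique (ls′⊆ls m∈) (ls′⊆ls ℓ∈) f∈ f′∈ a∈ a′∈ mf mf′ ℓa ℓa′ af a′f′)

  not-both : ∀ {a f} → Crosses a f → ¬ Crosses f a
  not-both (wvu , _) (_ , _ , wuv , _) = area-pos⇒flip-neg wvu (inj₁ wuv)

  𝟙-⊎ : ∀ {A B : Set} (a : Dec A) (b : Dec B) → (A → ¬ B) → 𝟙 a ℕ.+ 𝟙 b ℕ.≤ 𝟙 (a ⊎-dec b)
  𝟙-⊎ (yes a) (yes b) ¬both = ⊥-elim (¬both a b)
  𝟙-⊎ (yes a) (no _) _ = ℕ.≤-refl
  𝟙-⊎ (no _) (yes b) _ = ℕ.≤-refl
  𝟙-⊎ (no _) (no _) _ = z≤n

  -- Of two crossing segments only one descends through the other, so a crossing is a single term of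
  -- `crossings` but gives two ordered pairs in `cross-pairs`. The factor 2 is the gain from
  -- counting pairs of lines without order.
  2*crossings≤ : crossings ℕ.+ crossings ℕ.≤ length ls′ ℕ.* length ls′
  2*crossings≤ = ℕ.≤-trans (begin
    crossings ℕ.+ crossings
      ≡⟨ cong (crossings ℕ.+_) (∑-swap graph graph (λ a f → 𝟙 (crosses? a f))) ⟩
    crossings ℕ.+ ∑ graph (λ a → ∑ graph (λ f → 𝟙 (crosses? f a)))
      ≡⟨ ∑-+ graph (λ a → ∑ graph (λ f → 𝟙 (crosses? a f))) (λ a → ∑ graph (λ f → 𝟙 (crosses? f a))) ⟨
    ∑ graph (λ a → ∑ graph (λ f → 𝟙 (crosses? a f)) ℕ.+ ∑ graph (λ f → 𝟙 (crosses? f a)))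
      ≡⟨ ∑-cong graph (λ {a} _ → ∑-+ graph (λ f → 𝟙 (crosses? a f)) (λ f → 𝟙 (crosses? f a))) ⟨
    ∑ graph (λ a → ∑ graph (λ f → 𝟙 (crosses? a f) ℕ.+ 𝟙 (crosses? f a)))
      ≤⟨ ∑-mono graph (λ {a} _ → ∑-mono graph (λ {f} _ → 𝟙-⊎ (crosses? a f) (crosses? f a) not-both)) ⟩
    ∑ graph (λ a → ∑ graph (λ f → 𝟙 (cross-pair? (a , f))))
      ≡⟨ ∑-cartesianProduct graph graph (λ c → 𝟙 (cross-pair? c)) ⟨
    ∑ (cartesianProduct graph graph) (λ c → 𝟙 (cross-pair? c))
      ≡⟨ length-filter-𝟙 cross-pair? (cartesianProduct graph graph) ⟨
    length cross-pairs ∎) cross-pairs≤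
    where open ℕ.≤-Reasoning

  thin : List Segment → List Segment
  thin [] = []
  thin (e ∷ es) with any? (λ f → cross-pair? (e , f)) es
  ... | yes _ = thin es
  ... | no _ = e ∷ thin es

  thin-⊆ : ∀ es {e} → e ∈ thin es → e ∈ es
  thin-⊆ (e ∷ es) e∈ with any? (λ f → cross-pair? (e , f)) es
  ... | yes _ = there (thin-⊆ es e∈)
  thin-⊆ (e ∷ es) (here refl) | no _ = here refl
  thin-⊆ (e ∷ es) (there e∈) | no _ = there (thin-⊆ es e∈)

  thin-unique : ∀ {es} → Unique es → Unique (thin es)
  thin-unique [] = []
  thin-unique {e ∷ es} (e∉ ∷ unique) with any? (λ f → cross-pair? (e , f)) es
  ... | yes _ = thin-unique unique
  ... | no _ = All.tabulate (λ f∈ → All.lookup e∉ (thin-⊆ es f∈)) ∷ thin-unique unique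

  thin-noncrossing : ∀ es {a f} → a ∈ thin es → f ∈ thin es → ¬ Crosses a f
  thin-noncrossing (e ∷ es) a∈ f∈ with any? (λ f → cross-pair? (e , f)) es
  ... | yes _ = thin-noncrossing es a∈ f∈
  thin-noncrossing (e ∷ es) (here refl) (here refl) | no _ = λ cr → not-both cr cr
  thin-noncrossing (e ∷ es) (here refl) (there f∈) | no ¬cross = λ cr → ¬cross (lose (thin-⊆ es f∈) (inj₁ cr))
  thin-noncrossing (e ∷ es) (there a∈) (here refl) | no ¬cross = λ cr → ¬cross (lose (thin-⊆ es a∈) (inj₂ cr))
  thin-noncrossing (e ∷ es) (there a∈) (there f∈) | no _ = thin-noncrossing es a∈ f∈

  crossings-in : List Segment → ℕ
  crossings-in es = ∑ es (λ a → ∑ es (λ f → 𝟙 (crosses? a f)))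

  crossings-in-∷ : ∀ e es → ∑ es (λ f → 𝟙 (crosses? e f)) ℕ.+ ∑ es (λ a → 𝟙 (crosses? a e)) ℕ.+ crossings-in es
                            ℕ.≤ crossings-in (e ∷ es)
  crossings-in-∷ e es = begin
    ∑ es (λ f → 𝟙 (crosses? e f)) ℕ.+ ∑ es (λ a → 𝟙 (crosses? a e)) ℕ.+ crossings-in es
      ≡⟨ ℕ.+-assoc (∑ es (λ f → 𝟙 (crosses? e f))) _ _ ⟩
    ∑ es (λ f → 𝟙 (crosses? e f)) ℕ.+ (∑ es (λ a → 𝟙 (crosses? a e)) ℕ.+ crossings-in es)
      ≡⟨ cong (∑ es (λ f → 𝟙 (crosses? e f)) ℕ.+_) (∑-+ es (λ a → 𝟙 (crosses? a e)) (λ a → ∑ es (λ f → 𝟙 (crosses? a f)))) ⟨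
    ∑ es (λ f → 𝟙 (crosses? e f)) ℕ.+ ∑ es (λ a → 𝟙 (crosses? a e) ℕ.+ ∑ es (λ f → 𝟙 (crosses? a f)))
      ≤⟨ ℕ.+-monoˡ-≤ _ (ℕ.m≤n+m _ (𝟙 (crosses? e e))) ⟩
    crossings-in (e ∷ es) ∎
    where open ℕ.≤-Reasoning

  -- A deleted edge crosses one that comes later in the list, so different deletions are paid by
  -- different crossings.
  length≤thin+crossings : ∀ es → length es ℕ.≤ length (thin es) ℕ.+ crossings-in es
  length≤thin+crossings [] = z≤n
  length≤thin+crossings (e ∷ es) with any? (λ f → cross-pair? (e , f)) es
  ... | no _ = s≤s (ℕ.≤-trans (length≤thin+crossings es) (ℕ.+-monoʳ-≤ (length (thin es))
                 (ℕ.≤-trans (ℕ.m≤n+m _ _) (crossings-in-∷ e es))))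
  ... | yes crossed = begin
    suc (length es)                                  ≤⟨ s≤s (length≤thin+crossings es) ⟩
    suc (length (thin es) ℕ.+ crossings-in es)       ≡⟨ ℕ.+-suc (length (thin es)) (crossings-in es) ⟨
    length (thin es) ℕ.+ suc (crossings-in es)       ≤⟨ ℕ.+-monoʳ-≤ (length (thin es)) (ℕ.≤-trans
      (ℕ.+-monoˡ-≤ (crossings-in es) (one (find crossed))) (crossings-in-∷ e es)) ⟩
    length (thin es) ℕ.+ crossings-in (e ∷ es)       ∎
    where
    open ℕ.≤-Reasoning
    one : (∃ λ f → f ∈ es × CrossPair (e , f)) →
          1 ℕ.≤ ∑ es (λ f → 𝟙 (crosses? e f)) ℕ.+ ∑ es (λ a → 𝟙 (crosses? a e))
    one (f , f∈ , inj₁ cr) = ℕ.≤-trans (ℕ.≤-trans (ℕ.≤-reflexive (sym (𝟙-yes (crosses? e f) cr)))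
      (term≤∑ (λ f → 𝟙 (crosses? e f)) f∈)) (ℕ.m≤m+n _ _)
    one (f , f∈ , inj₂ cr) = ℕ.≤-trans (ℕ.≤-trans (ℕ.≤-reflexive (sym (𝟙-yes (crosses? f e) cr)))
      (term≤∑ (λ a → 𝟙 (crosses? a e)) f∈)) (ℕ.m≤n+m _ _)

  open import Data.List.Membership.DecPropositional _≟ₚ_ using (_∈?_) public

  -- The events that both ends or all four corners are sampled are expressed through this count,
  -- because `𝔼-count` evaluates functions of a count.
  hits : List Point → List Point → ℕ
  hits V S = ∑ S (λ s → 𝟙 (s ∈? V))

  hits-length : ∀ V S → hits V S ≡ length (filter (_∈? V) S)
  hits-length V S = sym (length-filter-𝟙 (_∈? V) S)

  hits-≤ : ∀ {V S} → Unique S → hits V S ℕ.≤ length V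
  hits-≤ {V} {S} unique = subst (ℕ._≤ length V) (sym (hits-length V S))
    (pigeonhole _≡_ (filter (_∈? V) S) V (Unique.filter⁺ (_∈? V) unique)
      (λ s∈ → _ , proj₂ (∈-filter⁻ (_∈? V) {xs = S} s∈) , refl) (λ { _ _ refl refl → refl }))

  hits-≥ : ∀ {V S} → Unique V → (∀ {v} → v ∈ V → v ∈ S) → length V ℕ.≤ hits V S
  hits-≥ {V} {S} unique V⊆S = subst (length V ℕ.≤_) (sym (hits-length V S))
    (pigeonhole _≡_ V (filter (_∈? V) S) unique
      (λ v∈ → _ , ∈-filter⁺ (_∈? V) (V⊆S v∈) v∈ , refl) (λ { _ _ refl refl → refl }))

  hits-missing : ∀ {V S v} → Unique S → v ∈ V → ¬ (v ∈ S) → suc (hits V S) ℕ.≤ length V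
  hits-missing {V} {S} {v} unique v∈ v∉S = subst (λ h → suc h ℕ.≤ length V) (sym (hits-length V S))
    (pigeonhole _≡_ (v ∷ filter (_∈? V) S) V
      (All.tabulate (λ { s∈ refl → v∉S (proj₁ (∈-filter⁻ (_∈? V) {xs = S} s∈)) }) ∷ Unique.filter⁺ (_∈? V) unique)
      (λ { (here refl) → v , v∈ , refl
         ; (there s∈) → _ , proj₂ (∈-filter⁻ (_∈? V) {xs = S} s∈) , refl }) (λ { _ _ refl refl → refl }))

  ends : Segment → List Point
  ends (u , v) = u ∷ v ∷ []

  edge-≢ : ∀ {u v} → (u , v) ∈ graph → u ≢ v
  edge-≢ e∈ refl = <-irrefl (ξ< (graph⇒Edge e∈))

  corners : Segment → Segment → List Point
  corners a f = ends a ++ ends f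

  hits-ends : ∀ {e} → e ∈ graph → hits (ends e) P ≡ 2
  hits-ends {u , v} e∈ = ℕ.≤-antisym (hits-≤ P-unique) (hits-≥ ((edge-≢ e∈ ∷ []) ∷ [] ∷ [])
    (λ { (here refl) → left∈ (graph⇒Edge e∈) ; (there (here refl)) → right∈ (graph⇒Edge e∈) }))

  corners-unique : ∀ {a f} → a ∈ graph → f ∈ graph → Crosses a f → Unique (corners a f)
  corners-unique {w , v} {u , y} a∈ f∈ (wvu , wyv , uwy , uyv) =
    (edge-≢ a∈ ∷ (λ { refl → pos⇒≢0 wvu (area-pqp w v) }) ∷ (λ { refl → pos⇒≢0 wyv (area-ppq w v) }) ∷ []) ∷
    ((λ { refl → pos⇒≢0 wvu (area-pqq w v) }) ∷ (λ { refl → pos⇒≢0 wyv (area-pqq w v) }) ∷ []) ∷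
    (edge-≢ f∈ ∷ []) ∷ [] ∷ []

  hits-corners : ∀ {a f} → a ∈ graph → f ∈ graph → Crosses a f → hits (corners a f) P ≡ 4
  hits-corners {w , v} {u , y} a∈ f∈ cr = ℕ.≤-antisym (hits-≤ P-unique) (hits-≥ (corners-unique a∈ f∈ cr)
    (λ { (here refl) → left∈ (graph⇒Edge a∈) ; (there (here refl)) → right∈ (graph⇒Edge a∈)
       ; (there (there (here refl))) → left∈ (graph⇒Edge f∈) ; (there (there (there (here refl)))) → right∈ (graph⇒Edge f∈) }))

  module _ {S : List Point} (S⊆P : ∀ {p} → p ∈ S → p ∈ P) (S-unique : Unique S) where
    private
      inside? : ∀ e → Dec (proj₁ e ∈ S × proj₂ e ∈ S)
      inside? (u , v) = (u ∈? S) ×-dec (v ∈? S)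

      induced : List Segment
      induced = filter inside? graph

      module Sub = Planar R t S (λ p∈ q∈ → ξ-injective (S⊆P p∈) (S⊆P q∈))

      induced-edge : ∀ {u v} → (u , v) ∈ induced → Sub.Edge u v
      induced-edge e∈ = let e∈g , u∈ , v∈ = ∈-filter⁻ inside? {xs = graph} e∈
                            E = graph⇒Edge e∈g
                        in record { left∈ = u∈ ; right∈ = v∈ ; ξ< = ξ< E ; empty = λ r∈ → empty E (S⊆P r∈) }

      induced-bound : length induced ℕ.≤ 3 ℕ.* length S ℕ.+ crossings-in induced
      induced-bound = ℕ.≤-trans (length≤thin+crossings induced) (ℕ.+-monoˡ-≤ (crossings-in induced)
        (Sub.planar-bound (thin induced) (thin-unique (Unique.filter⁺ inside? graph-unique))
          (λ e∈ → induced-edge (thin-⊆ induced e∈)) (thin-noncrossing induced)))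

      both-ends : ∀ {e} → e ∈ graph → hits (ends e) S ∸ 1 ℕ.≤ 𝟙 (inside? e)
      both-ends {u , v} e∈ = by-cases (inside? (u , v))
        where
        by-cases : (d : Dec (u ∈ S × v ∈ S)) → hits (ends (u , v)) S ∸ 1 ℕ.≤ 𝟙 d
        by-cases (yes _) = ℕ.∸-monoˡ-≤ 1 (hits-≤ {u ∷ v ∷ []} S-unique)
        by-cases (no outside) with u ∈? S | v ∈? S
        ... | yes u∈ | yes v∈ = ⊥-elim (outside (u∈ , v∈))
        ... | no u∉ | _ = ℕ.∸-monoˡ-≤ 1 (ℕ.≤-pred (hits-missing {u ∷ v ∷ []} S-unique (here refl) u∉))
        ... | yes _ | no v∉ = ℕ.∸-monoˡ-≤ 1 (ℕ.≤-pred (hits-missing {u ∷ v ∷ []} S-unique (there (here refl)) v∉))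

      all-corners : ∀ {a f} → a ∈ graph → f ∈ graph →
        𝟙 (inside? a) ℕ.* (𝟙 (inside? f) ℕ.* 𝟙 (crosses? a f)) ℕ.≤ 𝟙 (crosses? a f) ℕ.* (hits (corners a f) S ∸ 3)
      all-corners {a@(w , v)} {f@(u , y)} a∈ f∈ = by-cases (inside? a) (inside? f) (crosses? a f)
        where
        by-cases : (d : Dec (w ∈ S × v ∈ S)) (d′ : Dec (u ∈ S × y ∈ S)) (c : Dec (Crosses a f)) →
                   𝟙 d ℕ.* (𝟙 d′ ℕ.* 𝟙 c) ℕ.≤ 𝟙 c ℕ.* (hits (corners a f) S ∸ 3)
        by-cases (no _) _ _ = z≤n
        by-cases (yes _) (no _) _ = z≤n
        by-cases (yes _) (yes _) (no _) = z≤n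
        by-cases (yes (w∈ , v∈)) (yes (u∈ , y∈)) (yes cr) = ℕ.≤-trans (ℕ.∸-monoˡ-≤ 3 (hits-≥ (corners-unique a∈ f∈ cr)
          (λ { (here refl) → w∈ ; (there (here refl)) → v∈ ; (there (there (here refl))) → u∈
             ; (there (there (there (here refl)))) → y∈ }))) (ℕ.≤-reflexive (sym (ℕ.*-identityˡ _)))

    sampled-crossing : ∑ graph (λ e → hits (ends e) S ∸ 1) ℕ.≤
      3 ℕ.* length S ℕ.+ ∑ graph (λ a → ∑ graph (λ f → 𝟙 (crosses? a f) ℕ.* (hits (corners a f) S ∸ 3)))
    sampled-crossing = begin
      ∑ graph (λ e → hits (ends e) S ∸ 1)
        ≤⟨ ∑-mono graph both-ends ⟩
      ∑ graph (λ e → 𝟙 (inside? e))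
        ≡⟨ length-filter-𝟙 inside? graph ⟨
      length induced
        ≤⟨ induced-bound ⟩
      3 ℕ.* length S ℕ.+ crossings-in induced
        ≡⟨ cong (3 ℕ.* length S ℕ.+_) (trans (∑-cong induced (λ {a} _ → ∑-filter inside? graph (λ f → 𝟙 (crosses? a f))))
             (∑-filter inside? graph (λ a → ∑ graph (λ f → 𝟙 (inside? f) ℕ.* 𝟙 (crosses? a f))))) ⟩
      3 ℕ.* length S ℕ.+ ∑ graph (λ a → 𝟙 (inside? a) ℕ.* ∑ graph (λ f → 𝟙 (inside? f) ℕ.* 𝟙 (crosses? a f)))
        ≡⟨ cong (3 ℕ.* length S ℕ.+_) (∑-cong graph (λ {a} _ → ∑-*ˡ graph (𝟙 (inside? a)) (λ f → 𝟙 (inside? f) ℕ.* 𝟙 (crosses? a f)))) ⟨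
      3 ℕ.* length S ℕ.+ ∑ graph (λ a → ∑ graph (λ f → 𝟙 (inside? a) ℕ.* (𝟙 (inside? f) ℕ.* 𝟙 (crosses? a f))))
        ≤⟨ ℕ.+-monoʳ-≤ (3 ℕ.* length S) (∑-mono graph (λ a∈ → ∑-mono graph (λ f∈ → all-corners a∈ f∈))) ⟩
      _ ∎
      where open ℕ.≤-Reasoning

  ∑≤graph : ∑ ls′ (λ ℓ → x ℓ P ∸ 1) ℕ.≤ length graph
  ∑≤graph = ℕ.≤-trans (∑-mono ls′ (λ ℓ∈ → ℕ.∸-monoˡ-≤ 1 (x≤edges-on (ls′⊆ls ℓ∈)))) (∑-edges-on ls′-unique ls′⊆ls)

Unique-resp-⊆ : ∀ {A : Set} {xs ys : List A} → xs ⊆ ys → Unique ys → Unique xs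
Unique-resp-⊆ [] [] = []
Unique-resp-⊆ (_ ∷ʳ xs⊆ys) (_ ∷ unique) = Unique-resp-⊆ xs⊆ys unique
Unique-resp-⊆ (refl ∷ xs⊆ys) (y∉ ∷ unique) = All-resp-⊆ xs⊆ys y∉ ∷ Unique-resp-⊆ xs⊆ys unique

-- Averaging over random subsets of the points.

module Averaging (R : RealField) (t : RealField.Carrier R) (P : List (Plane.Point R)) (P-unique : Unique P)
  (ξ-injective : Geometry.Generic R t P)
  where
  open OrderedField R using ()
  open Geometry R t
  open Configuration R t P P-unique ξ-injective
  open Lines R t
  open Plane R using (Point)
  open import Data.Nat using (_+_; _*_; _^_; _≤_; _<_; _≤?_; _<?_)
  open ℕ.≤-Reasoning
  open +-*-Solver
  private
    n = length P

  2≤x : ∀ {ℓ} → ℓ ∈ ls → 2 ≤ x ℓ P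
  2≤x {a , b} ℓ∈ = let a∈ , b∈ , a<b = line-ends ℓ∈ in
    Sample.two-on R t P P-unique ξ-injective P id P-unique {a , b} a∈ b∈
      (λ { refl → OrderedField.<-irrefl R a<b }) (area-pqp a b) (area-pqq a b)

  -- A line enters through the binomial law of its number of sampled points, which `κ-bound` rounds
  -- to integers. Lines with 7 or more points are thereby bounded by those with 2 to 5, up to the
  -- linear error of `melchior-weak`.
  κ-inequality : ∑ ls (λ ℓ → κ⁺ (x ℓ P)) ≤ ∑ ls (λ ℓ → κ⁻ (x ℓ P)) + 24 * n
  κ-inequality = ℕ.*-cancelʳ-≤ _ _ (2 ^ n) ⦃ ℕ.m^n≢0 2 n ⦄ (ℕ.+-cancelˡ-≤ (48 * ∑ ls crowded) _ _ (begin
    48 * ∑ ls crowded + ∑ ls (λ ℓ → κ⁺ (x ℓ P)) * 2 ^ n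
      ≡⟨ cong₂ _+_ (∑-*ˡ ls 48 crowded) (∑-*ʳ ls (2 ^ n) (λ ℓ → κ⁺ (x ℓ P))) ⟨
    ∑ ls (λ ℓ → 48 * crowded ℓ) + ∑ ls (λ ℓ → κ⁺ (x ℓ P) * 2 ^ n)
      ≡⟨ ∑-+ ls (λ ℓ → 48 * crowded ℓ) (λ ℓ → κ⁺ (x ℓ P) * 2 ^ n) ⟨
    ∑ ls (λ ℓ → 48 * crowded ℓ + κ⁺ (x ℓ P) * 2 ^ n)
      ≤⟨ ∑-mono ls per-line ⟩
    ∑ ls (λ ℓ → 24 * gaps ℓ + κ⁻ (x ℓ P) * 2 ^ n)
      ≡⟨ ∑-+ ls (λ ℓ → 24 * gaps ℓ) (λ ℓ → κ⁻ (x ℓ P) * 2 ^ n) ⟩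
    ∑ ls (λ ℓ → 24 * gaps ℓ) + ∑ ls (λ ℓ → κ⁻ (x ℓ P) * 2 ^ n)
      ≡⟨ cong₂ _+_ (∑-*ˡ ls 24 gaps) (∑-*ʳ ls (2 ^ n) (λ ℓ → κ⁻ (x ℓ P))) ⟩
    24 * ∑ ls gaps + ∑ ls (λ ℓ → κ⁻ (x ℓ P)) * 2 ^ n
      ≤⟨ ℕ.+-monoˡ-≤ _ (ℕ.*-monoʳ-≤ 24 averaged) ⟩
    24 * (2 * ∑ ls crowded + 2 ^ n * n) + ∑ ls (λ ℓ → κ⁻ (x ℓ P)) * 2 ^ n
      ≡⟨ solve 4 (λ c p n k → con 24 :* (con 2 :* c :+ p :* n) :+ k :* p := con 48 :* c :+ (k :+ con 24 :* n) :* p) refl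
           (∑ ls crowded) (2 ^ n) n (∑ ls (λ ℓ → κ⁻ (x ℓ P))) ⟩
    48 * ∑ ls crowded + (∑ ls (λ ℓ → κ⁻ (x ℓ P)) + 24 * n) * 2 ^ n ∎))
    where
    crowded gaps : Segment → ℕ
    crowded ℓ = 𝔼 1 1 P (λ S → 𝟙 (2 ≤? x ℓ S))
    gaps ℓ = 𝔼 1 1 P (λ S → x ℓ S ∸ 1)

    per-line : ∀ {ℓ} → ℓ ∈ ls → 48 * crowded ℓ + κ⁺ (x ℓ P) * 2 ^ n ≤ 24 * gaps ℓ + κ⁻ (x ℓ P) * 2 ^ n
    per-line {ℓ} ℓ∈ = ℕ.*-cancelʳ-≤ _ _ (2 ^ m) ⦃ ℕ.m^n≢0 2 m ⦄ (begin
      (48 * crowded ℓ + κ⁺ m * 2 ^ n) * 2 ^ m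
        ≡⟨ solve 4 (λ c k p q → (con 48 :* c :+ k :* p) :* q := con 48 :* (c :* q) :+ k :* p :* q) refl (crowded ℓ) (κ⁺ m) (2 ^ n) (2 ^ m) ⟩
      48 * (crowded ℓ * 2 ^ m) + κ⁺ m * 2 ^ n * 2 ^ m
        ≡⟨ cong (λ y → 48 * y + κ⁺ m * 2 ^ n * 2 ^ m) (𝔼-count 1 1 (on? ℓ) (at-least 2) P) ⟩
      48 * (2 ^ n * B) + κ⁺ m * 2 ^ n * 2 ^ m
        ≡⟨ solve 4 (λ B k p q → con 48 :* (p :* B) :+ k :* p :* q := p :* (con 48 :* B :+ k :* q)) refl B (κ⁺ m) (2 ^ n) (2 ^ m) ⟩
      2 ^ n * (48 * B + κ⁺ m * 2 ^ m)
        ≤⟨ ℕ.*-monoʳ-≤ (2 ^ n) (κ-bound m (2≤x ℓ∈)) ⟩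
      2 ^ n * (24 * A + κ⁻ m * 2 ^ m)
        ≡⟨ solve 4 (λ A k p q → p :* (con 24 :* A :+ k :* q) := con 24 :* (p :* A) :+ k :* p :* q) refl A (κ⁻ m) (2 ^ n) (2 ^ m) ⟩
      24 * (2 ^ n * A) + κ⁻ m * 2 ^ n * 2 ^ m
        ≡⟨ cong (λ y → 24 * y + κ⁻ m * 2 ^ n * 2 ^ m) (𝔼-count 1 1 (on? ℓ) (_∸ 1) P) ⟨
      24 * (gaps ℓ * 2 ^ m) + κ⁻ m * 2 ^ n * 2 ^ m
        ≡⟨ solve 4 (λ c k p q → (con 24 :* c :+ k :* p) :* q := con 24 :* (c :* q) :+ k :* p :* q) refl (gaps ℓ) (κ⁻ m) (2 ^ n) (2 ^ m) ⟨
      (24 * gaps ℓ + κ⁻ m * 2 ^ n) * 2 ^ m ∎)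
      where
      m = x ℓ P
      A = binomial 1 1 (_∸ 1) m
      B = binomial 1 1 (at-least 2) m

    averaged : ∑ ls gaps ≤ 2 * ∑ ls crowded + 2 ^ n * n
    averaged = begin
      ∑ ls gaps
        ≡⟨ 𝔼-∑ 1 1 P ls (λ ℓ S → x ℓ S ∸ 1) ⟨
      𝔼 1 1 P (λ S → ∑ ls (λ ℓ → x ℓ S ∸ 1))
        ≤⟨ 𝔼-mono 1 1 P (λ {S} S⊆P → ℕ.≤-trans
             (Sample.melchior-weak R t P P-unique ξ-injective S (⊆-lookup S⊆P) (Unique-resp-⊆ S⊆P P-unique))
             (ℕ.+-monoʳ-≤ _ (length-mono-≤ S⊆P))) ⟩
      𝔼 1 1 P (λ S → 2 * ∑ ls (λ ℓ → 𝟙 (2 ≤? x ℓ S)) + n)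
        ≡⟨ 𝔼-+ 1 1 P (λ S → 2 * ∑ ls (λ ℓ → 𝟙 (2 ≤? x ℓ S))) (λ _ → n) ⟩
      𝔼 1 1 P (λ S → 2 * ∑ ls (λ ℓ → 𝟙 (2 ≤? x ℓ S))) + 𝔼 1 1 P (λ _ → n)
        ≡⟨ cong₂ _+_ (trans (𝔼-*ˡ 1 1 P 2 (λ S → ∑ ls (λ ℓ → 𝟙 (2 ≤? x ℓ S))))
             (cong (2 *_) (𝔼-∑ 1 1 P ls (λ ℓ S → 𝟙 (2 ≤? x ℓ S))))) (𝔼-const 1 1 P n) ⟩
      2 * ∑ ls crowded + 2 ^ n * n ∎

  -- With p = b / N, an edge survives with probability p² and a crossing with p⁴, so p² e ≤ 3 p n +
  -- p⁴ s² / 2. This is divided by p and multiplied by 2 N³.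
  crossing-inequality : ∀ {ls′} → Unique ls′ → (∀ {ℓ} → ℓ ∈ ls′ → ℓ ∈ ls) → ∀ a b → .⦃ NonZero b ⦄ →
    let N = a + b; s = length ls′ in
    2 * ∑ ls′ (λ ℓ → x ℓ P ∸ 1) * (b * N ^ 2) ≤ 6 * n * N ^ 3 + s * s * b ^ 3
  crossing-inequality {ls′} unique ls′⊆ls a b = ℕ.*-cancelʳ-≤ _ _ (b * N ^ n) ⦃ ℕ.m*n≢0 b (N ^ n) ⦄ (begin
    2 * T * (b * N ^ 2) * (b * p)
      ≤⟨ ℕ.*-monoˡ-≤ (b * p) (ℕ.*-monoˡ-≤ (b * N ^ 2) (ℕ.*-monoʳ-≤ 2 G.∑≤graph)) ⟩
    2 * e * (b * N ^ 2) * (b * p)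
      ≡⟨ solve 4 (λ e b N p → con 2 :* e :* (b :* N :^ 2) :* (b :* p) := con 2 :* (e :* (p :* (b :* b) :* N :^ 2))) refl e b N p ⟩
    2 * (e * (p * (b * b) * N ^ 2))
      ≡⟨ cong (2 *_) (∑-const G.graph (p * (b * b) * N ^ 2)) ⟨
    2 * ∑ G.graph (λ _ → p * (b * b) * N ^ 2)
      ≡⟨ cong (2 *_) (∑-cong G.graph edge-weight) ⟨
    2 * ∑ G.graph (λ e → 𝔼 a b P (λ S → G.hits (G.ends e) S ∸ 1) * N ^ 4)
      ≡⟨ cong (2 *_) (trans (∑-*ʳ G.graph (N ^ 4) (λ e → 𝔼 a b P (λ S → G.hits (G.ends e) S ∸ 1)))
           (cong (_* N ^ 4) (sym (𝔼-∑ a b P G.graph (λ e S → G.hits (G.ends e) S ∸ 1))))) ⟩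
    2 * (𝔼 a b P (λ S → ∑ G.graph (λ e → G.hits (G.ends e) S ∸ 1)) * N ^ 4)
      ≤⟨ ℕ.*-monoʳ-≤ 2 (ℕ.*-monoˡ-≤ (N ^ 4) (𝔼-mono a b P (λ S⊆P →
           G.sampled-crossing (⊆-lookup S⊆P) (Unique-resp-⊆ S⊆P P-unique)))) ⟩
    2 * (𝔼 a b P (λ S → 3 * length S + ∑ G.graph (λ e → ∑ G.graph (λ f → weight e f S))) * N ^ 4)
      ≡⟨ cong (λ y → 2 * (y * N ^ 4)) (trans (𝔼-+ a b P (λ S → 3 * length S) (λ S → ∑ G.graph (λ e → ∑ G.graph (λ f → weight e f S))))
           (cong₂ _+_ (𝔼-*ˡ a b P 3 length) (trans (𝔼-∑ a b P G.graph (λ e S → ∑ G.graph (λ f → weight e f S)))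
             (∑-cong G.graph (λ {e} _ → 𝔼-∑ a b P G.graph (weight e)))))) ⟩
    2 * ((3 * 𝔼 a b P length + ∑ G.graph (λ e → ∑ G.graph (λ f → 𝔼 a b P (weight e f)))) * N ^ 4)
      ≡⟨ solve 3 (λ E N W → con 2 :* ((con 3 :* E :+ W) :* N :^ 4) := con 6 :* (E :* N) :* N :^ 3 :+ con 2 :* (W :* N :^ 4)) refl
           (𝔼 a b P length) N _ ⟩
    6 * (𝔼 a b P length * N) * N ^ 3 + 2 * (∑ G.graph (λ e → ∑ G.graph (λ f → 𝔼 a b P (weight e f))) * N ^ 4)
      ≡⟨ cong₂ (λ y z → 6 * y * N ^ 3 + 2 * z) (𝔼-length a b P) crossing-weights ⟩
    6 * (n * b * p) * N ^ 3 + 2 * (G.crossings * (p * (b * b * (b * b))))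
      ≡⟨ solve 5 (λ n b p N c → con 6 :* (n :* b :* p) :* N :^ 3 :+ con 2 :* (c :* (p :* (b :* b :* (b :* b))))
           := (con 6 :* n :* N :^ 3 :+ (c :+ c) :* b :^ 3) :* (b :* p)) refl n b p N G.crossings ⟩
    (6 * n * N ^ 3 + (G.crossings + G.crossings) * b ^ 3) * (b * p)
      ≤⟨ ℕ.*-monoˡ-≤ (b * p) (ℕ.+-monoʳ-≤ (6 * n * N ^ 3) (ℕ.*-monoˡ-≤ (b ^ 3) G.2*crossings≤)) ⟩
    (6 * n * N ^ 3 + length ls′ * length ls′ * b ^ 3) * (b * p) ∎)
    where
    module G = Graph R t P P-unique ξ-injective ls′ unique ls′⊆ls
    N = a + b
    p = N ^ n
    T = ∑ ls′ (λ ℓ → x ℓ P ∸ 1)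
    e = length G.graph
    instance
      N≢0 : NonZero N
      N≢0 = ℕ.>-nonZero (ℕ.<-≤-trans (ℕ.>-nonZero⁻¹ b) (ℕ.m≤n+m b a))
      p≢0 : NonZero p
      p≢0 = ℕ.m^n≢0 N n

    weight : Segment → Segment → List _ → ℕ
    weight e f S = 𝟙 (G.crosses? e f) * (G.hits (G.corners e f) S ∸ 3)

    edge-weight : ∀ {e} → e ∈ G.graph → 𝔼 a b P (λ S → G.hits (G.ends e) S ∸ 1) * N ^ 4 ≡ p * (b * b) * N ^ 2
    edge-weight {e} e∈ = trans (solve 2 (λ E N → E :* N :^ 4 := E :* N :^ 2 :* N :^ 2) refl (𝔼 a b P (λ S → G.hits (G.ends e) S ∸ 1)) N)
      (cong (_* N ^ 2) (trans (subst (λ m → 𝔼 a b P (λ S → G.hits (G.ends e) S ∸ 1) * N ^ m ≡ p * binomial a b (_∸ 1) m)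
        (G.hits-ends e∈) (𝔼-count a b (G._∈? G.ends e) (_∸ 1) P)) (cong (p *_) (binomial-pair a b))))

    quadruple : ∀ {e f} → e ∈ G.graph → f ∈ G.graph →
      𝔼 a b P (weight e f) * N ^ 4 ≡ 𝟙 (G.crosses? e f) * (p * (b * b * (b * b)))
    quadruple {e} {f} e∈ f∈ = trans (cong (_* N ^ 4) (𝔼-*ˡ a b P (𝟙 (G.crosses? e f)) (λ S → G.hits (G.corners e f) S ∸ 3)))
      (trans (ℕ.*-assoc (𝟙 (G.crosses? e f)) _ _) (by-cases (G.crosses? e f)))
      where
      by-cases : (d : Dec (Crosses e f)) → 𝟙 d * (𝔼 a b P (λ S → G.hits (G.corners e f) S ∸ 3) * N ^ 4)
                                          ≡ 𝟙 d * (p * (b * b * (b * b)))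
      by-cases (no _) = refl
      by-cases (yes cr) = cong (1 *_) (trans
        (subst (λ m → 𝔼 a b P (λ S → G.hits (G.corners e f) S ∸ 3) * N ^ m ≡ p * binomial a b (_∸ 3) m)
          (G.hits-corners e∈ f∈ cr) (𝔼-count a b (G._∈? G.corners e f) (_∸ 3) P)) (cong (p *_) (binomial-quadruple a b)))

    crossing-weights : ∑ G.graph (λ e → ∑ G.graph (λ f → 𝔼 a b P (weight e f))) * N ^ 4
                       ≡ G.crossings * (p * (b * b * (b * b)))
    crossing-weights = trans (sym (∑-*ʳ G.graph (N ^ 4) (λ e → ∑ G.graph (λ f → 𝔼 a b P (weight e f)))))
      (trans (∑-cong G.graph (λ {e} e∈ → trans (sym (∑-*ʳ G.graph (N ^ 4) (λ f → 𝔼 a b P (weight e f))))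
        (trans (∑-cong G.graph (λ f∈ → quadruple e∈ f∈)) (∑-*ʳ G.graph _ (λ f → 𝟙 (G.crosses? e f))))))
      (∑-*ʳ G.graph _ (λ e → ∑ G.graph (λ f → 𝟙 (G.crosses? e f)))))

-- Counting pairs, tails of the line sizes, and the bound for lines.

module Bounds (R : RealField) (t : RealField.Carrier R) (P : List (Plane.Point R)) (P-unique : Unique P)
  (ξ-injective : Geometry.Generic R t P)
  where
  open OrderedField R using ()
  open Geometry R t
  open Configuration R t P P-unique ξ-injective
  open Lines R t
  open Averaging R t P P-unique ξ-injective
  open Sample R t P P-unique ξ-injective P id P-unique using (_≟ₚ_; melchior)
  open Plane R using (Point)
  open import Data.Nat using (_+_; _*_; _^_; _≤_; _<_; _≤?_; _<?_)
  open ℕ.≤-Reasoning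
  open +-*-Solver

  n L : ℕ
  n = length P
  L = length ls

  j : Segment → ℕ
  j ℓ = x ℓ P ∸ 1

  U : ℕ → ℕ
  U k = ∑ ls (λ ℓ → j ℓ ∸ k)

  degree : List Segment → Point → ℕ
  degree ls′ p = ∑ ls′ (λ ℓ → 𝟙 (on? ℓ p))

  ∑-degree : ∀ ls′ → ∑ P (degree ls′) ≡ ∑ ls′ (λ ℓ → x ℓ P)
  ∑-degree ls′ = ∑-swap P ls′ (λ p ℓ → 𝟙 (on? ℓ p))

  x≡1+j : ∀ {ℓ} → ℓ ∈ ls → x ℓ P ≡ suc (j ℓ)
  x≡1+j ℓ∈ = sym (ℕ.m+[n∸m]≡n (ℕ.≤-trans (s≤s z≤n) (2≤x ℓ∈)))

  1≤j : ∀ {ℓ} → ℓ ∈ ls → 1 ≤ j ℓ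
  1≤j ℓ∈ = ℕ.∸-monoˡ-≤ 1 (2≤x ℓ∈)

  𝟙-idem : ∀ {A : Set} (d : Dec A) → 𝟙 d * 𝟙 d ≡ 𝟙 d
  𝟙-idem (yes _) = refl
  𝟙-idem (no _) = refl

  ∑-product : ∀ {A : Set} (xs : List A) (f g : A → ℕ) → ∑ xs f * ∑ xs g ≡ ∑ xs (λ y → ∑ xs (λ z → f y * g z))
  ∑-product xs f g = trans (sym (∑-*ʳ xs (∑ xs g) f)) (∑-cong xs (λ {y} _ → sym (∑-*ˡ xs (f y) g)))

  ∑-diagonal : ∀ {p} → p ∈ P → ∑ P (λ q → 𝟙 (p ≟ₚ q)) ≡ 1
  ∑-diagonal {p} p∈ = ℕ.≤-antisym (at-most-one (p ≟ₚ_) P-unique (λ { _ _ refl refl → refl }))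
    (subst (_≤ ∑ P (λ q → 𝟙 (p ≟ₚ q))) (𝟙-yes (p ≟ₚ p) refl) (term≤∑ (λ q → 𝟙 (p ≟ₚ q)) p∈))

  -- Two distinct points have a common line. The squares x² also count every pair (p, p) once for
  -- each line through p; this surplus Σ x is added on the left, which avoids subtraction.
  square-count : n * n ≤ n + 2 * ∑ ls (λ ℓ → triangle (j ℓ))
  square-count = ℕ.+-cancelʳ-≤ (∑ ls (λ ℓ → x ℓ P)) _ _ (begin
    n * n + ∑ ls (λ ℓ → x ℓ P)
      ≡⟨ cong₂ _+_ (trans (sym (∑-const P n)) (∑-cong P (λ _ → sym (∑-1 P)))) (sym (∑-degree ls)) ⟩
    ∑ P (λ _ → ∑ P (λ _ → 1)) + ∑ P (degree ls)
      ≡⟨ cong (∑ P (λ _ → ∑ P (λ _ → 1)) +_) (∑-cong P (λ {p} p∈ → trans (sym (ℕ.*-identityˡ (degree ls p)))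
           (trans (cong (_* degree ls p) (sym (∑-diagonal p∈))) (sym (∑-*ʳ P (degree ls p) (λ q → 𝟙 (p ≟ₚ q))))))) ⟩
    ∑ P (λ _ → ∑ P (λ _ → 1)) + ∑ P (λ p → ∑ P (λ q → 𝟙 (p ≟ₚ q) * degree ls p))
      ≡⟨ ∑∑-+ (λ _ _ → 1) (λ p q → 𝟙 (p ≟ₚ q) * degree ls p) ⟨
    ∑ P (λ p → ∑ P (λ q → 1 + 𝟙 (p ≟ₚ q) * degree ls p))
      ≤⟨ ∑-mono P (λ {p} p∈ → ∑-mono P (λ {q} q∈ → pointwise p∈ q∈ (p ≟ₚ q))) ⟩
    ∑ P (λ p → ∑ P (λ q → 𝟙 (p ≟ₚ q) + ∑ ls (λ ℓ → 𝟙 (on? ℓ p) * 𝟙 (on? ℓ q))))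
      ≡⟨ ∑∑-+ (λ p q → 𝟙 (p ≟ₚ q)) (λ p q → ∑ ls (λ ℓ → 𝟙 (on? ℓ p) * 𝟙 (on? ℓ q))) ⟩
    ∑ P (λ p → ∑ P (λ q → 𝟙 (p ≟ₚ q))) + ∑ P (λ p → ∑ P (λ q → ∑ ls (λ ℓ → 𝟙 (on? ℓ p) * 𝟙 (on? ℓ q))))
      ≡⟨ cong₂ _+_ (trans (∑-cong P ∑-diagonal) (∑-1 P)) (trans (∑-cong P (λ {p} _ → ∑-swap P ls (λ q ℓ → 𝟙 (on? ℓ p) * 𝟙 (on? ℓ q))))
           (trans (∑-swap P ls (λ p ℓ → ∑ P (λ q → 𝟙 (on? ℓ p) * 𝟙 (on? ℓ q))))
             (∑-cong ls (λ {ℓ} _ → sym (∑-product P (λ p → 𝟙 (on? ℓ p)) (λ p → 𝟙 (on? ℓ p))))))) ⟩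
    n + ∑ ls (λ ℓ → x ℓ P * x ℓ P)
      ≡⟨ cong (n +_) (trans (∑-cong ls x²) (trans (∑-+ ls (λ ℓ → 2 * triangle (j ℓ)) (λ ℓ → x ℓ P))
           (cong (_+ ∑ ls (λ ℓ → x ℓ P)) (∑-*ˡ ls 2 (λ ℓ → triangle (j ℓ)))))) ⟩
    n + (2 * ∑ ls (λ ℓ → triangle (j ℓ)) + ∑ ls (λ ℓ → x ℓ P))
      ≡⟨ ℕ.+-assoc n _ _ ⟨
    n + 2 * ∑ ls (λ ℓ → triangle (j ℓ)) + ∑ ls (λ ℓ → x ℓ P) ∎)
    where
    ∑∑-+ : ∀ (f g : Point → Point → ℕ) → ∑ P (λ p → ∑ P (λ q → f p q + g p q))
                                        ≡ ∑ P (λ p → ∑ P (f p)) + ∑ P (λ p → ∑ P (g p))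
    ∑∑-+ f g = trans (∑-cong P (λ {p} _ → ∑-+ P (f p) (g p))) (∑-+ P (λ p → ∑ P (f p)) (λ p → ∑ P (g p)))

    x² : ∀ {ℓ} → ℓ ∈ ls → x ℓ P * x ℓ P ≡ 2 * triangle (j ℓ) + x ℓ P
    x² {ℓ} ℓ∈ = trans (cong (λ y → y * y) (x≡1+j ℓ∈)) (trans
      (solve 1 (λ j → (con 1 :+ j) :* (con 1 :+ j) := (con 1 :+ j) :* j :+ (con 1 :+ j)) refl (j ℓ))
      (cong₂ _+_ (sym (2*triangle (j ℓ))) (sym (x≡1+j ℓ∈))))

    pointwise : ∀ {p q} → p ∈ P → q ∈ P → (d : Dec (p ≡ q)) →
                1 + 𝟙 d * degree ls p ≤ 𝟙 d + ∑ ls (λ ℓ → 𝟙 (on? ℓ p) * 𝟙 (on? ℓ q))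
    pointwise {p} p∈ q∈ (yes refl) = s≤s (ℕ.≤-reflexive (trans (ℕ.+-identityʳ _) (∑-cong ls (λ {ℓ} _ → sym (𝟙-idem (on? ℓ p))))))
    pointwise {p} {q} p∈ q∈ (no p≢q) = let ℓ , ℓ∈ , on-p , on-q = joins p∈ q∈ p≢q in
      subst (_≤ ∑ ls (λ ℓ → 𝟙 (on? ℓ p) * 𝟙 (on? ℓ q))) (cong₂ _*_ (𝟙-yes (on? ℓ p) on-p) (𝟙-yes (on? ℓ q) on-q))
        (term≤∑ (λ ℓ → 𝟙 (on? ℓ p) * 𝟙 (on? ℓ q)) ℓ∈)

  _≟ₛ_ : (ℓ m : Segment) → Dec (ℓ ≡ m)
  _≟ₛ_ = ≡-dec _≟ₚ_ _≟ₚ_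

  module _ {ls′} (unique : Unique ls′) (ls′⊆ls : ∀ {ℓ} → ℓ ∈ ls′ → ℓ ∈ ls) where
    private
      I = ∑ ls′ (λ ℓ → x ℓ P)
      s = length ls′

    common-points : ∀ {ℓ m} → ℓ ∈ ls′ → m ∈ ls′ → (d : Dec (ℓ ≡ m)) →
                    ∑ P (λ p → 𝟙 (on? ℓ p) * 𝟙 (on? m p)) ≤ 𝟙 d * x ℓ P + 1
    common-points {ℓ} ℓ∈ m∈ (yes refl) = ℕ.≤-trans (ℕ.≤-reflexive (trans (∑-cong P (λ {p} _ → 𝟙-idem (on? ℓ p)))
      (sym (ℕ.*-identityˡ (x ℓ P))))) (ℕ.m≤m+n _ 1)
    common-points {ℓ} {m} ℓ∈ m∈ (no ℓ≢m) = ℕ.≤-trans (ℕ.≤-reflexive (∑-cong P (λ {p} _ → product (on? ℓ p) (on? m p))))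
      (at-most-one (λ p → on? ℓ p ×-dec on? m p) P-unique λ {p} {q} p∈ q∈ (ℓp , mp) (ℓq , mq) →
        [ id , (λ p≢q → ⊥-elim (ℓ≢m (meet (ls′⊆ls ℓ∈) (ls′⊆ls m∈) p∈ q∈ p≢q ℓp ℓq mp mq))) ]′ (toSum (p ≟ₚ q)))
      where
      product : ∀ {A B : Set} (a : Dec A) (b : Dec B) → 𝟙 a * 𝟙 b ≡ 𝟙 (a ×-dec b)
      product (yes _) (yes _) = refl
      product (yes _) (no _) = refl
      product (no _) _ = refl

    degree-squares : ∑ P (λ p → degree ls′ p * degree ls′ p) ≤ I + s * s
    degree-squares = begin
      ∑ P (λ p → degree ls′ p * degree ls′ p)
        ≡⟨ ∑-cong P (λ {p} _ → ∑-product ls′ (λ ℓ → 𝟙 (on? ℓ p)) (λ ℓ → 𝟙 (on? ℓ p))) ⟩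
      ∑ P (λ p → ∑ ls′ (λ ℓ → ∑ ls′ (λ m → 𝟙 (on? ℓ p) * 𝟙 (on? m p))))
        ≡⟨ trans (∑-swap P ls′ (λ p ℓ → ∑ ls′ (λ m → 𝟙 (on? ℓ p) * 𝟙 (on? m p))))
             (∑-cong ls′ (λ {ℓ} _ → ∑-swap P ls′ (λ p m → 𝟙 (on? ℓ p) * 𝟙 (on? m p)))) ⟩
      ∑ ls′ (λ ℓ → ∑ ls′ (λ m → ∑ P (λ p → 𝟙 (on? ℓ p) * 𝟙 (on? m p))))
        ≤⟨ ∑-mono ls′ (λ {ℓ} ℓ∈ → ∑-mono ls′ (λ {m} m∈ → common-points ℓ∈ m∈ (ℓ ≟ₛ m))) ⟩
      ∑ ls′ (λ ℓ → ∑ ls′ (λ m → 𝟙 (ℓ ≟ₛ m) * x ℓ P + 1))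
        ≤⟨ ∑-mono ls′ (λ {ℓ} _ → ℕ.≤-trans (ℕ.≤-reflexive (∑-+ ls′ (λ m → 𝟙 (ℓ ≟ₛ m) * x ℓ P) (λ _ → 1)))
             (ℕ.+-mono-≤ (ℕ.≤-trans (ℕ.≤-reflexive (∑-*ʳ ls′ (x ℓ P) (λ m → 𝟙 (ℓ ≟ₛ m))))
               (ℕ.≤-trans (ℕ.*-monoˡ-≤ (x ℓ P) (at-most-one (ℓ ≟ₛ_) unique (λ { _ _ refl refl → refl })))
                 (ℕ.≤-reflexive (ℕ.*-identityˡ (x ℓ P))))) (ℕ.≤-reflexive (∑-1 ls′)))) ⟩
      ∑ ls′ (λ ℓ → x ℓ P + s)
        ≡⟨ trans (∑-+ ls′ (λ ℓ → x ℓ P) (λ _ → s)) (cong (I +_) (∑-const ls′ s)) ⟩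
      I + s * s ∎

    -- The sum of squared degrees counts pairs of lines at a point, and distinct lines meet at most
    -- once. Its diagonal is the number of incidences, which the + 1 in 2 m + 1 cancels.
    incidence-bound : ∀ m → 2 * m * ∑ ls′ j ≤ s * s + m * (m + 1) * n
    incidence-bound m = ℕ.≤-trans (ℕ.*-monoʳ-≤ (2 * m) (∑-mono ls′ (λ {ℓ} _ → ℕ.m∸n≤m (x ℓ P) 1)))
      (ℕ.+-cancelʳ-≤ I _ _ (begin
      2 * m * I + I
        ≡⟨ solve 2 (λ m I → con 2 :* m :* I :+ I := (con 2 :* m :+ con 1) :* I) refl m I ⟩
      (2 * m + 1) * I
        ≡⟨ trans (cong ((2 * m + 1) *_) (sym (∑-degree ls′))) (sym (∑-*ˡ P (2 * m + 1) (degree ls′))) ⟩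
      ∑ P (λ p → (2 * m + 1) * degree ls′ p)
        ≤⟨ ∑-mono P (λ {p} _ → sum-of-squares-bound m (degree ls′ p)) ⟩
      ∑ P (λ p → degree ls′ p * degree ls′ p + m * (m + 1))
        ≡⟨ trans (∑-+ P (λ p → degree ls′ p * degree ls′ p) (λ _ → m * (m + 1)))
             (cong (∑ P (λ p → degree ls′ p * degree ls′ p) +_) (trans (∑-const P (m * (m + 1))) (ℕ.*-comm n _))) ⟩
      ∑ P (λ p → degree ls′ p * degree ls′ p) + m * (m + 1) * n
        ≤⟨ ℕ.+-monoˡ-≤ _ degree-squares ⟩
      I + s * s + m * (m + 1) * n
        ≡⟨ solve 3 (λ I s c → I :+ s :+ c := s :+ c :+ I) refl I (s * s) _ ⟩
      s * s + m * (m + 1) * n + I ∎))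

  -- U k is bounded through the lines with more than k gaps: by counting incidences when k² ≥ n and by
  -- the crossing inequality, at sampling probability k² / (r n), when k² ≤ n.
  module _ (k : ℕ) .⦃ k≢0 : NonZero k ⦄ where
    private
      rich : List Segment
      rich = filter (λ ℓ → k <? j ℓ) ls

      s = length rich

      rich-unique : Unique rich
      rich-unique = Unique.filter⁺ (λ ℓ → k <? j ℓ) ls-unique

      rich⊆ls : ∀ {ℓ} → ℓ ∈ rich → ℓ ∈ ls
      rich⊆ls ℓ∈ = proj₁ (∈-filter⁻ (λ ℓ → k <? j ℓ) {xs = ls} ℓ∈)

      ∑-rich : ∑ rich j ≡ U k + k * s
      ∑-rich = trans (∑-filter (λ ℓ → k <? j ℓ) ls j) (trans (∑-cong ls (λ {ℓ} _ → pointwise (j ℓ) (k <? j ℓ)))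
        (trans (∑-+ ls (λ ℓ → j ℓ ∸ k) (λ ℓ → k * 𝟙 (k <? j ℓ))) (cong (U k +_)
          (trans (∑-*ˡ ls k (λ ℓ → 𝟙 (k <? j ℓ))) (cong (k *_) (sym (length-filter-𝟙 (λ ℓ → k <? j ℓ) ls)))))))
        where
        pointwise : ∀ j (d : Dec (k < j)) → 𝟙 d * j ≡ (j ∸ k) + k * 𝟙 d
        pointwise j (yes k<j) = trans (ℕ.*-identityˡ j) (sym (trans (cong (j ∸ k +_) (ℕ.*-identityʳ k)) (ℕ.m∸n+n≡m (ℕ.<⇒≤ k<j))))
        pointwise j (no k≮j) = sym (cong₂ _+_ (ℕ.m≤n⇒m∸n≡0 (ℕ.≮⇒≥ k≮j)) (ℕ.*-zeroʳ k))

    U-tail : n ≤ k * k → U k ≤ n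
    U-tail n≤k² = tail-bound (U k) s k n n≤k² (λ m → subst (λ T → 2 * m * T ≤ s * s + m * (m + 1) * n)
      ∑-rich (incidence-bound rich-unique rich⊆ls m))

    U-middle : .⦃ NonZero n ⦄ → k * k ≤ n → k * k * U k ≤ 5 * (n * n)
    -- In these variables only the ratio s k³ / n² is left to optimise; it compares s with the
    -- Szemerédi-Trotter order n² / k³ for the number of rich lines.
    U-middle k²≤n = middle-bound (k * k * U k) (s * (k * k * k)) (n * n) ⦃ ℕ.m*n≢0 n n ⦄ λ r → begin
      2 * (k * k * U k + s * (k * k * k)) * (r * r * (n * n))
        ≡⟨ solve 5 (λ k u s r n → con 2 :* (k :* k :* u :+ s :* (k :* k :* k)) :* (r :* r :* (n :* n))
             := con 2 :* (u :+ k :* s) :* (k :* k :* (r :* n) :^ 2)) refl k (U k) s r n ⟩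
      2 * (U k + k * s) * (k * k * (r * n) ^ 2)
        ≤⟨ with-N r ⟩
      6 * n * (r * n) ^ 3 + s * s * (k * k) ^ 3
        ≡⟨ solve 4 (λ k s r n → con 6 :* n :* (r :* n) :^ 3 :+ s :* s :* (k :* k) :^ 3
             := con 6 :* (r :* r :* r) :* (n :* n :* (n :* n)) :+ (s :* (k :* k :* k)) :* (s :* (k :* k :* k))) refl k s r n ⟩
      6 * (r * r * r) * (n * n * (n * n)) + s * (k * k * k) * (s * (k * k * k)) ∎
      where
      with-N : ∀ r → .⦃ NonZero r ⦄ → 2 * (U k + k * s) * (k * k * (r * n) ^ 2)
                       ≤ 6 * n * (r * n) ^ 3 + s * s * (k * k) ^ 3
      with-N r = subst₂ (λ T N → 2 * T * (k * k * N ^ 2) ≤ 6 * n * N ^ 3 + s * s * (k * k) ^ 3)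
        ∑-rich (ℕ.m∸n+n≡m (ℕ.≤-trans k²≤n (ℕ.m≤n*m n r)))
        (crossing-inequality rich-unique rich⊆ls (r * n ∸ k * k) (k * k) ⦃ ℕ.m*n≢0 k k ⦄)

  -- The lines from p to the points of ℓ are distinct, since a coincidence would put p on ℓ.
  degree-off-line : ∀ {ℓ p} → ℓ ∈ ls → p ∈ P → ¬ On ℓ p → x ℓ P ≤ degree ls p
  degree-off-line {ℓ} {p} ℓ∈ p∈ off = subst₂ _≤_ (length-filter-𝟙 (on? ℓ) P) (length-filter-𝟙 (λ m → on? m p) ls)
    (pigeonhole (λ q m → m ∈ ls × On m p × On m q) (filter (on? ℓ) P) (filter (λ m → on? m p) ls) (Unique.filter⁺ (on? ℓ) P-unique)
      (λ q∈ → let q∈P , ℓq = ∈-filter⁻ (on? ℓ) {xs = P} q∈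
                  m , m∈ , mp , mq = joins p∈ q∈P (λ { refl → off ℓq })
              in m , ∈-filter⁺ (λ m → on? m p) m∈ mp , m∈ , mp , mq)
      (λ {q} {q′} q∈ q′∈ (m∈ , mp , mq) (_ , _ , mq′) →
        let q∈P , ℓq = ∈-filter⁻ (on? ℓ) {xs = P} q∈
            q′∈P , ℓq′ = ∈-filter⁻ (on? ℓ) {xs = P} q′∈
        in [ id , (λ q≢q′ → ⊥-elim (off (subst (λ m → On m p) (meet m∈ ℓ∈ q∈P q′∈P q≢q′ mq mq′ ℓq ℓq′) mp))) ]′ (toSum (q ≟ₚ q′))))

  line-product : ∀ {ℓ} → ℓ ∈ ls → n * x ℓ P ≤ ∑ ls (λ m → x m P) + x ℓ P * x ℓ P
  line-product {ℓ} ℓ∈ = begin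
    n * x ℓ P
      ≡⟨ ∑-const P (x ℓ P) ⟨
    ∑ P (λ _ → x ℓ P)
      ≤⟨ ∑-mono P (λ {p} p∈ → pointwise p∈ (on? ℓ p)) ⟩
    ∑ P (λ p → degree ls p + 𝟙 (on? ℓ p) * x ℓ P)
      ≡⟨ trans (∑-+ P (degree ls) (λ p → 𝟙 (on? ℓ p) * x ℓ P))
           (cong₂ _+_ (∑-degree ls) (∑-*ʳ P (x ℓ P) (λ p → 𝟙 (on? ℓ p)))) ⟩
    ∑ ls (λ m → x m P) + x ℓ P * x ℓ P ∎
    where
    pointwise : ∀ {p} → p ∈ P → (d : Dec (On ℓ p)) → x ℓ P ≤ degree ls p + 𝟙 d * x ℓ P
    pointwise {p} p∈ (yes _) = ℕ.≤-trans (ℕ.≤-reflexive (sym (ℕ.*-identityˡ (x ℓ P)))) (ℕ.m≤n+m (1 * x ℓ P) (degree ls p))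
    pointwise p∈ (no off) = ℕ.≤-trans (degree-off-line ℓ∈ p∈ off) (ℕ.m≤m+n _ _)

  module _ {ℓ₀} (ℓ₀∈ : ℓ₀ ∈ ls) (maximal : ∀ {ℓ} → ℓ ∈ ls → x ℓ P ≤ x ℓ₀ P) (proper : x ℓ₀ P < n) where
    private
      X d : ℕ
      X = x ℓ₀ P
      d = n ∸ X

      n≡ : X + d ≡ n
      n≡ = ℕ.m+[n∸m]≡n (ℕ.<⇒≤ proper)

    ∑j≤ : ∑ ls j ≤ 2 * L
    ∑j≤ = ℕ.≤-trans (melchior λ {p} {q} p∈ q∈ p≢q → off-line p∈ q∈ p≢q (any? (λ s → ¬? (_≟ℝ_ R (area p q s) (OrderedField.0# R))) P))
      (ℕ.*-monoʳ-≤ 2 (ℕ.≤-trans (∑-mono ls (λ {ℓ} _ → 𝟙-≤ (2 ≤? x ℓ P) (λ _ → ℕ.≤-refl))) (ℕ.≤-reflexive (∑-1 ls))))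
      where
      off-line : ∀ {p q} → p ∈ P → q ∈ P → p ≢ q → Dec (Any (λ s → area p q s ≢ OrderedField.0# R) P) →
                 ∃ λ s → s ∈ P × area p q s ≢ OrderedField.0# R
      off-line _ _ _ (yes off) = find off
      off-line {p} {q} p∈ q∈ p≢q (no ¬off) =
        let ℓ , ℓ∈ , ℓp , ℓq = joins p∈ q∈ p≢q
            all-on : ∀ {s} → s ∈ P → On ℓ s
            all-on {s} s∈ = on-chord⇒on (≢⇒ξ≢ p∈ q∈ p≢q) ℓp ℓq
              ([ id , (λ off → ⊥-elim (¬off (lose s∈ off))) ]′ (toSum (_≟ℝ_ R (area p q s) (OrderedField.0# R))))
        in ⊥-elim (ℕ.<⇒≱ proper (ℕ.≤-trans (ℕ.≤-reflexive (trans (sym (∑-1 P))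
             (∑-cong P (λ {s} s∈ → sym (𝟙-yes (on? ℓ s) (all-on s∈)))))) (maximal ℓ∈)))

    long-line : 3 * n ≤ 61 * X → n * d ≤ 61 * L
    long-line 3n≤61X = ℕ.*-cancelˡ-≤ 3 (begin
      3 * (n * d)     ≡⟨ ℕ.*-assoc 3 n d ⟨
      3 * n * d       ≤⟨ ℕ.*-monoˡ-≤ d 3n≤61X ⟩
      61 * X * d      ≡⟨ ℕ.*-assoc 61 X d ⟩
      61 * (X * d)    ≤⟨ ℕ.*-monoʳ-≤ 61 (ℕ.+-cancelʳ-≤ (X * X) _ _ (begin
        X * d + X * X                     ≡⟨ solve 2 (λ X d → X :* d :+ X :* X := (X :+ d) :* X) refl X d ⟩
        (X + d) * X                         ≡⟨ cong (_* X) n≡ ⟩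
        n * X                                 ≤⟨ line-product ℓ₀∈ ⟩
        ∑ ls (λ m → x m P) + X * X          ≡⟨ cong (_+ X * X) (trans (∑-cong ls (λ ℓ∈ → x≡1+j ℓ∈)) (trans (∑-+ ls (λ _ → 1) j) (cong (_+ ∑ ls j) (∑-1 ls)))) ⟩
        L + ∑ ls j + X * X                ≤⟨ ℕ.+-monoˡ-≤ (X * X) (ℕ.+-monoʳ-≤ L ∑j≤) ⟩
        3 * L + X * X                     ∎)) ⟩
      61 * (3 * L)    ≡⟨ solve 1 (λ L → con 61 :* (con 3 :* L) := con 3 :* (con 61 :* L)) refl L ⟩
      3 * (61 * L)    ∎)

    ∑-triangle : ∀ K → ∑ ls (λ ℓ → triangle (j ℓ ∸ K)) ≤ sumBelow (λ i → U (K + i)) (X ∸ K)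
    ∑-triangle K = begin
      ∑ ls (λ ℓ → triangle (j ℓ ∸ K))
        ≤⟨ ∑-mono ls (λ {ℓ} ℓ∈ → triangle≤sumBelow (ℕ.∸-monoˡ-≤ K (ℕ.≤-trans (ℕ.m∸n≤m (x ℓ P) 1) (maximal ℓ∈)))) ⟩
      ∑ ls (λ ℓ → sumBelow (j ℓ ∸ K ∸_) (X ∸ K))
        ≡⟨ ∑-sumBelow ls (X ∸ K) ⟩
      sumBelow (λ i → ∑ ls (λ ℓ → j ℓ ∸ K ∸ i)) (X ∸ K)
        ≤⟨ sumBelow-mono (X ∸ K) (λ i → ℕ.≤-reflexive (∑-cong ls (λ {ℓ} _ → ℕ.∸-+-assoc (j ℓ) K i))) ⟩
      sumBelow (λ i → U (K + i)) (X ∸ K) ∎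
      where
      ∑-sumBelow : ∀ ms h → ∑ ms (λ ℓ → sumBelow (j ℓ ∸ K ∸_) h) ≡ sumBelow (λ i → ∑ ms (λ ℓ → j ℓ ∸ K ∸ i)) h
      ∑-sumBelow ms zero = ∑-zero ms
      ∑-sumBelow ms (suc h) = trans (∑-+ ms (λ ℓ → j ℓ ∸ K ∸ h) (λ ℓ → sumBelow (j ℓ ∸ K ∸_) h))
        (cong (∑ ms (λ ℓ → j ℓ ∸ K ∸ h) +_) (∑-sumBelow ms h))

    U≡0 : ∀ {K} → X ≤ K → U K ≡ 0
    U≡0 {K} X≤K = trans (∑-cong ls (λ {ℓ} ℓ∈ → ℕ.m≤n⇒m∸n≡0 (ℕ.≤-trans (ℕ.m∸n≤m (x ℓ P) 1) (ℕ.≤-trans (maximal ℓ∈) X≤K)))) (∑-zero ls)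

    -- As 2500 = 50², every `U k` with k ≥ 50 is at most n by incidences. There are X - 50 layers
    -- and 24 further copies, together at most X multiples of n.
    few-points-tail : n ≤ 2500 → 24 * U 50 + ∑ ls (λ ℓ → triangle (j ℓ ∸ 50)) ≤ X * n
    few-points-tail n≤2500 with X ≤? 50
    -- Treated apart because 24 + (X ∸ 50) can exceed X here; all the terms vanish instead.
    ... | yes X≤50 = ℕ.≤-trans (ℕ.+-mono-≤ (ℕ.≤-reflexive (trans (cong (24 *_) (U≡0 X≤50)) (ℕ.*-zeroʳ 24)))
            (ℕ.≤-trans (∑-triangle 50) (ℕ.≤-reflexive (cong (sumBelow (λ i → U (50 + i))) (ℕ.m≤n⇒m∸n≡0 X≤50))))) z≤n
    ... | no X≰50 = begin
      24 * U 50 + ∑ ls (λ ℓ → triangle (j ℓ ∸ 50))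
        ≤⟨ ℕ.+-mono-≤ (ℕ.*-monoʳ-≤ 24 (U-tail 50 n≤2500)) (ℕ.≤-trans (∑-triangle 50)
             (sumBelow-const n (X ∸ 50) (λ i → U-tail (50 + i) (ℕ.≤-trans n≤2500 (ℕ.*-mono-≤ (ℕ.m≤m+n 50 i) (ℕ.m≤m+n 50 i)))))) ⟩
      24 * n + (X ∸ 50) * n
        ≡⟨ ℕ.*-distribʳ-+ n 24 (X ∸ 50) ⟨
      (24 + (X ∸ 50)) * n
        ≤⟨ ℕ.*-monoˡ-≤ n (ℕ.≤-trans (ℕ.+-monoˡ-≤ (X ∸ 50) (ℕ.≤ᵇ⇒≤ 24 50 _)) (ℕ.≤-reflexive (ℕ.m+[n∸m]≡n (ℕ.≰⇒≥ X≰50)))) ⟩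
      X * n ∎

    -- The coefficient 54 is 2 (2 · 26 - 25), from the multipliers 26 and 25 in `small-line` and the
    -- factor 2 in Melchior's inequality.
    few-points : n ≤ 2500 → n * n ≤ 54 * L + (1 + 2 * X) * n
    few-points n≤2500 = begin
      n * n
        ≤⟨ square-count ⟩
      n + 2 * Δ
        ≤⟨ ℕ.+-monoʳ-≤ n (ℕ.*-monoʳ-≤ 2 (ℕ.+-cancelʳ-≤ (25 * L) Δ (27 * L + X * n) (begin
          Δ + 25 * L
            ≡⟨ trans (∑-+ ls (λ ℓ → triangle (j ℓ)) (λ _ → 25)) (cong (Δ +_) (trans (∑-const ls 25) (ℕ.*-comm L 25))) ⟨
          ∑ ls (λ ℓ → triangle (j ℓ) + 25)
            ≤⟨ ∑-mono ls (λ {ℓ} ℓ∈ → small-line (j ℓ) (1≤j ℓ∈)) ⟩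
          ∑ ls (λ ℓ → 26 * j ℓ + 24 * (j ℓ ∸ 50) + triangle (j ℓ ∸ 50))
            ≡⟨ trans (∑-+ ls (λ ℓ → 26 * j ℓ + 24 * (j ℓ ∸ 50)) (λ ℓ → triangle (j ℓ ∸ 50)))
                 (cong (_+ W) (trans (∑-+ ls (λ ℓ → 26 * j ℓ) (λ ℓ → 24 * (j ℓ ∸ 50)))
                   (cong₂ _+_ (∑-*ˡ ls 26 j) (∑-*ˡ ls 24 (λ ℓ → j ℓ ∸ 50))))) ⟩
          26 * ∑ ls j + 24 * U 50 + W
            ≡⟨ ℕ.+-assoc (26 * ∑ ls j) _ _ ⟩
          26 * ∑ ls j + (24 * U 50 + W)
            ≤⟨ ℕ.+-mono-≤ (ℕ.*-monoʳ-≤ 26 ∑j≤) (few-points-tail n≤2500) ⟩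
          26 * (2 * L) + X * n
            ≡⟨ solve 2 (λ L w → con 26 :* (con 2 :* L) :+ w := con 27 :* L :+ w :+ con 25 :* L) refl L (X * n) ⟩
          27 * L + X * n + 25 * L ∎))) ⟩
      n + 2 * (27 * L + X * n)
        ≡⟨ solve 3 (λ n L X → n :+ con 2 :* (con 27 :* L :+ X :* n) := con 54 :* L :+ (con 1 :+ con 2 :* X) :* n) refl n L X ⟩
      54 * L + (1 + 2 * X) * n ∎
      where
      Δ = ∑ ls (λ ℓ → triangle (j ℓ))
      W = ∑ ls (λ ℓ → triangle (j ℓ ∸ 50))

    -- In either range of k the tail `U k` is at most 5 n² / k² + n, and the sum of 1 / k² over k ≥
    -- 29 is at most 1 / 28.
    many-points-tail : .⦃ NonZero n ⦄ → 28 * ∑ ls (λ ℓ → triangle (j ℓ ∸ 29)) ≤ 5 * (n * n) + 28 * n * X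
    many-points-tail = begin
      28 * ∑ ls (λ ℓ → triangle (j ℓ ∸ 29))
        ≤⟨ ℕ.*-monoʳ-≤ 28 (∑-triangle 29) ⟩
      28 * sumBelow (λ i → U (29 + i)) (X ∸ 29)
        ≤⟨ telescope 28 (λ i → U (29 + i)) (5 * (n * n)) n bound (X ∸ 29) ⟩
      5 * (n * n) + 28 * n * (X ∸ 29)
        ≤⟨ ℕ.+-monoʳ-≤ _ (ℕ.*-monoʳ-≤ (28 * n) (ℕ.m∸n≤m X 29)) ⟩
      5 * (n * n) + 28 * n * X ∎
      where
      bound : ∀ i → let k = 28 + i in U (suc k) * (k * suc k) ≤ 5 * (n * n) + n * (k * suc k)
      bound i with ℕ.≤-total n ((29 + i) * (29 + i))
      ... | inj₁ n≤k² = ℕ.≤-trans (ℕ.*-monoˡ-≤ ((28 + i) * (29 + i)) (U-tail (29 + i) n≤k²)) (ℕ.m≤n+m _ _)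
      ... | inj₂ k²≤n = ℕ.≤-trans (ℕ.*-monoʳ-≤ (U (29 + i)) (ℕ.*-monoˡ-≤ (29 + i) (ℕ.n≤1+n (28 + i))))
              (ℕ.≤-trans (ℕ.≤-reflexive (ℕ.*-comm (U (29 + i)) _)) (ℕ.≤-trans (U-middle (29 + i) k²≤n) (ℕ.m≤m+n _ _)))

    -- Of the n² pairs, rich lines absorb n² / 7 through `U 29` and 5 n² / 14 through `W`, together
    -- half. The other half is at most 24 L = 2 (12 + 5 · 2 - 10) L up to linear terms. The factor
    -- 14 clears denominators.
    many-points : 2500 ≤ n → n * n ≤ 48 * L + (98 + 4 * X) * n
    many-points 2500≤n = ℕ.*-cancelˡ-≤ 7 (ℕ.+-cancelʳ-≤ (7 * (n * n)) _ _ (begin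
      7 * (n * n) + 7 * (n * n)
        ≡⟨ solve 1 (λ q → con 7 :* q :+ con 7 :* q := con 14 :* q) refl (n * n) ⟩
      14 * (n * n)
        ≤⟨ ℕ.*-monoʳ-≤ 14 square-count ⟩
      14 * (n + 2 * Δ)
        ≤⟨ ℕ.*-monoʳ-≤ 14 (ℕ.+-monoʳ-≤ n (ℕ.*-monoʳ-≤ 2 triangles)) ⟩
      14 * (n + 2 * (12 * L + 24 * n + 12 * U 29 + W))
        ≡⟨ solve 4 (λ n L u W → con 14 :* (n :+ con 2 :* (con 12 :* L :+ con 24 :* n :+ con 12 :* u :+ W))
             := con 7 :* (con 48 :* L) :+ con 686 :* n :+ con 2 :* (con 168 :* u) :+ con 28 :* W) refl n L (U 29) W ⟩
      7 * (48 * L) + 686 * n + 2 * (168 * U 29) + 28 * W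
        ≤⟨ ℕ.+-mono-≤ (ℕ.+-monoʳ-≤ (7 * (48 * L) + 686 * n) (ℕ.*-monoʳ-≤ 2 168U≤n²)) many-points-tail ⟩
      7 * (48 * L) + 686 * n + 2 * (n * n) + (5 * (n * n) + 28 * n * X)
        ≡⟨ solve 3 (λ n L X → con 7 :* (con 48 :* L) :+ con 686 :* n :+ con 2 :* (n :* n) :+ (con 5 :* (n :* n) :+ con 28 :* n :* X)
             := con 7 :* (con 48 :* L :+ (con 98 :+ con 4 :* X) :* n) :+ con 7 :* (n :* n)) refl n L X ⟩
      7 * (48 * L + (98 + 4 * X) * n) + 7 * (n * n) ∎))
      where
      instance
        n≢0 : NonZero n
        n≢0 = ℕ.>-nonZero (ℕ.≤-trans (ℕ.≤ᵇ⇒≤ 1 2500 _) 2500≤n)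
      Δ = ∑ ls (λ ℓ → triangle (j ℓ))
      W = ∑ ls (λ ℓ → triangle (j ℓ ∸ 29))
      K⁻ = ∑ ls (λ ℓ → κ⁻ (x ℓ P))
      K⁺ = ∑ ls (λ ℓ → κ⁺ (x ℓ P))

      168U≤n² : 168 * U 29 ≤ n * n
      168U≤n² = ℕ.*-cancelˡ-≤ 5 (begin
        5 * (168 * U 29)   ≡⟨ ℕ.*-assoc 5 168 (U 29) ⟨
        -- Here 841 = 29² and 840 = 5 · 168.
        840 * U 29           ≤⟨ ℕ.*-monoˡ-≤ (U 29) (ℕ.≤ᵇ⇒≤ 840 841 _) ⟩
        841 * U 29           ≤⟨ U-middle 29 (ℕ.≤-trans (ℕ.≤ᵇ⇒≤ 841 2500 _) 2500≤n) ⟩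
        5 * (n * n)        ∎)

      per-line : ∀ {ℓ} → ℓ ∈ ls → triangle (j ℓ) + 10 + κ⁻ (x ℓ P) ≤
                                   12 + 5 * j ℓ + κ⁺ (x ℓ P) + 12 * (j ℓ ∸ 29) + triangle (j ℓ ∸ 29)
      per-line {ℓ} ℓ∈ = subst (λ y → triangle (j ℓ) + 10 + κ⁻ y ≤
          12 + 5 * j ℓ + κ⁺ y + 12 * (j ℓ ∸ 29) + triangle (j ℓ ∸ 29))
        (sym (x≡1+j ℓ∈)) (large-line (j ℓ) (1≤j ℓ∈))

      triangles : Δ ≤ 12 * L + 24 * n + 12 * U 29 + W
      triangles = ℕ.+-cancelʳ-≤ (10 * L + K⁻) _ _ (begin
        Δ + (10 * L + K⁻)
          ≡⟨ ℕ.+-assoc Δ _ _ ⟨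
        Δ + 10 * L + K⁻
          ≡⟨ cong (λ y → Δ + y + K⁻) (trans (ℕ.*-comm 10 L) (sym (∑-const ls 10))) ⟩
        Δ + ∑ ls (λ _ → 10) + K⁻
          ≡⟨ trans (∑-+ ls (λ ℓ → triangle (j ℓ) + 10) (λ ℓ → κ⁻ (x ℓ P)))
               (cong (_+ K⁻) (∑-+ ls (λ ℓ → triangle (j ℓ)) (λ _ → 10))) ⟨
        ∑ ls (λ ℓ → triangle (j ℓ) + 10 + κ⁻ (x ℓ P))
          ≤⟨ ∑-mono ls per-line ⟩
        ∑ ls (λ ℓ → 12 + 5 * j ℓ + κ⁺ (x ℓ P) + 12 * (j ℓ ∸ 29) + triangle (j ℓ ∸ 29))
          ≡⟨ trans (∑-+ ls (λ ℓ → 12 + 5 * j ℓ + κ⁺ (x ℓ P) + 12 * (j ℓ ∸ 29)) (λ ℓ → triangle (j ℓ ∸ 29))) (cong (_+ W)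
               (trans (∑-+ ls (λ ℓ → 12 + 5 * j ℓ + κ⁺ (x ℓ P)) (λ ℓ → 12 * (j ℓ ∸ 29))) (cong₂ _+_
                 (trans (∑-+ ls (λ ℓ → 12 + 5 * j ℓ) (λ ℓ → κ⁺ (x ℓ P))) (cong (_+ K⁺)
                   (trans (∑-+ ls (λ _ → 12) (λ ℓ → 5 * j ℓ)) (cong₂ _+_ (∑-const ls 12) (∑-*ˡ ls 5 j)))))
                 (∑-*ˡ ls 12 (λ ℓ → j ℓ ∸ 29))))) ⟩
        L * 12 + 5 * ∑ ls j + K⁺ + 12 * U 29 + W
          ≤⟨ ℕ.+-monoˡ-≤ W (ℕ.+-monoˡ-≤ (12 * U 29) (ℕ.+-mono-≤ (ℕ.+-monoʳ-≤ (L * 12) (ℕ.*-monoʳ-≤ 5 ∑j≤)) κ-inequality)) ⟩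
        L * 12 + 5 * (2 * L) + (K⁻ + 24 * n) + 12 * U 29 + W
          ≡⟨ solve 5 (λ L k n u W → L :* con 12 :+ con 5 :* (con 2 :* L) :+ (k :+ con 24 :* n) :+ u :+ W
               := con 12 :* L :+ con 24 :* n :+ u :+ W :+ (con 10 :* L :+ k)) refl L K⁻ n (12 * U 29) W ⟩
        12 * L + 24 * n + 12 * U 29 + W + (10 * L + K⁻) ∎)

    lines-bound : n * d ≤ 61 * L
    lines-bound with ℕ.≤-total (3 * n) (61 * X)
    ... | inj₁ 3n≤61X = long-line 3n≤61X
    ... | inj₂ 61X≤3n = subst (λ n → n * d ≤ 61 * L) n≡ (by-size (ℕ.≤-total n 2500))
      where
      19X≤d : 19 * X ≤ d
      19X≤d = 19*X≤d X d (subst (λ n → 61 * X ≤ 3 * n) (sym n≡) 61X≤3n)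
      instance
        X+d≢0 : NonZero (X + d)
        X+d≢0 = ℕ.>-nonZero (ℕ.≤-trans (ℕ.≤-trans (s≤s z≤n) (2≤x ℓ₀∈)) (ℕ.m≤m+n X d))
      by-size : _ → (X + d) * d ≤ 61 * L
      by-size (inj₁ n≤2500) = conclude 54 L X d 1 2
        (subst (λ n → n * n ≤ 54 * L + (1 + 2 * X) * n) (sym n≡) (few-points n≤2500))
        (small-slack X d (2≤x ℓ₀∈) 19X≤d)
      by-size (inj₂ 2500≤n) = conclude 48 L X d 98 4
        (subst (λ n → n * n ≤ 48 * L + (98 + 4 * X) * n) (sym n≡) (many-points 2500≤n))
        (large-slack X d (subst (2500 ≤_) (sym n≡) 2500≤n) 19X≤d)

filter-mono-length : ∀ {A : Set} {Q Q′ : A → Set} (Q? : ∀ a → Dec (Q a)) (Q′? : ∀ a → Dec (Q′ a)) xs →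
                     (∀ {a} → Q a → Q′ a) → length (filter Q? xs) ℕ.≤ length (filter Q′? xs)
filter-mono-length Q? Q′? xs Q⇒Q′ = subst₂ ℕ._≤_ (sym (length-filter-𝟙 Q? xs)) (sym (length-filter-𝟙 Q′? xs))
  (∑-mono xs (λ {a} _ → 𝟙-mono (Q? a) (Q′? a) Q⇒Q′))

-- Choice of a generic abscissa, and the theorem.

module Beck (R : RealField) where
  open OrderedField R
  open Plane R
  open Solver using (solve; _:=_; _:+_; _:*_; _:-_; :-_; con)

  0<1 : 0# < 1#
  0<1 with sign 1#
  ... | positive 0<1 = 0<1
  ... | null 1≡0 = ⊥-elim (0≢1 (sym 1≡0))
  ... | negative 0<-1 = subst (0# <_) (trans (solve 1 (λ x → (:- x) :* (:- x) := x :* x) refl 1#) (*-identityˡ 1#)) (*-pos 0<-1 0<-1)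

  above-all : ∀ bs → ∃ λ t → ∀ {b} → b ∈ bs → b < t
  above-all [] = 0# , λ ()
  above-all (b ∷ bs) = let t , h = above-all bs in by-order t h (<-or-≤ b t)
    where
    by-order : ∀ t → (∀ {b} → b ∈ bs → b < t) → b < t ⊎ t ≤ b → ∃ λ t → ∀ {b′} → b′ ∈ b ∷ bs → b′ < t
    by-order t h (inj₁ b<t) = t , λ { (here refl) → b<t ; (there b∈) → h b∈ }
    by-order t h (inj₂ t≤b) = b + 1# , λ { (here refl) → b<b+1 ; (there b∈) → <-trans (h b∈) (≤-<-trans t≤b b<b+1) }
      where
      b<b+1 : b < b + 1#
      b<b+1 = 0<-⇒< (subst (0# <_) (solve 2 (λ b o → o := (b :+ o) :- b) refl b 1#) 0<1)

  -- The slope at which the abscissae of two points agree (0 if there is none).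
  tie : Point → Point → Carrier
  tie (px , py) (qx , qy) with _≟ℝ_ R (py - qy) 0#
  ... | yes _ = 0#
  ... | no d≢0 = (qx - px) * inv (py - qy) d≢0

  ξ-≡⇒≡ : ∀ t p q → tie p q < t → Geometry.ξ R t p ≡ Geometry.ξ R t q → p ≡ q
  ξ-≡⇒≡ t (px , py) (qx , qy) tie<t ξ≡ with _≟ℝ_ R (py - qy) 0#
  ... | yes d≡0 = cong₂ _,_ (-≡0⇒≡ (begin
      px - qx                                     ≡⟨ solve 5 (λ t px py qx qy → px :- qx := ((px :+ t :* py) :- (qx :+ t :* qy)) :- t :* (py :- qy)) refl t px py qx qy ⟩
      (px + t * py) - (qx + t * qy) - t * (py - qy) ≡⟨ cong₂ (λ a b → a - t * b) (trans (cong (_- (qx + t * qy)) ξ≡′) (-‿inverseʳ _)) d≡0 ⟩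
      0# - t * 0#                                 ≡⟨ solve 1 (λ t → con 0ℤ :- t :* con 0ℤ := con 0ℤ) refl t ⟩
      0#                                          ∎)) (-≡0⇒≡ d≡0)
    where
    open ≡-Reasoning
    ξ≡′ : px + t * py ≡ qx + t * qy
    ξ≡′ = trans (sym (Geometry.ξ-def R t px py)) (trans ξ≡ (Geometry.ξ-def R t qx qy))
  ... | no d≢0 = ⊥-elim (<-irrefl (subst (_< t) (sym t≡) tie<t))
    where
    open ≡-Reasoning
    i = inv (py - qy) d≢0
    ξ≡′ : px + t * py ≡ qx + t * qy
    ξ≡′ = trans (sym (Geometry.ξ-def R t px py)) (trans ξ≡ (Geometry.ξ-def R t qx qy))
    t≡ : t ≡ (qx - px) * i
    t≡ = begin
      t                                           ≡⟨ *-identityʳ t ⟨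
      t * 1#                                      ≡⟨ cong (t *_) (inv-law (py - qy) d≢0) ⟨
      t * ((py - qy) * i)                         ≡⟨ solve 6 (λ t px py qx qy i → t :* ((py :- qy) :* i)
                                                       := ((px :+ t :* py) :- (qx :+ t :* qy)) :* i :+ (qx :- px) :* i) refl t px py qx qy i ⟩
      ((px + t * py) - (qx + t * qy)) * i + (qx - px) * i
        ≡⟨ cong (λ a → a * i + (qx - px) * i) (trans (cong (_- (qx + t * qy)) ξ≡′) (-‿inverseʳ _)) ⟩
      0# * i + (qx - px) * i                      ≡⟨ solve 2 (λ i a → con 0ℤ :* i :+ a := a) refl i ((qx - px) * i) ⟩
      (qx - px) * i                               ∎

  -- Each pair of distinct points forbids at most one slope, so any t beyond these finitely many
  -- values works.
  generic-slope : ∀ (P : List Point) → ∃ λ t → ∀ {p q} → p ∈ P → q ∈ P → Geometry.ξ R t p ≡ Geometry.ξ R t q → p ≡ q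
  generic-slope P = let t , h = above-all (map (λ pq → tie (proj₁ pq) (proj₂ pq)) (cartesianProduct P P)) in
    t , λ {p} {q} p∈ q∈ → ξ-≡⇒≡ t p q (h (∈-map⁺ (λ pq → tie (proj₁ pq) (proj₂ pq)) (∈-cartesianProduct⁺ p∈ q∈)))

  -- A single point determines no line, so 1 · (1 - l) has to vanish; the vertical line through the
  -- point forces this.
  at-most-one-point : ∀ {p l} → AtMostCollinear (p ∷ []) l → 1 ℕ.≤ l
  at-most-one-point {px , py} few = ℕ.≤-trans
    (∈-length (∈-filter⁺ {P = λ s → 1# * proj₁ s + 0# * proj₂ s ≡ px} (λ s → _≟ℝ_ R (1# * proj₁ s + 0# * proj₂ s) px)
      {xs = (px , py) ∷ []} (here refl)
      (trans (solve 3 (λ o x y → o :* x :+ con 0ℤ :* y := o :* x) refl 1# px py) (*-identityˡ px))))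
    (few 1# 0# px (λ (1≡0 , _) → 0≢1 (sym 1≡0)))

  module _ (P : List Point) (P-unique : Unique P) (t : Carrier)
           (ξ-injective : ∀ {p q} → p ∈ P → q ∈ P → Geometry.ξ R t p ≡ Geometry.ξ R t q → p ≡ q) where
    open Geometry R t
    open Lines R t
    open Configuration R t P P-unique ξ-injective
    open Bounds R t P P-unique ξ-injective using (L; lines-bound)

    determined : DeterminesAtLeast P L
    determined = ls , refl ,
      All.tabulate (λ {(a , b)} ℓ∈ → let a∈ , b∈ , a<b = line-ends ℓ∈ in a∈ , b∈ , λ { refl → <-irrefl a<b }) ,
      AllPairs.map (λ ¬same (pq , pq′) → ¬same (collinear⇒area pq , collinear⇒area pq′)) (distinct-AllPairs candidates)

    x≤ : ∀ {l ℓ} → AtMostCollinear P l → ℓ ∈ ls → x ℓ P ℕ.≤ l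
    x≤ {l} {ℓ@((ax , ay) , (bx , by))} few ℓ∈ = ℕ.≤-trans (subst (ℕ._≤ pointsOnLine A B C P) (length-filter-𝟙 (on? ℓ) P)
        (filter-mono-length (on? ℓ) (λ s → _≟ℝ_ R (A * proj₁ s + B * proj₂ s) C) P on⇒))
      (few A B C (λ (A≡0 , B≡0) → <-irrefl (subst (ξ (ax , ay) <_) (cong ξ (sym (cong₂ _,_ (sym (-≡0⇒≡ B≡0)) (-≡0⇒≡ A≡0)))) (proj₂ (proj₂ (line-ends ℓ∈))))))
      where
      A = ay - by
      B = bx - ax
      C = A * ax + B * ay
      on⇒ : ∀ {s} → On ℓ s → A * proj₁ s + B * proj₂ s ≡ C
      on⇒ {sx , sy} on = begin
        A * sx + B * sy
          ≡⟨ solve 6 (λ ax ay bx by sx sy → (ay :- by) :* sx :+ (bx :- ax) :* sy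
               := ((ay :- by) :* ax :+ (bx :- ax) :* ay) :+ ((bx :- ax) :* (sy :- ay) :- (by :- ay) :* (sx :- ax))) refl ax ay bx by sx sy ⟩
        C + ((bx - ax) * (sy - ay) - (by - ay) * (sx - ax))
          ≡⟨ cong (λ y → C + (y - (by - ay) * (sx - ax))) (area⇒collinear on) ⟩
        C + ((by - ay) * (sx - ax) - (by - ay) * (sx - ax))
          ≡⟨ solve 2 (λ c y → c :+ (y :- y) := c) refl C ((by - ay) * (sx - ax)) ⟩
        C ∎
        where open ≡-Reasoning

    beck : ∀ {l p q} → AtMostCollinear P l → p ∈ P → q ∈ P → p ≢ q → length P ℕ.* (length P ∸ l) ℕ.≤ 61 ℕ.* L
    beck {l} few p∈ q∈ p≢q =
      let ℓ , ℓ∈ , _ = joins p∈ q∈ p≢q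
          ℓ₀ , ℓ₀∈ , maximal = least-∈ {Q = λ _ → ⊤} (λ ℓ m → x m P ℕ.≤ x ℓ P) (λ ℓ m → ℕ.≤-total (x m P) (x ℓ P))
                                 (λ _ _ _ b≤a c≤b → ℕ.≤-trans c≤b b≤a) ls ℓ∈ _
      in ℕ.≤-trans (ℕ.*-monoʳ-≤ (length P) (ℕ.∸-monoʳ-≤ (length P) (x≤ few ℓ₀∈))) (by-size ℓ₀∈ maximal (x ℓ₀ P ℕ.<? length P))
      where
      by-size : ∀ {ℓ₀} → ℓ₀ ∈ ls → (∀ {ℓ} → ℓ ∈ ls → x ℓ P ℕ.≤ x ℓ₀ P) → Dec (x ℓ₀ P ℕ.< length P) →
                length P ℕ.* (length P ∸ x ℓ₀ P) ℕ.≤ 61 ℕ.* L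
      by-size ℓ₀∈ maximal (yes proper) = lines-bound ℓ₀∈ maximal proper
      by-size ℓ₀∈ maximal (no full) = ℕ.≤-trans (ℕ.≤-reflexive (trans
        (cong (length P ℕ.*_) (ℕ.m≤n⇒m∸n≡0 (ℕ.≮⇒≥ full))) (ℕ.*-zeroʳ (length P)))) z≤n

open import Data.Nat using (_*_; _≤_)

theorem2 : (R : RealField) → let open Plane R in
    (n l : ℕ) (P : List Point) → Unique P → length P ≡ n →
    AtMostCollinear P l →
    ∃ λ m → DeterminesAtLeast P m × n * (n ∸ l) ≤ 61 * m
theorem2 R n l [] _ refl _ = 0 , ([] , refl , [] , []) , z≤n
theorem2 R n l (p ∷ []) _ refl few = 0 , ([] , refl , [] , []) ,
  ℕ.≤-reflexive (trans (ℕ.+-identityʳ (1 ∸ l)) (ℕ.m≤n⇒m∸n≡0 (Beck.at-most-one-point R {l = l} few)))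
theorem2 R n l P@(p ∷ q ∷ _) unique@((p≢q ∷ _) ∷ _) refl few =
  let t , ξ-injective = Beck.generic-slope R P
  in _ , Beck.determined R P unique t ξ-injective ,
     Beck.beck R P unique t ξ-injective few (here refl) (there (here refl)) p≢q
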